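{- For every integer $m\ge 1$ there exists a primitive TSR matrix of order $2$ over $\mathbb{F}_{2^m}$; that is, there exist $c_0,c_1\in\mathbb{F}_2$ and $A\in M_m(\mathbb{F}_2)$ such that the characteristic polynomial $\det(XI_{2m}-T)\in\mathbb{F}_2[X]$ of the $2m\times 2m$ matrix $$T=\begin{pmatrix}\mathbf{0} & c_0A\\ I_m & c_1A\end{pmatrix}$$ is a primitive polynomial of degree $2m$ over $\mathbb{F}_2$.
   Context: A polynomial of degree $d$ over a finite field $\mathbb{F}_Q$ is primitive if it is monic and irreducible and one (equivalently every) root generates the cyclic group $\mathbb{F}_{Q^d}^*$. Here $I_m$ and $\mathbf{0}$ denote the $m\times m$ identity and zero matrices over $\mathbb{F}_2$. -}

module Defs where

open import Data.Bool using (Bool; true; false; _∧_; _xor_; if_then_else_)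
open import Data.Nat using (ℕ; zero; suc; _+_; _*_)
open import Data.Fin using (Fin; zero; suc; punchIn; splitAt; _≟_)
open import Data.List using (List; []; _∷_; length)
open import Data.Sum using (_⊎_; inj₁; inj₂)
open import Data.Product using (_×_; ∃)
open import Relation.Binary.PropositionalEquality using (_≡_)
open import Relation.Nullary using (¬_)
open import Relation.Nullary.Decidable using (⌊_⌋)

-- The field F₂ : Bool with xor as addition and ∧ as multiplication.

F₂ : Set
F₂ = Bool

-- Polynomials over F₂ : coefficient lists, lowest degree first.
-- Trailing zero coefficients are allowed; polynomial equality is _≈_.

Poly : Set
Poly = List F₂

normalize : Poly → Poly
normalize [] = []
normalize (a ∷ p) with normalize p
... | [] = if a then true ∷ [] else []
... | q ∷ qs = a ∷ q ∷ qs

_≈_ : Poly → Poly → Set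
p ≈ q = normalize p ≡ normalize q

0P 1P XP : Poly
0P = []
1P = true ∷ []
XP = false ∷ true ∷ []

constP : F₂ → Poly
constP a = a ∷ []

_+P_ : Poly → Poly → Poly
[] +P q = q
(a ∷ p) +P [] = a ∷ p
(a ∷ p) +P (b ∷ q) = (a xor b) ∷ (p +P q)

-- additive inverse in F₂[X] (coefficientwise −a = a in F₂)
negP : Poly → Poly
negP [] = []
negP (a ∷ p) = a ∷ negP p

_-P_ : Poly → Poly → Poly
p -P q = p +P negP q

scaleP : F₂ → Poly → Poly
scaleP a [] = []
scaleP a (b ∷ q) = (a ∧ b) ∷ scaleP a q

_*P_ : Poly → Poly → Poly
[] *P q = []
(a ∷ p) *P q = scaleP a q +P (false ∷ (p *P q))

_^P_ : Poly → ℕ → Poly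
p ^P zero = 1P
p ^P suc k = p *P (p ^P k)

Degree : Poly → ℕ → Set
Degree p d = length (normalize p) ≡ suc d

lead : Poly → F₂
lead p = go (normalize p)
  where
  go : Poly → F₂
  go [] = false
  go (a ∷ []) = a
  go (a ∷ b ∷ q) = go (b ∷ q)

Monic : Poly → Set
Monic p = lead p ≡ true

_∣P_ : Poly → Poly → Set
f ∣P g = ∃ λ q → g ≈ (q *P f)

-- units of F₂[X] are exactly the nonzero constants, i.e. 1
IsUnit : Poly → Set
IsUnit p = ∃ λ q → (p *P q) ≈ 1P

Irreducible : Poly → Set
Irreducible f = (¬ (f ≈ 0P)) × (¬ IsUnit f)
              × (∀ g h → f ≈ (g *P h) → IsUnit g ⊎ IsUnit h)

-- Primitive polynomial of degree d over F₂: monic, irreducible of degree d,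
-- and its root (the class of X in the field F₂[X]/(f) ≅ F_{2^d}) generates
-- the multiplicative group: every nonzero class [g] is a power of [X].
Primitive : Poly → ℕ → Set
Primitive f d = Monic f × Degree f d × Irreducible f
              × (∀ g → ¬ (f ∣P g) → ∃ λ k → f ∣P ((XP ^P k) -P g))

Mat : Set → ℕ → Set
Mat R n = Fin n → Fin n → R

sumP : ∀ {n} → (Fin n → Poly) → Poly
sumP {zero} f = 0P
sumP {suc n} f = f zero +P sumP (λ i → f (suc i))

signP : ℕ → Poly → Poly
signP zero p = p
signP (suc k) p = negP (signP k p)

toℕ' : ∀ {n} → Fin n → ℕ
toℕ' zero = zero
toℕ' (suc i) = suc (toℕ' i)

det : ∀ {n} → Mat Poly n → Poly
det {zero} M = 1P
det {suc n} M =
  sumP (λ j → signP (toℕ' j) (M zero j *P det (λ i k → M (suc i) (punchIn j k))))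

δ : ∀ {n} → Fin n → Fin n → F₂
δ i j = ⌊ i ≟ j ⌋

charPoly : ∀ {n} → Mat F₂ n → Poly
charPoly T = det (λ i j → (if δ i j then XP else 0P) -P constP (T i j))

tsr : ∀ m → F₂ → F₂ → Mat F₂ m → Mat F₂ (m + m)
tsr m c₀ c₁ A i j with splitAt m i | splitAt m j
... | inj₁ i' | inj₁ j' = false
... | inj₁ i' | inj₂ j' = c₀ ∧ A i' j'
... | inj₂ i' | inj₁ j' = δ i' j'
... | inj₂ i' | inj₂ j' = c₁ ∧ A i' j'

{-# OPTIONS --safe #-}
-- Put q = 2^m.  Necessarily c₀ = c₁ = 1, and T = (0 A; I A) has the eigenvalue α as soon as A has the eigenvalue
-- y = α²/(1+α).  If α ∈ F_{q²} is primitive and 1/α has trace 1 over F_q, then y = α^{q+1} ∈ F_q, so y is a root of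
-- a monic polynomial of degree m over F₂; for its companion matrix A the characteristic polynomial of T is monic of
-- degree 2m with the primitive root α, hence primitive.
--
-- So a primitive element of F_{q²} of trace 1 is needed.  Relative to a generator γ, the exponents i with
-- tr(γ^i) = 1 form a relative difference set modulo q²-1: there are q of them, and every nonzero difference occurs at
-- most once.  Computing the second moment of their distribution over the residue classes modulo e, for e ∣ q²-1, shows
-- that each class contains q/e of them up to an error √q.  The sieve of Eratosthenes over the primes dividing q²-1
-- then produces an exponent coprime to q²-1, provided that ∏ 2p/(p-1) < √q.  As 2p/(p-1) ≤ p^{1/6} for p ≥ 71, this
-- holds for m ≥ 41, and for smaller m it is checked directly, apart from 15 values of m for which an explicit
-- primitive polynomial is given.  The field F_{q²} comes from an irreducible factor of X^{q²} + X that divides no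
-- X^{2^e} + X with 0 < e < 2m.
module Submission where

-- For c₀ = 0 the matrix T is singular, and for c₁ = 0 its characteristic polynomial is a polynomial
-- in X², hence a square; this leaves c₀ = c₁ = 1. An eigenvalue y of A lying in F_q makes α a root
-- of X² + yX + y, whose two roots have equal sum and product: this is the origin of the condition
-- tr(1/α) = 1. The obstacle is to find an element that is primitive and has a prescribed trace.
-- Gauss sums would give the distribution of the trace-one exponents over residue classes; counting
-- pairs with a given difference yields the same error √q and stays within the natural numbers. The
-- exponent 1/6 comes from the budget of the sieve. The sieving primes multiply to at most N < q²,
-- so a cost of at most p^(1/6) for each large prime amounts to less than q^(1/3), while √q is
-- available. The remaining q^(1/6) pays for the 18 odd primes below 71. In sixth powers all of this
-- becomes an inequality between integers.

import Data.Nat.Properties as ℕ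
open import Data.Product.Base using (_×_; _,_; ∃; proj₁; proj₂)
open import Data.Sum.Base using (_⊎_; inj₁; inj₂; [_,_]′)
open import Function.Base using (id; _∘_)
open import Function.Definitions using (Injective)
open import Relation.Nullary using (¬_; contradiction; yes; no; Dec; ¬?; _×-dec_; _⊎-dec_; _→-dec_)
open import Relation.Binary.PropositionalEquality

-- The ring F₂[X] of coefficient lists up to trailing zeros.

module PolynomialRing where

  open import Defs
  open import Level using (0ℓ)
  open import Algebra.Bundles using (CommutativeRing)
  import Algebra.Solver.Ring.NaturalCoefficients.Default
  open import Data.Bool.Base using (Bool; true; false; _∧_; _xor_)
  open import Data.Bool.Properties using (xor-assoc; xor-comm; xor-same; xor-identityʳ; ∧-assoc; ∧-comm; ∧-zeroʳ; ∧-distribˡ-xor)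
  open import Data.List.Base using ([]; _∷_)
  open import Data.Nat.Base using (ℕ; zero; suc; _+_; _*_)
  import Relation.Binary.Reasoning.Setoid as SetoidReasoning

  coeff : Poly → ℕ → Bool
  coeff []      _       = false
  coeff (a ∷ p) zero    = a
  coeff (a ∷ p) (suc i) = coeff p i

  -- A record, so that Agda can infer p and q from a proof.
  record _≋_ (p q : Poly) : Set where
    constructor mk
    field at : ∀ i → coeff p i ≡ coeff q i
  open _≋_ public
  infix 4 _≋_

  -- What `normalize` does after its recursive call, as a function of its own, so that equations
  -- about `normalize` follow by congruence.
  cons : Bool → Poly → Poly
  cons true  []      = true ∷ []
  cons false []      = []
  cons a     (b ∷ p) = a ∷ b ∷ p

  normalize-∷ : ∀ a p → normalize (a ∷ p) ≡ cons a (normalize p)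
  normalize-∷ a p with normalize p
  normalize-∷ true  p | []    = refl
  normalize-∷ false p | []    = refl
  normalize-∷ true  p | _ ∷ _ = refl
  normalize-∷ false p | _ ∷ _ = refl

  coeff-cons : ∀ a p i → coeff (cons a p) i ≡ coeff (a ∷ p) i
  coeff-cons true  []      i       = refl
  coeff-cons false []      zero    = refl
  coeff-cons false []      (suc i) = refl
  coeff-cons true  (b ∷ p) i       = refl
  coeff-cons false (b ∷ p) i       = refl

  ∷-cong : ∀ {a b p q} → a ≡ b → p ≋ q → (a ∷ p) ≋ (b ∷ q)
  ∷-cong e f .at zero    = e
  ∷-cong e f .at (suc i) = f .at i

  coeff-normalize : ∀ p i → coeff (normalize p) i ≡ coeff p i
  coeff-normalize []      i = refl
  coeff-normalize (a ∷ p) i = begin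
    coeff (normalize (a ∷ p)) i       ≡⟨ cong (λ r → coeff r i) (normalize-∷ a p) ⟩
    coeff (cons a (normalize p)) i    ≡⟨ coeff-cons a (normalize p) i ⟩
    coeff (a ∷ normalize p) i         ≡⟨ ∷-cong refl (mk (coeff-normalize p)) .at i ⟩
    coeff (a ∷ p) i ∎
    where open ≡-Reasoning

  ≈⇒≋ : ∀ {p q} → p ≈ q → p ≋ q
  ≈⇒≋ {p} {q} e .at i =
    trans (sym (coeff-normalize p i)) (trans (cong (λ r → coeff r i) e) (coeff-normalize q i))

  ≋⇒≈ : ∀ {p q} → p ≋ q → p ≈ q
  ≋⇒≈ {[]}    {[]}    e = refl
  ≋⇒≈ {[]}    {b ∷ q} e = sym (trans (normalize-∷ b q)
    (cong₂ cons (sym (e .at 0)) (sym (≋⇒≈ {[]} {q} (mk λ i → e .at (suc i))))))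
  ≋⇒≈ {a ∷ p} {[]}    e = trans (normalize-∷ a p)
    (cong₂ cons (e .at 0) (≋⇒≈ {p} {[]} (mk λ i → e .at (suc i))))
  ≋⇒≈ {a ∷ p} {b ∷ q} e = trans (normalize-∷ a p) (trans
    (cong₂ cons (e .at 0) (≋⇒≈ {p} {q} (mk λ i → e .at (suc i)))) (sym (normalize-∷ b q)))

  ≋-refl : ∀ {p} → p ≋ p
  ≋-refl .at i = refl

  ≋-sym : ∀ {p q} → p ≋ q → q ≋ p
  ≋-sym e .at i = sym (e .at i)

  ≋-trans : ∀ {p q r} → p ≋ q → q ≋ r → p ≋ r
  ≋-trans e f .at i = trans (e .at i) (f .at i)

  coeff-+ : ∀ p q i → coeff (p +P q) i ≡ coeff p i xor coeff q i
  coeff-+ []      q       i       = refl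
  coeff-+ (a ∷ p) []      i       = sym (xor-identityʳ _)
  coeff-+ (a ∷ p) (b ∷ q) zero    = refl
  coeff-+ (a ∷ p) (b ∷ q) (suc i) = coeff-+ p q i

  coeff-scale : ∀ a p i → coeff (scaleP a p) i ≡ a ∧ coeff p i
  coeff-scale a []      i       = sym (∧-zeroʳ a)
  coeff-scale a (b ∷ p) zero    = refl
  coeff-scale a (b ∷ p) (suc i) = coeff-scale a p i

  negP≡id : ∀ p → negP p ≡ p
  negP≡id []      = refl
  negP≡id (a ∷ p) = cong (a ∷_) (negP≡id p)

  +-cong : ∀ {p p′ q q′} → p ≋ p′ → q ≋ q′ → (p +P q) ≋ (p′ +P q′)
  +-cong {p} {p′} {q} {q′} e f .at i = begin
    coeff (p +P q) i            ≡⟨ coeff-+ p q i ⟩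
    coeff p i xor coeff q i     ≡⟨ cong₂ _xor_ (e .at i) (f .at i) ⟩
    coeff p′ i xor coeff q′ i   ≡⟨ coeff-+ p′ q′ i ⟨
    coeff (p′ +P q′) i ∎
    where open ≡-Reasoning

  +-assoc : ∀ p q r → ((p +P q) +P r) ≋ (p +P (q +P r))
  +-assoc p q r .at i = begin
    coeff ((p +P q) +P r) i                     ≡⟨ trans (coeff-+ (p +P q) r i) (cong (_xor coeff r i) (coeff-+ p q i)) ⟩
    (coeff p i xor coeff q i) xor coeff r i     ≡⟨ xor-assoc (coeff p i) (coeff q i) (coeff r i) ⟩
    coeff p i xor (coeff q i xor coeff r i)     ≡⟨ trans (coeff-+ p (q +P r) i) (cong (coeff p i xor_) (coeff-+ q r i)) ⟨
    coeff (p +P (q +P r)) i ∎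
    where open ≡-Reasoning

  +-comm : ∀ p q → (p +P q) ≋ (q +P p)
  +-comm p q .at i = trans (coeff-+ p q i) (trans (xor-comm (coeff p i) (coeff q i)) (sym (coeff-+ q p i)))

  +-identityʳ : ∀ p → (p +P []) ≋ p
  +-identityʳ []      = ≋-refl
  +-identityʳ (a ∷ p) = ≋-refl

  +-self : ∀ p → (p +P p) ≋ []
  +-self p .at i = trans (coeff-+ p p i) (xor-same (coeff p i))

  +-interchange : ∀ p q r s → ((p +P q) +P (r +P s)) ≋ ((p +P r) +P (q +P s))
  +-interchange p q r s =
    ≋-trans (+-assoc p q (r +P s))
    (≋-trans (+-cong (≋-refl {p}) (≋-trans (≋-sym (+-assoc q r s)) (≋-trans (+-cong (+-comm q r) ≋-refl) (+-assoc r q s))))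
    (≋-sym (+-assoc p r (q +P s))))

  scale-cong : ∀ a {p q} → p ≋ q → scaleP a p ≋ scaleP a q
  scale-cong a {p} {q} e .at i =
    trans (coeff-scale a p i) (trans (cong (a ∧_) (e .at i)) (sym (coeff-scale a q i)))

  scale-false : ∀ p → scaleP false p ≋ []
  scale-false p .at i = coeff-scale false p i

  scale-true : ∀ p → scaleP true p ≋ p
  scale-true p .at i = coeff-scale true p i

  scale-distrib-+ : ∀ a p q → scaleP a (p +P q) ≋ (scaleP a p +P scaleP a q)
  scale-distrib-+ a p q .at i = begin
    coeff (scaleP a (p +P q)) i                ≡⟨ trans (coeff-scale a (p +P q) i) (cong (a ∧_) (coeff-+ p q i)) ⟩
    a ∧ (coeff p i xor coeff q i)              ≡⟨ ∧-distribˡ-xor a (coeff p i) (coeff q i) ⟩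
    (a ∧ coeff p i) xor (a ∧ coeff q i)        ≡⟨ cong₂ _xor_ (coeff-scale a p i) (coeff-scale a q i) ⟨
    coeff (scaleP a p) i xor coeff (scaleP a q) i ≡⟨ coeff-+ (scaleP a p) (scaleP a q) i ⟨
    coeff (scaleP a p +P scaleP a q) i ∎
    where open ≡-Reasoning

  scale-scale : ∀ a b p → scaleP a (scaleP b p) ≋ scaleP (a ∧ b) p
  scale-scale a b p .at i = begin
    coeff (scaleP a (scaleP b p)) i  ≡⟨ trans (coeff-scale a (scaleP b p) i) (cong (a ∧_) (coeff-scale b p i)) ⟩
    a ∧ (b ∧ coeff p i)              ≡⟨ ∧-assoc a b (coeff p i) ⟨
    (a ∧ b) ∧ coeff p i              ≡⟨ coeff-scale (a ∧ b) p i ⟨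
    coeff (scaleP (a ∧ b) p) i ∎
    where open ≡-Reasoning

  shift-[] : (false ∷ []) ≋ []
  shift-[] .at zero    = refl
  shift-[] .at (suc i) = refl

  *-congˡ : ∀ p {q r} → q ≋ r → (p *P q) ≋ (p *P r)
  *-congˡ []      e = ≋-refl
  *-congˡ (a ∷ p) e = +-cong (scale-cong a e) (∷-cong refl (*-congˡ p e))

  *-zeroʳ : ∀ p → (p *P []) ≋ []
  *-zeroʳ []      = ≋-refl
  *-zeroʳ (a ∷ p) = ≋-trans (∷-cong refl (*-zeroʳ p)) shift-[]

  -- The product recurses on its left factor; this is the same recursion on the right factor, and
  -- commutativity follows from the two by induction.
  *-∷ʳ : ∀ p b q → (p *P (b ∷ q)) ≋ (scaleP b p +P (false ∷ (p *P q)))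
  *-∷ʳ []      b q = ≋-sym shift-[]
  *-∷ʳ (a ∷ p) b q = ∷-cong (cong (_xor false) (∧-comm a b))
    (≋-trans (+-cong (≋-refl {scaleP a q}) (*-∷ʳ p b q))
    (≋-trans (≋-sym (+-assoc (scaleP a q) (scaleP b p) _))
    (≋-trans (+-cong (+-comm (scaleP a q) (scaleP b p)) ≋-refl)
             (+-assoc (scaleP b p) (scaleP a q) _))))

  *-comm : ∀ p q → (p *P q) ≋ (q *P p)
  *-comm []      q = ≋-sym (*-zeroʳ q)
  *-comm (a ∷ p) q = ≋-trans (+-cong (≋-refl {scaleP a q}) (∷-cong refl (*-comm p q))) (≋-sym (*-∷ʳ q a p))

  *-cong : ∀ {p p′ q q′} → p ≋ p′ → q ≋ q′ → (p *P q) ≋ (p′ *P q′)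
  *-cong {p} {p′} {q} {q′} e f =
    ≋-trans (*-congˡ p f) (≋-trans (*-comm p q′) (≋-trans (*-congˡ q′ e) (*-comm q′ p′)))

  *-distribˡ : ∀ p q r → (p *P (q +P r)) ≋ ((p *P q) +P (p *P r))
  *-distribˡ []      q r = ≋-refl
  *-distribˡ (a ∷ p) q r = ≋-trans
    (+-cong (scale-distrib-+ a q r) (∷-cong refl (*-distribˡ p q r)))
    (+-interchange (scaleP a q) (scaleP a r) (false ∷ (p *P q)) (false ∷ (p *P r)))

  *-distribʳ : ∀ p q r → ((q +P r) *P p) ≋ ((q *P p) +P (r *P p))
  *-distribʳ p q r = ≋-trans (*-comm (q +P r) p)
    (≋-trans (*-distribˡ p q r) (+-cong (*-comm p q) (*-comm p r)))

  shift-* : ∀ p q → ((false ∷ p) *P q) ≋ (false ∷ (p *P q))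
  shift-* p q = +-cong (scale-false q) ≋-refl

  scale-* : ∀ a p q → (scaleP a p *P q) ≋ scaleP a (p *P q)
  scale-* a []      q = ≋-refl
  scale-* a (b ∷ p) q = ≋-trans
    (+-cong (≋-sym (scale-scale a b q)) (∷-cong (sym (∧-zeroʳ a)) (scale-* a p q)))
    (≋-sym (scale-distrib-+ a (scaleP b q) (false ∷ (p *P q))))

  *-assoc : ∀ p q r → ((p *P q) *P r) ≋ (p *P (q *P r))
  *-assoc []      q r = ≋-refl
  *-assoc (a ∷ p) q r = ≋-trans (*-distribʳ r (scaleP a q) (false ∷ (p *P q)))
    (+-cong (scale-* a q r) (≋-trans (shift-* (p *P q) r) (∷-cong refl (*-assoc p q r))))

  *-identityˡ : ∀ p → (1P *P p) ≋ p
  *-identityˡ p = ≋-trans (+-cong (scale-true p) shift-[]) (+-identityʳ p)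

  polyRing : CommutativeRing 0ℓ 0ℓ
  polyRing = record
    { Carrier = Poly ; _≈_ = _≋_ ; _+_ = _+P_ ; _*_ = _*P_ ; -_ = λ p → p ; 0# = 0P ; 1# = 1P
    ; isCommutativeRing = record
      { isRing = record
        { +-isAbelianGroup = record
          { isGroup = record
            { isMonoid = record
              { isSemigroup = record
                { isMagma = record
                  { isEquivalence = record { refl = ≋-refl ; sym = ≋-sym ; trans = ≋-trans }
                  ; ∙-cong = +-cong }
                ; assoc = +-assoc }
              ; identity = (λ p → ≋-refl) , +-identityʳ }
            ; inverse = +-self , +-self
            ; ⁻¹-cong = λ e → e }
          ; comm = +-comm }
        ; *-cong = *-cong
        ; *-assoc = *-assoc
        ; *-identity = *-identityˡ , λ p → ≋-trans (*-comm p 1P) (*-identityˡ p)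
        ; distrib = *-distribˡ , *-distribʳ }
      ; *-comm = *-comm } }

  polySetoid = CommutativeRing.setoid polyRing
  module ≋-Reasoning = SetoidReasoning polySetoid

  module PolySolver = Algebra.Solver.Ring.NaturalCoefficients.Default (CommutativeRing.commutativeSemiring polyRing)

-- Degrees, division, Bézout's identity and the factors of X^(2^n) + X.

module Divisibility where

  open import Defs hiding (lead)
  open PolynomialRing
  open import Data.Bool.Base using (Bool; true; false; _∧_; _xor_)
  open import Data.Bool.Properties using (∧-zeroʳ)
  open import Data.List.Base using ([]; _∷_; length)
  open import Data.Nat.Base using (ℕ; zero; suc; _+_; _^_; _≤_; _<_; z≤n; s≤s; s≤s⁻¹)
  open import Data.Vec.Base using (Vec; []; _∷_; toList)

  -- Degree less than `d`, a condition that zero satisfies for every `d`, so that zero needs no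
  -- degree of its own.
  Below : Poly → ℕ → Set
  Below p d = ∀ i → d ≤ i → coeff p i ≡ false

  record HasDeg (p : Poly) (d : ℕ) : Set where
    constructor _,_
    field
      top  : coeff p d ≡ true
      rest : Below p (suc d)
  open HasDeg public

  below-tail : ∀ {a p d} → Below (a ∷ p) (suc d) → Below p d
  below-tail b i le = b (suc i) (s≤s le)

  below-∷ : ∀ {a p d} → Below p d → Below (a ∷ p) (suc d)
  below-∷ b (suc i) (s≤s le) = b i le

  below-mono : ∀ {p d e} → d ≤ e → Below p d → Below p e
  below-mono d≤e b i e≤i = b i (ℕ.≤-trans d≤e e≤i)

  below-cong : ∀ {p q d} → p ≋ q → Below p d → Below q d
  below-cong e b i le = trans (sym (e .at i)) (b i le)

  hasDeg-cong : ∀ {p q d} → p ≋ q → HasDeg p d → HasDeg q d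
  hasDeg-cong e (t , b) = trans (sym (e .at _)) t , below-cong e b

  below-0 : ∀ {p} → Below p 0 → p ≋ []
  below-0 b .at i = b i z≤n

  below-+ : ∀ {p q d} → Below p d → Below q d → Below (p +P q) d
  below-+ {p} {q} b c i le = trans (coeff-+ p q i) (cong₂ _xor_ (b i le) (c i le))

  below-scale : ∀ {a p d} → Below p d → Below (scaleP a p) d
  below-scale {a} {p} b i le = trans (coeff-scale a p i) (trans (cong (a ∧_) (b i le)) (∧-zeroʳ a))

  -- Degree at most `d` times degree less than `e`: the asymmetry avoids a truncated subtraction,
  -- and it is the form that expanding a determinant calls for.
  below-* : ∀ {p q d e} → Below p (suc d) → Below q e → Below (p *P q) (d + e)
  below-* {[]} b c i le = refl
  below-* {a ∷ p} {q} {zero} {e} b c = below-+ {scaleP a q} (below-scale {a} {q} c)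
    (below-cong (≋-sym zero-tail) λ i _ → refl)
    where
    zero-tail : (false ∷ (p *P q)) ≋ []
    zero-tail = ≋-trans (∷-cong refl (*-cong (below-0 {p} (below-tail {a} b)) (≋-refl {q}))) shift-[]
  below-* {a ∷ p} {q} {suc d} {e} b c = below-+ {scaleP a q}
    (below-mono {scaleP a q} (ℕ.m≤n+m e (suc d)) (below-scale {a} {q} c))
    (below-∷ (below-* {p} {q} {d} {e} (below-tail {a} b) c))

  hasDeg-* : ∀ {p q d e} → HasDeg p d → HasDeg q e → HasDeg (p *P q) (d + e)
  hasDeg-* {p} {q} {d} {e} hp hq =
    lead hp , subst (Below (p *P q)) (ℕ.+-suc d e) (below-* {p} {q} (rest hp) (rest hq))
    where
    lead : ∀ {p d} → HasDeg p d → coeff (p *P q) (d + e) ≡ true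
    lead {a ∷ p} {zero} (refl , b) = begin
      coeff (scaleP true q +P (false ∷ (p *P q))) e ≡⟨ +-cong (scale-true q) zero-tail .at e ⟩
      coeff (q +P []) e                             ≡⟨ +-identityʳ q .at e ⟩
      coeff q e                                     ≡⟨ top hq ⟩
      true ∎
      where
      open ≡-Reasoning
      zero-tail : (false ∷ (p *P q)) ≋ []
      zero-tail = ≋-trans (∷-cong refl (*-cong (below-0 {p} (below-tail {true} b)) (≋-refl {q}))) shift-[]
    lead {a ∷ p} {suc d} (t , b) = begin
      coeff (scaleP a q +P (false ∷ (p *P q))) (suc d + e)
        ≡⟨ coeff-+ (scaleP a q) (false ∷ (p *P q)) (suc d + e) ⟩
      coeff (scaleP a q) (suc d + e) xor coeff (p *P q) (d + e)
        ≡⟨ cong₂ _xor_ (below-scale {a} {q} (rest hq) (suc d + e) (s≤s (ℕ.m≤n+m e d)))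
                       (lead {p} {d} (t , below-tail {a} b)) ⟩
      true ∎
      where open ≡-Reasoning

  hasDeg-≢0 : ∀ {p d} → HasDeg p d → ¬ p ≋ []
  hasDeg-≢0 {p} {d} (t , _) e = contradiction (trans (sym t) (e .at d)) λ ()

  below⇒< : ∀ {p d e} → HasDeg p d → Below p e → d < e
  below⇒< {p} {d} {e} (t , _) b with ℕ.<-≤-connex d e
  ... | inj₁ d<e = d<e
  ... | inj₂ e≤d = contradiction (trans (sym t) (b d e≤d)) λ ()

  hasDeg-unique : ∀ {p d e} → HasDeg p d → HasDeg p e → d ≡ e
  hasDeg-unique hd he = ℕ.≤-antisym (s≤s⁻¹ (below⇒< hd (rest he))) (s≤s⁻¹ (below⇒< he (rest hd)))

  degree? : ∀ p → p ≋ [] ⊎ ∃ (HasDeg p)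
  degree? [] = inj₁ ≋-refl
  degree? (a ∷ p) with degree? p
  degree? (a ∷ p)     | inj₂ (d , t , b) = inj₂ (suc d , t , below-∷ b)
  degree? (true ∷ p)  | inj₁ e = inj₂ (0 , refl , below-∷ λ i _ → e .at i)
  degree? (false ∷ p) | inj₁ e = inj₁ (≋-trans (∷-cong refl e) shift-[])

  *-zero⇒zeroʳ : ∀ {p q d} → HasDeg p d → (p *P q) ≋ [] → q ≋ []
  *-zero⇒zeroʳ {p} {q} hp e with degree? q
  ... | inj₁ z        = z
  ... | inj₂ (_ , hq) = contradiction e (hasDeg-≢0 (hasDeg-* hp hq))

  +-zero⇒≋ : ∀ {p q} → (p +P q) ≋ [] → p ≋ q
  +-zero⇒≋ {p} {q} e = begin
    p                ≈⟨ +-identityʳ p ⟨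
    p +P []          ≈⟨ +-cong (≋-refl {p}) (+-self q) ⟨
    p +P (q +P q)    ≈⟨ +-assoc p q q ⟨
    (p +P q) +P q    ≈⟨ +-cong e ≋-refl ⟩
    q ∎
    where open ≋-Reasoning

  +-transpose : ∀ {p t r} → p ≋ (t +P r) → (p +P t) ≋ r
  +-transpose {p} {t} {r} e = begin
    p +P t           ≈⟨ +-cong e (≋-refl {t}) ⟩
    (t +P r) +P t    ≈⟨ solve 2 (λ t r → (t :+ r) :+ t := (t :+ t) :+ r) ≋-refl t r ⟩
    (t +P t) +P r    ≈⟨ +-cong (+-self t) ≋-refl ⟩
    r ∎
    where
    open ≋-Reasoning
    open PolySolver

  infix 4 _∣_
  _∣_ : Poly → Poly → Set
  p ∣ q = ∃ λ s → q ≋ (s *P p)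

  ∣-refl : ∀ {p} → p ∣ p
  ∣-refl {p} = 1P , ≋-sym (*-identityˡ p)

  ∣-trans : ∀ {p q r} → p ∣ q → q ∣ r → p ∣ r
  ∣-trans {p} (s , e) (t , f) = t *P s , ≋-trans f (≋-trans (*-congˡ t e) (≋-sym (*-assoc t s p)))

  ∣-+ : ∀ {p q r} → p ∣ q → p ∣ r → p ∣ (q +P r)
  ∣-+ {p} (s , e) (t , f) = s +P t , ≋-trans (+-cong e f) (≋-sym (*-distribʳ p s t))

  ∣-*ˡ : ∀ {p q} r → p ∣ q → p ∣ (r *P q)
  ∣-*ˡ {p} r (s , e) = r *P s , ≋-trans (*-congˡ r e) (≋-sym (*-assoc r s p))

  ∣-resp : ∀ {p q r} → q ≋ r → p ∣ q → p ∣ r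
  ∣-resp e (s , f) = s , ≋-trans (≋-sym e) f

  ∣-*ʳ : ∀ {p q} r → p ∣ q → p ∣ (q *P r)
  ∣-*ʳ {p} {q} r d = ∣-resp (*-comm r q) (∣-*ˡ r d)

  ∣-mul : ∀ {p q r s} → p ∣ q → r ∣ s → (p *P r) ∣ (q *P s)
  ∣-mul {p} {q} {r} {s} (a , e) (b , f) = a *P b , ≋-trans (*-cong e f)
    (solve 4 (λ a p b r → (a :* p) :* (b :* r) := (a :* b) :* (p :* r)) ≋-refl a p b r)
    where open PolySolver

  ∣-deg : ∀ {p q d e} → HasDeg p d → HasDeg q e → p ∣ q → d ≤ e
  ∣-deg {p} {q} {d} {e} hp hq (s , f) with degree? s
  ... | inj₁ z = contradiction (≋-trans f (*-cong z (≋-refl {p}))) (hasDeg-≢0 hq)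
  ... | inj₂ (c , hs) = subst (d ≤_) (hasDeg-unique (hasDeg-* hs hp) (hasDeg-cong f hq)) (ℕ.m≤n+m d c)

  hasDeg-1 : HasDeg 1P 0
  hasDeg-1 = refl , λ { (suc i) _ → refl }

  hasDeg-X^ : ∀ k → HasDeg (XP ^P k) k
  hasDeg-X^ zero    = hasDeg-1
  hasDeg-X^ (suc k) = hasDeg-* {XP} (refl , λ { (suc (suc i)) _ → refl ; (suc zero) (s≤s ()) }) (hasDeg-X^ k)

  hasDeg-+ : ∀ {p q d} → HasDeg p d → Below q d → HasDeg (p +P q) d
  hasDeg-+ {p} {q} {d} (t , b) c =
    trans (coeff-+ p q d) (cong₂ _xor_ t (c d ℕ.≤-refl)) ,
    below-+ {p} b (below-mono {q} (ℕ.n≤1+n d) c)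

  hasDeg0⇒1 : ∀ {p} → HasDeg p 0 → p ≋ 1P
  hasDeg0⇒1 (t , b) .at zero    = t
  hasDeg0⇒1 (t , b) .at (suc i) = b (suc i) (s≤s z≤n)

  -- Schoolbook division from the top coefficient down: a remainder of degree less than `e`, shifted
  -- by one place, has degree at most `e`, and over F₂ a single subtraction of `q` repairs it.
  divMod : ∀ p {q e} → HasDeg q e → ∃ λ s → ∃ λ r → p ≋ ((s *P q) +P r) × Below r e
  divMod [] hq = [] , [] , ≋-refl , λ _ _ → refl
  divMod (a ∷ p) {q} {e} hq@(t , b) with divMod p hq
  ... | s , r , eq , c with coeff (a ∷ r) e in ce
  ... | false = (false ∷ s) , (a ∷ r) , eq′ , below
    where
    eq′ : (a ∷ p) ≋ (((false ∷ s) *P q) +P (a ∷ r))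
    eq′ = ≋-trans (∷-cong refl eq) (+-cong (≋-sym (shift-* s q)) ≋-refl)
    below : Below (a ∷ r) e
    below i le with ℕ.m≤n⇒m<n∨m≡n le
    ... | inj₁ lt   = below-∷ {a} c i lt
    ... | inj₂ refl = ce
  ... | true = (true ∷ s) , ((a ∷ r) +P q) , eq′ , below
    where
    open ≋-Reasoning
    open PolySolver
    eq′ : (a ∷ p) ≋ (((true ∷ s) *P q) +P ((a ∷ r) +P q))
    eq′ = begin
      a ∷ p                                        ≈⟨ ∷-cong refl eq ⟩
      (false ∷ (s *P q)) +P (a ∷ r)                ≈⟨ +-transpose {(false ∷ (s *P q)) +P ((a ∷ r) +P q)} (≋-trans (≋-sym (+-assoc (false ∷ (s *P q)) (a ∷ r) q)) (+-comm _ q)) ⟨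
      ((false ∷ (s *P q)) +P ((a ∷ r) +P q)) +P q  ≈⟨ solve 3 (λ t r q → (t :+ r) :+ q := (q :+ t) :+ r) ≋-refl (false ∷ (s *P q)) ((a ∷ r) +P q) q ⟩
      (q +P (false ∷ (s *P q))) +P ((a ∷ r) +P q)  ≈⟨ +-cong (+-cong (scale-true q) (≋-refl {false ∷ (s *P q)})) ≋-refl ⟨
      ((true ∷ s) *P q) +P ((a ∷ r) +P q) ∎
    below : Below ((a ∷ r) +P q) e
    below i le with ℕ.m≤n⇒m<n∨m≡n le
    ... | inj₁ lt   = below-+ {a ∷ r} {q} (below-∷ {a} c) b i lt
    ... | inj₂ refl = trans (coeff-+ (a ∷ r) q e) (cong₂ _xor_ ce t)

  _∣?_ : ∀ {q e} → HasDeg q e → ∀ p → Dec (q ∣ p)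
  _∣?_ {q} {e} hq p with divMod p hq
  ... | s , r , eq , b with degree? r
  ... | inj₁ z = yes (s , ≋-trans eq (≋-trans (+-cong (≋-refl {s *P q}) z) (+-identityʳ _)))
  ... | inj₂ (d , hr) = no λ q∣p →
    ℕ.<⇒≱ (below⇒< {r} hr b) (∣-deg hq hr (∣-resp (+-transpose eq) (∣-+ {q} q∣p (s , ≋-refl))))

  record Bezout (p q : Poly) : Set where
    field
      gcd u v : Poly
      gcd∣p : gcd ∣ p
      gcd∣q : gcd ∣ q
      identity : gcd ≋ ((u *P p) +P (v *P q))

  bezout : ∀ p q → Bezout p q
  bezout p q = go _ p q λ i → end q i
    where
    end : ∀ q i → length q ≤ i → coeff q i ≡ false
    end []      i       _        = refl
    end (a ∷ q) (suc i) (s≤s le) = end q i le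
    base : ∀ p q → q ≋ [] → Bezout p q
    base p q e = record { gcd = p ; u = 1P ; v = [] ; gcd∣p = ∣-refl ; gcd∣q = [] , e
      ; identity = ≋-sym (≋-trans (+-identityʳ _) (*-identityˡ p)) }
    -- Fuel for Euclid's algorithm: `k` bounds the degree of the second argument, which drops at
    -- every division.
    go : ∀ k p q → Below q k → Bezout p q
    go zero    p q b = base p q (below-0 b)
    go (suc k) p q b with degree? q
    ... | inj₁ e        = base p q e
    ... | inj₂ (e , hq) with divMod p hq
    ... | s , r , eq , c = record
      { gcd = B.gcd ; u = B.v ; v = B.u +P (B.v *P s) ; gcd∣q = B.gcd∣p
      ; gcd∣p = ∣-resp (≋-sym eq) (∣-+ (∣-*ˡ s B.gcd∣p) B.gcd∣q)
      ; identity = begin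
          B.gcd                                    ≈⟨ B.identity ⟩
          (B.u *P q) +P (B.v *P r)                 ≈⟨ +-cong (≋-refl {B.u *P q}) (*-congˡ B.v (+-transpose eq)) ⟨
          (B.u *P q) +P (B.v *P (p +P (s *P q)))   ≈⟨ solve 5 (λ u q v p s → (u :* q) :+ (v :* (p :+ (s :* q))) := (v :* p) :+ ((u :+ (v :* s)) :* q)) ≋-refl B.u q B.v p s ⟩
          (B.v *P p) +P ((B.u +P (B.v *P s)) *P q) ∎ }
      where
      open ≋-Reasoning
      open PolySolver
      module B = Bezout (go k q r (below-mono {r} (s≤s⁻¹ (below⇒< {q} hq b)) c))

  -- With the leading 1 left implicit, the degree is part of the type and `anyVec?` can search all
  -- monic polynomials of a given degree.
  monic : ∀ {n} → Vec Bool n → Poly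
  monic []      = true ∷ []
  monic (a ∷ v) = a ∷ monic v

  hasDeg-monic : ∀ {n} (v : Vec Bool n) → HasDeg (monic v) n
  hasDeg-monic []      = hasDeg-1
  hasDeg-monic (a ∷ v) with hasDeg-monic v
  ... | t , b = t , below-∷ b

  low : ∀ n → Poly → Vec Bool n
  low zero    p       = []
  low (suc n) []      = false ∷ low n []
  low (suc n) (a ∷ p) = a ∷ low n p

  monic-low : ∀ {n p} → HasDeg p n → monic (low n p) ≋ p
  monic-low {zero}  h = ≋-sym (hasDeg0⇒1 h)
  monic-low {suc n} {a ∷ p} (t , b) = ∷-cong refl (monic-low (t , below-tail {a} b))

  toP-low : ∀ {n p} → Below p n → toList (low n p) ≋ p
  toP-low {zero} b = ≋-sym (below-0 b)
  toP-low {suc n} {[]}    b = ≋-trans (∷-cong refl (toP-low {n} {[]} λ _ _ → refl)) shift-[]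
  toP-low {suc n} {a ∷ p} b = ∷-cong refl (toP-low (below-tail {a} b))

  low-cong : ∀ n {p q} → p ≋ q → low n p ≡ low n q
  low-cong zero e = refl
  low-cong (suc n) {[]}    {[]}    e = refl
  low-cong (suc n) {[]}    {b ∷ q} e = cong₂ _∷_ (e .at 0) (low-cong n {[]} {q} (mk λ i → e .at (suc i)))
  low-cong (suc n) {a ∷ p} {[]}    e = cong₂ _∷_ (e .at 0) (low-cong n {p} {[]} (mk λ i → e .at (suc i)))
  low-cong (suc n) {a ∷ p} {b ∷ q} e = cong₂ _∷_ (e .at 0) (low-cong n {p} {q} (mk λ i → e .at (suc i)))

  low-toList : ∀ {n} (v : Vec Bool n) → low n (toList v) ≡ v
  low-toList []      = refl
  low-toList (a ∷ v) = cong (a ∷_) (low-toList v)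

  below-toList : ∀ {n} (v : Vec Bool n) → Below (toList v) n
  below-toList []      i       le       = refl
  below-toList (a ∷ v) (suc i) (s≤s le) = below-toList v i le

  anyVec? : ∀ {n} {P : Vec Bool n → Set} → (∀ v → Dec (P v)) → Dec (∃ P)
  anyVec? {zero} P? with P? []
  ... | yes h = yes ([] , h)
  ... | no ¬h = no λ { ([] , h) → ¬h h }
  anyVec? {suc n} P? with anyVec? (λ v → P? (false ∷ v)) | anyVec? (λ v → P? (true ∷ v))
  ... | yes (v , h) | _           = yes (false ∷ v , h)
  ... | no _        | yes (v , h) = yes (true ∷ v , h)
  ... | no ¬f       | no ¬t       = no λ { (false ∷ v , h) → ¬f (v , h) ; (true ∷ v , h) → ¬t (v , h) }

  -- Irreducibility arises as minimality: a divisor of `g` of least positive degree has no proper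
  -- divisors, as these would divide `g` too.
  record IrreducibleFactor (g : Poly) : Set where
    field
      {degree} : ℕ
      lower    : Vec Bool (suc degree)
      divides  : monic lower ∣ g
      minimal  : ∀ {h e} → HasDeg h e → h ∣ g → e ≤ degree → e ≡ 0

  irreducibleFactor : ∀ {g d} → HasDeg g (suc d) → IrreducibleFactor g
  irreducibleFactor {g} {d} hg = search d 0 (ℕ.+-identityʳ d) λ { _ _ z≤n → refl }
    where
    open IrreducibleFactor
    search : ∀ k e → k + e ≡ d → (∀ {h c} → HasDeg h c → h ∣ g → c ≤ e → c ≡ 0) → IrreducibleFactor g
    search k e eq none with anyVec? {suc e} (λ v → hasDeg-monic v ∣? g)
    ... | yes (v , v∣g) = record { lower = v ; divides = v∣g ; minimal = none }
    -- At degree `suc d` the search cannot fail, since `g` itself is a candidate.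
    search zero .d refl none | no ∄ =
      contradiction (low (suc d) g , 1P , ≋-sym (≋-trans (*-identityˡ _) (monic-low hg))) ∄
    search (suc k) e eq none | no ∄ = search k (suc e) (trans (ℕ.+-suc k e) eq) none′
      where
      none′ : ∀ {h c} → HasDeg h c → h ∣ g → c ≤ suc e → c ≡ 0
      none′ {h} hh h∣g le with ℕ.m≤n⇒m<n∨m≡n le
      ... | inj₁ lt   = none hh h∣g (s≤s⁻¹ lt)
      ... | inj₂ refl = contradiction (low (suc e) h , ∣-trans (1P , (≋-trans (≋-sym (monic-low hh)) (≋-sym (*-identityˡ _)))) h∣g) ∄

  -- The formal derivative through (a + X p)′ = p + X p′, which involves no integer multiples.
  deriv : Poly → Poly
  deriv []      = []
  deriv (a ∷ p) = p +P (false ∷ deriv p)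

  deriv-0 : ∀ {p} → p ≋ [] → deriv p ≋ []
  deriv-0 {[]}    e = ≋-refl
  deriv-0 {a ∷ p} e = ≋-trans (+-cong p≋0 (∷-cong refl (deriv-0 p≋0))) shift-[]
    where
    p≋0 : p ≋ []
    p≋0 .at i = e .at (suc i)

  deriv-cong : ∀ {p q} → p ≋ q → deriv p ≋ deriv q
  deriv-cong {[]}    {q}     e = ≋-sym (deriv-0 (≋-sym e))
  deriv-cong {a ∷ p} {[]}    e = deriv-0 e
  deriv-cong {a ∷ p} {b ∷ q} e = +-cong p≋q (∷-cong refl (deriv-cong p≋q))
    where
    p≋q : p ≋ q
    p≋q .at i = e .at (suc i)

  deriv-+ : ∀ p q → deriv (p +P q) ≋ (deriv p +P deriv q)
  deriv-+ []      q       = ≋-refl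
  deriv-+ (a ∷ p) []      = ≋-sym (+-identityʳ _)
  deriv-+ (a ∷ p) (b ∷ q) = ≋-trans (+-cong (≋-refl {p +P q}) (∷-cong refl (deriv-+ p q)))
    (+-interchange p q (false ∷ deriv p) (false ∷ deriv q))

  deriv-scale : ∀ a p → deriv (scaleP a p) ≋ scaleP a (deriv p)
  deriv-scale a []      = ≋-refl
  deriv-scale a (b ∷ p) = ≋-trans (+-cong (≋-refl {scaleP a p}) (∷-cong (sym (∧-zeroʳ a)) (deriv-scale a p)))
    (≋-sym (scale-distrib-+ a p (false ∷ deriv p)))

  deriv-* : ∀ p q → deriv (p *P q) ≋ ((deriv p *P q) +P (p *P deriv q))
  deriv-* []      q = ≋-refl
  deriv-* (a ∷ p) q = begin
    deriv (scaleP a q +P (false ∷ (p *P q)))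
      ≈⟨ deriv-+ (scaleP a q) (false ∷ (p *P q)) ⟩
    deriv (scaleP a q) +P ((p *P q) +P (false ∷ deriv (p *P q)))
      ≈⟨ +-cong (deriv-scale a q) (+-cong (≋-refl {p *P q}) (∷-cong refl (deriv-* p q))) ⟩
    scaleP a (deriv q) +P ((p *P q) +P ((false ∷ (deriv p *P q)) +P (false ∷ (p *P deriv q))))
      ≈⟨ solve 4 (λ w x y z → w :+ (x :+ (y :+ z)) := (x :+ y) :+ (w :+ z)) ≋-refl (scaleP a (deriv q)) (p *P q) (false ∷ (deriv p *P q)) (false ∷ (p *P deriv q)) ⟩
    ((p *P q) +P (false ∷ (deriv p *P q))) +P ((a ∷ p) *P deriv q)
      ≈⟨ +-cong (≋-trans (*-distribʳ q p (false ∷ deriv p)) (+-cong (≋-refl {p *P q}) (shift-* (deriv p) q))) ≋-refl ⟨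
    (deriv (a ∷ p) *P q) +P ((a ∷ p) *P deriv q) ∎
    where
    open ≋-Reasoning
    open PolySolver

  deriv-square : ∀ p → deriv (p *P p) ≋ []
  deriv-square p = ≋-trans (deriv-* p p) (≋-trans (+-cong (*-comm (deriv p) p) ≋-refl) (+-self (p *P deriv p)))

  -- Since (p²)′ = 2 p p′ = 0, differentiating g = s p² gives 1 = s′ p².
  square∣⇒unit : ∀ {p g} → deriv g ≋ 1P → (p *P p) ∣ g → p ∣ 1P
  square∣⇒unit {p} {g} dg (s , e) = deriv s *P p , (begin
    1P                                                  ≈⟨ dg ⟨
    deriv g                                             ≈⟨ deriv-cong e ⟩
    deriv (s *P (p *P p))                               ≈⟨ deriv-* s (p *P p) ⟩
    (deriv s *P (p *P p)) +P (s *P deriv (p *P p))      ≈⟨ +-cong (≋-refl {deriv s *P (p *P p)}) (≋-trans (*-congˡ s (deriv-square p)) (*-zeroʳ s)) ⟩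
    (deriv s *P (p *P p)) +P []                         ≈⟨ +-identityʳ _ ⟩
    deriv s *P (p *P p)                                 ≈⟨ *-assoc (deriv s) p p ⟨
    (deriv s *P p) *P p ∎)
    where open ≋-Reasoning

  X^-+ : ∀ a b → (XP ^P (a + b)) ≋ ((XP ^P a) *P (XP ^P b))
  X^-+ zero    b = ≋-sym (*-identityˡ _)
  X^-+ (suc a) b = ≋-trans (*-congˡ XP (X^-+ a b)) (≋-sym (*-assoc XP (XP ^P a) (XP ^P b)))

  frob : ℕ → Poly
  frob n = (XP ^P (2 ^ n)) +P XP

  deriv-frob : ∀ n → deriv (frob (suc n)) ≋ 1P
  deriv-frob n = begin
    deriv (frob (suc n))                         ≈⟨ deriv-+ (XP ^P (2 ^ suc n)) XP ⟩
    deriv (XP ^P (2 ^ suc n)) +P deriv XP        ≈⟨ +-cong (deriv-cong {XP ^P (2 ^ suc n)} square) (≋-refl {deriv XP}) ⟩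
    deriv ((XP ^P (2 ^ n)) *P (XP ^P (2 ^ n))) +P deriv XP ≈⟨ +-cong (deriv-square (XP ^P (2 ^ n))) (≋-refl {deriv XP}) ⟩
    deriv XP                                     ≈⟨ ∷-cong refl shift-[] ⟩
    1P ∎
    where
    open ≋-Reasoning
    square : (XP ^P (2 ^ suc n)) ≋ ((XP ^P (2 ^ n)) *P (XP ^P (2 ^ n)))
    square = subst (λ k → (XP ^P k) ≋ ((XP ^P (2 ^ n)) *P (XP ^P (2 ^ n)))) (cong (2 ^ n +_) (sym (ℕ.+-identityʳ (2 ^ n)))) (X^-+ (2 ^ n) (2 ^ n))

  1<2^ : ∀ n → 1 < 2 ^ suc n
  1<2^ zero    = ℕ.≤-refl
  1<2^ (suc n) = ℕ.≤-trans (1<2^ n) (ℕ.m≤m+n (2 ^ suc n) _)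

  hasDeg-frob : ∀ n → HasDeg (frob (suc n)) (2 ^ suc n)
  hasDeg-frob n = hasDeg-+ (hasDeg-X^ (2 ^ suc n)) (below-mono {XP} (1<2^ n) λ { (suc (suc i)) _ → refl ; (suc zero) (s≤s ()) })

  frobs : ℕ → Poly
  frobs zero    = 1P
  frobs (suc n) = frob (suc n) *P frobs n

  frob∣frobs : ∀ {e n} → e < n → frob (suc e) ∣ frobs n
  frob∣frobs {e} {suc n} (s≤s le) with ℕ.m≤n⇒m<n∨m≡n le
  ... | inj₁ lt   = ∣-*ˡ (frob (suc n)) (frob∣frobs lt)
  ... | inj₂ refl = ∣-*ʳ (frobs n) ∣-refl

  -- The sum 2 + 4 + ... + 2^n falls two short of the degree of `frob (suc n)`, so a common divisor
  -- of the two polynomials cannot be all of `frob (suc n)`.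
  hasDeg-frobs : ∀ n → ∃ λ d → HasDeg (frobs n) d × 2 + d ≡ 2 ^ suc n
  hasDeg-frobs zero = 0 , hasDeg-1 , refl
  hasDeg-frobs (suc n) with hasDeg-frobs n
  ... | d , hd , eq = 2 ^ suc n + d , hasDeg-* (hasDeg-frob n) hd ,
    trans (trans (sym (ℕ.+-assoc 2 (2 ^ suc n) d)) (trans (cong (_+ d) (ℕ.+-comm 2 (2 ^ suc n))) (ℕ.+-assoc (2 ^ suc n) 2 d)))
          (cong (2 ^ suc n +_) (trans eq (sym (ℕ.+-identityʳ (2 ^ suc n)))))

  -- Dividing X^(2^n) + X by its common part with the X^(2^e) + X, e < n, leaves a factor of positive
  -- degree, because the degrees 2^e add up to less than 2^n; as X^(2^n) + X is squarefree, an irreducible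
  -- factor of the quotient divides no X^(2^e) + X.
  newFactor : ∀ n → ∃ λ d → ∃ λ (v : Vec Bool (suc d)) → monic v ∣ frob (suc n)
    × (∀ {h e} → HasDeg h e → h ∣ monic v → e ≤ d → e ≡ 0)
    × (∀ {e} → e < n → ¬ monic v ∣ frob (suc e))
  newFactor n with bezout (frob (suc n)) (frobs n)
  ... | record { gcd = c ; u = u ; v = w ; gcd∣p = (g , eq) ; gcd∣q = c∣q ; identity = id }
    with degree? c | degree? g | hasDeg-frobs n
  ... | inj₁ z | _ | _ = contradiction (≋-trans eq (≋-trans (*-congˡ g z) (*-zeroʳ g))) (hasDeg-≢0 (hasDeg-frob n))
  ... | inj₂ _ | inj₁ z | _ = contradiction (≋-trans eq (*-cong z (≋-refl {c}))) (hasDeg-≢0 (hasDeg-frob n))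
  ... | inj₂ (dc , hc) | inj₂ (zero , hg) | (D , hD , eD) =
    contradiction (∣-deg hc hD c∣q) (ℕ.<⇒≱ (ℕ.≤-trans (ℕ.n≤1+n _) (ℕ.≤-reflexive
      (trans eD (hasDeg-unique (hasDeg-frob n) (hasDeg-cong (≋-sym eq) (hasDeg-* hg hc)))))))
  ... | inj₂ (dc , hc) | inj₂ (suc dg , hg) | _ = F.degree , F.lower , v∣P , minimal , new
    where
    module F = IrreducibleFactor (irreducibleFactor {g} hg)
    v∣P : monic F.lower ∣ frob (suc n)
    v∣P = ∣-trans F.divides (c , ≋-trans eq (*-comm g c))
    minimal : ∀ {h e} → HasDeg h e → h ∣ monic F.lower → e ≤ F.degree → e ≡ 0
    minimal hh h∣v = F.minimal hh (∣-trans h∣v F.divides)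
    new : ∀ {e} → e < n → ¬ monic F.lower ∣ frob (suc e)
    new e<n v∣e = contradiction (∣-deg (hasDeg-monic F.lower) hasDeg-1 (square∣⇒unit (deriv-frob n)
      (∣-resp (≋-sym eq) (∣-mul F.divides v∣c)))) λ ()
      where
      v∣c : monic F.lower ∣ c
      v∣c = ∣-resp (≋-sym id) (∣-+ (∣-*ˡ u v∣P) (∣-*ˡ w (∣-trans v∣e (frob∣frobs e<n))))

-- The quotient rings F₂[X]/(f) on bit vectors.

module QuotientRings where

  open import Defs hiding (lead)
  open PolynomialRing
  open Divisibility
  open import Algebra.Structures using (IsCommutativeRing)
  open import Data.Bool.Base using (Bool; true; false; _xor_; if_then_else_)
  open import Data.Bool.Properties using (xor-same; xor-identityʳ)
  open import Data.List.Base using ([]; _∷_)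
  open import Data.Nat.Base using (ℕ; zero; suc)
  open import Data.Vec.Base using (Vec; []; _∷_; toList; zipWith; replicate)

  _⊕_ : ∀ {n} → Vec Bool n → Vec Bool n → Vec Bool n
  _⊕_ = zipWith _xor_

  -- Multiplication of a remainder by X, plus `a`. The bit pushed out is the coefficient of X^n,
  -- which `reduce` trades for `v`, because X^n ≡ v modulo `monic v`.
  shiftIn : ∀ {n} → Bool → Vec Bool n → Vec Bool n × Bool
  shiftIn a []      = [] , a
  shiftIn a (b ∷ r) with shiftIn b r
  ... | s , t = a ∷ s , t

  reduce : ∀ {n} → Vec Bool n → Vec Bool n × Bool → Vec Bool n
  reduce v (s , false) = s
  reduce v (s , true)  = s ⊕ v

  toList-⊕ : ∀ {n} (u w : Vec Bool n) → toList (u ⊕ w) ≡ toList u +P toList w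
  toList-⊕ []      []      = refl
  toList-⊕ (a ∷ u) (b ∷ w) = cong (_ ∷_) (toList-⊕ u w)

  toList-shiftIn : ∀ {n} a (r v : Vec Bool n) →
    toList (reduce v (shiftIn a r)) ≋ ((a ∷ toList r) +P scaleP (proj₂ (shiftIn a r)) (monic v))
  toList-shiftIn {zero} false [] [] = ≋-sym shift-[]
  toList-shiftIn {zero} true  [] [] = ≋-sym shift-[]
  toList-shiftIn {suc n} a (b ∷ r) (c ∷ v) with shiftIn b r | toList-shiftIn b r v
  ... | s , false | e = ∷-cong (sym (xor-identityʳ a)) e
  ... | s , true  | e = ∷-cong refl e

  -- The ring F₂[X]/(f), with f = monic v and classes represented by their remainders.
  module Quotient {n : ℕ} (v : Vec Bool n) where

    f : Poly
    f = monic v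

    step : Bool → Vec Bool n → Vec Bool n
    step a r = reduce v (shiftIn a r)

    rem : Poly → Vec Bool n
    rem []      = replicate n false
    rem (a ∷ p) = step a (rem p)

    scaleV : Bool → Vec Bool n → Vec Bool n
    scaleV a w = if a then w else replicate n false

    -- The first factor has its own length `k`, which lets the recursion shorten it. All
    -- intermediate results are reduced, so products can be evaluated in certificates.
    horner : ∀ {k} → Vec Bool k → Vec Bool n → Vec Bool n
    horner []      w = replicate n false
    horner (a ∷ u) w = scaleV a w ⊕ step false (horner u w)

    infixl 7 _⊛_
    _⊛_ : Vec Bool n → Vec Bool n → Vec Bool n
    _⊛_ = horner

    0K 1K X : Vec Bool n
    0K = replicate n false
    1K = rem 1P
    X  = rem XP

    -- Congruence modulo f and the representation of classes are records, so that Agda can infer their arguments.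
    infix 4 _~_ _represents_
    record _~_ (p q : Poly) : Set where
      constructor ⟨_⟩
      field divides : f ∣ (p +P q)
    open _~_ public

    ≋⇒~ : ∀ {p q} → p ≋ q → p ~ q
    ≋⇒~ {p} {q} e = ⟨ [] , ≋-trans (+-cong e (≋-refl {q})) (+-self q) ⟩

    ~-sym : ∀ {p q} → p ~ q → q ~ p
    ~-sym {p} {q} ⟨ d ⟩ = ⟨ ∣-resp (+-comm p q) d ⟩

    ~-trans : ∀ {p q r} → p ~ q → q ~ r → p ~ r
    ~-trans {p} {q} {r} ⟨ d ⟩ ⟨ e ⟩ = ⟨ ∣-resp
      (≋-trans (+-interchange p q q r) (≋-trans (+-cong (≋-refl {p +P q}) (+-comm q r))
      (≋-trans (+-interchange p q r q) (≋-trans (+-cong (≋-refl {p +P r}) (+-self q)) (+-identityʳ _)))))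
      (∣-+ d e) ⟩

    ~-+ : ∀ {p p′ q q′} → p ~ p′ → q ~ q′ → (p +P q) ~ (p′ +P q′)
    ~-+ {p} {p′} {q} {q′} ⟨ d ⟩ ⟨ e ⟩ = ⟨ ∣-resp (+-interchange p p′ q q′) (∣-+ d e) ⟩

    ~-*ˡ : ∀ r {p q} → p ~ q → (r *P p) ~ (r *P q)
    ~-*ˡ r {p} {q} ⟨ d ⟩ = ⟨ ∣-resp (*-distribˡ r p q) (∣-*ˡ r d) ⟩

    ~-*ʳ : ∀ r {p q} → p ~ q → (p *P r) ~ (q *P r)
    ~-*ʳ r {p} {q} ⟨ d ⟩ = ⟨ ∣-resp (*-distribʳ r p q) (∣-*ʳ r d) ⟩

    ~-shift : ∀ a {p q} → p ~ q → (a ∷ p) ~ (a ∷ q)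
    ~-shift a {p} {q} ⟨ s , e ⟩ = ⟨ false ∷ s , ≋-trans
      (∷-cong (xor-same a) e) (≋-sym (shift-* s f)) ⟩

    toList-0 : ∀ {n} → toList (replicate n false) ≋ []
    toList-0 {zero}  = ≋-refl
    toList-0 {suc n} = ≋-trans (∷-cong refl (toList-0 {n})) shift-[]

    toList-step : ∀ a r → (a ∷ toList r) ~ toList (step a r)
    toList-step a r = ⟨ ∣-resp (≋-sym lemma) (multiple (proj₂ (shiftIn a r))) ⟩
      where
      t = proj₂ (shiftIn a r)
      p = a ∷ toList r
      lemma : (p +P toList (step a r)) ≋ scaleP t f
      lemma = ≋-trans (+-cong (≋-refl {p}) (toList-shiftIn a r v))
        (≋-trans (≋-sym (+-assoc p p (scaleP t f))) (+-cong (+-self p) ≋-refl))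
      multiple : ∀ t → f ∣ scaleP t f
      multiple true  = ∣-resp (≋-sym (scale-true f)) ∣-refl
      multiple false = [] , scale-false f

    ~-rem : ∀ p → p ~ toList (rem p)
    ~-rem []      = ≋⇒~ (≋-sym (toList-0 {n}))
    ~-rem (a ∷ p) = ~-trans {q = a ∷ toList (rem p)} (~-shift a {p} {toList (rem p)} (~-rem p)) (toList-step a (rem p))

    -- The difference of two remainders has degree below that of `f`, so `f` divides it only if it
    -- vanishes.
    ~-unique : ∀ u w → toList u ~ toList w → u ≡ w
    ~-unique u w d = trans (sym (low-toList u)) (trans (low-cong n (zero-sum d)) (low-toList w))
      where
      zero-sum : toList u ~ toList w → toList u ≋ toList w
      zero-sum ⟨ d ⟩ with degree? (toList u +P toList w)
      ... | inj₁ z       = +-zero⇒≋ z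
      ... | inj₂ (e , h) = contradiction (∣-deg (hasDeg-monic v) h d)
        (ℕ.<⇒≱ (below⇒< h (below-+ {toList u} {toList w} (below-toList u) (below-toList w))))

    ~⇒rem : ∀ {p q} → p ~ q → rem p ≡ rem q
    ~⇒rem {p} {q} d = ~-unique (rem p) (rem q)
      (~-trans {q = p} (~-sym {p} {toList (rem p)} (~-rem p)) (~-trans {p} {q} d (~-rem q)))

    rem⇒~ : ∀ {p q} → rem p ≡ rem q → p ~ q
    rem⇒~ {p} {q} e = ~-trans {q = toList (rem p)} (~-rem p)
      (subst (λ u → toList u ~ q) (sym e) (~-sym {q} {toList (rem q)} (~-rem q)))

    rem-cong : ∀ {p q} → p ≋ q → rem p ≡ rem q
    rem-cong e = ~⇒rem (≋⇒~ e)

    rem-toList : ∀ u → rem (toList u) ≡ u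
    rem-toList u = ~-unique _ u (~-sym {toList u} {toList (rem (toList u))} (~-rem (toList u)))

    toList-scaleV : ∀ a w → toList (scaleV a w) ≋ scaleP a (toList w)
    toList-scaleV true  w = ≋-sym (scale-true (toList w))
    toList-scaleV false w = ≋-trans (toList-0 {n}) (≋-sym (scale-false (toList w)))

    toList-⊛ : ∀ {k} (u : Vec Bool k) w → (toList u *P toList w) ~ toList (horner u w)
    toList-⊛ []      w = ≋⇒~ (≋-sym (toList-0 {n}))
    toList-⊛ (a ∷ u) w = subst ((scaleP a (toList w) +P (false ∷ (toList u *P toList w))) ~_)
      (sym (toList-⊕ (scaleV a w) (step false (horner u w))))
      (~-+ {scaleP a (toList w)} {toList (scaleV a w)} (≋⇒~ (≋-sym (toList-scaleV a w)))
        (~-trans {q = false ∷ toList (horner u w)}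
          (~-shift false {toList u *P toList w} (toList-⊛ u w)) (toList-step false (horner u w))))

    record _represents_ (u : Vec Bool n) (p : Poly) : Set where
      constructor rep
      field is-rem : u ≡ rem p
    open _represents_ public

    +-hom : ∀ {p q u w} → u represents p → w represents q → (u ⊕ w) represents (p +P q)
    +-hom {p} {q} (rep refl) (rep refl) = rep (trans (sym (rem-toList _))
      (trans (cong rem (toList-⊕ (rem p) (rem q))) (sym (~⇒rem (~-+ (~-rem p) (~-rem q))))))

    *-hom : ∀ {p q u w} → u represents p → w represents q → (u ⊛ w) represents (p *P q)
    *-hom {p} {q} (rep refl) (rep refl) = rep (trans (sym (rem-toList _)) (sym (~⇒rem
      (~-trans (~-*ʳ q (~-rem p)) (~-trans (~-*ˡ (toList (rem p)) (~-rem q)) (toList-⊛ (rem p) (rem q)))))))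

    lift : ∀ u → u represents toList u
    lift u = rep (sym (rem-toList u))

    -- How every ring law descends from F₂[X]: its two sides represent polynomials that the law
    -- identifies there.
    transfer : ∀ {p q u w} → u represents p → p ≋ q → w represents q → u ≡ w
    transfer (rep d) e (rep d′) = trans d (trans (rem-cong e) (sym d′))

    isCommutativeRing : IsCommutativeRing _≡_ _⊕_ _⊛_ id 0K 1K
    isCommutativeRing = record
      { isRing = record
        { +-isAbelianGroup = record
          { isGroup = record
            { isMonoid = record
              { isSemigroup = record
                { isMagma = record { isEquivalence = isEquivalence ; ∙-cong = cong₂ _⊕_ }
                ; assoc = λ u v w → transfer (+-hom (+-hom (lift u) (lift v)) (lift w)) (+-assoc (toList u) (toList v) (toList w)) (+-hom (lift u) (+-hom (lift v) (lift w))) }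
              ; identity = idˡ , λ u → trans (⊕-comm u 0K) (idˡ u) }
            ; inverse = inv , inv
            ; ⁻¹-cong = id }
          ; comm = ⊕-comm }
        ; *-cong = cong₂ _⊛_
        ; *-assoc = λ u v w → transfer (*-hom (*-hom (lift u) (lift v)) (lift w)) (*-assoc (toList u) (toList v) (toList w)) (*-hom (lift u) (*-hom (lift v) (lift w)))
        ; *-identity = *-idˡ , λ u → trans (⊛-comm u 1K) (*-idˡ u)
        ; distrib = distˡ , λ u v w → trans (⊛-comm (v ⊕ w) u) (trans (distˡ u v w) (cong₂ _⊕_ (⊛-comm u v) (⊛-comm u w))) }
      ; *-comm = ⊛-comm }
      where
      ⊕-comm : ∀ u w → u ⊕ w ≡ w ⊕ u
      ⊕-comm u w = transfer (+-hom (lift u) (lift w)) (+-comm (toList u) (toList w)) (+-hom (lift w) (lift u))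
      idˡ : ∀ u → 0K ⊕ u ≡ u
      idˡ u = transfer (+-hom (rep {p = []} refl) (lift u)) ≋-refl (lift u)
      inv : ∀ u → u ⊕ u ≡ 0K
      inv u = transfer (+-hom (lift u) (lift u)) (+-self (toList u)) (rep refl)
      ⊛-comm : ∀ u w → u ⊛ w ≡ w ⊛ u
      ⊛-comm u w = transfer (*-hom (lift u) (lift w)) (*-comm (toList u) (toList w)) (*-hom (lift w) (lift u))
      *-idˡ : ∀ u → 1K ⊛ u ≡ u
      *-idˡ u = transfer (*-hom (rep {p = 1P} refl) (lift u)) (*-identityˡ (toList u)) (lift u)
      distˡ : ∀ u v w → u ⊛ (v ⊕ w) ≡ (u ⊛ v) ⊕ (u ⊛ w)
      distˡ u v w = transfer (*-hom (lift u) (+-hom (lift v) (lift w))) (*-distribˡ (toList u) (toList v) (toList w)) (+-hom (*-hom (lift u) (lift v)) (*-hom (lift u) (lift w)))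

-- Commutative rings of characteristic 2: Frobenius, evaluation, determinants, eigenvectors.

module CharacteristicTwo where

  open import Defs using (Poly; 0P; XP; constP; _+P_; _*P_; _^P_; _-P_; sumP; signP; toℕ'; δ; tsr; charPoly) renaming (det to detP)
  open PolynomialRing using (_≋_; at; ≋-sym; negP≡id)
  open import Algebra.Bundles using (CommutativeRing)
  open import Algebra.Structures using (IsCommutativeRing)
  import Algebra.Properties.CommutativeMonoid.Sum
  import Algebra.Properties.Semiring.Sum
  import Algebra.Properties.CommutativeSemiring.Exp
  import Algebra.Solver.Ring.NaturalCoefficients.Default
  open import Data.Bool.Base using (Bool; true; false; _xor_; if_then_else_)
  open import Data.Fin.Base using (Fin; zero; suc; toℕ; fromℕ<; punchIn; splitAt; _↑ˡ_; _↑ʳ_)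
  open import Data.Fin.Patterns using (0F; 1F)
  open import Data.Fin.Permutation using (Permutation′; _⟨$⟩ʳ_; remove; punchIn-permute; transpose; lift₀)
  open import Data.Fin.Properties as Fin using (splitAt-↑ˡ; splitAt-↑ʳ)
  open import Data.List.Base using ([]; _∷_)
  open import Data.Nat.Base as ℕ using (ℕ; zero; suc)
  open import Level using (0ℓ)
  open ≡-Reasoning

  signP-id : ∀ k p → signP k p ≡ p
  signP-id zero    p = refl
  signP-id (suc k) p = trans (negP≡id _) (signP-id k p)

  -- Negation is the identity, so the inverse law says x + x ≡ 0#.
  record Char2Ring : Set₁ where
    infixl 6 _+_
    infixl 7 _*_
    field
      K     : Set
      _+_   : K → K → K
      _*_   : K → K → K
      0# 1# : K
      isCommutativeRing : IsCommutativeRing _≡_ _+_ _*_ id 0# 1#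

    commutativeRing : CommutativeRing 0ℓ 0ℓ
    commutativeRing = record { isCommutativeRing = isCommutativeRing }

  module Char2 (R : Char2Ring) where
    open Char2Ring R public
    open CommutativeRing commutativeRing public
      using (+-assoc; +-comm; +-identityˡ; +-identityʳ; *-assoc; *-comm; *-identityˡ; *-identityʳ; distribˡ; distribʳ; zeroˡ; zeroʳ; commutativeSemiring; semiring; +-commutativeMonoid; *-commutativeMonoid)
    open Algebra.Properties.CommutativeSemiring.Exp commutativeSemiring public
    open Algebra.Properties.CommutativeMonoid.Sum +-commutativeMonoid public
    open Algebra.Properties.Semiring.Sum semiring public using (*-distribˡ-sum; *-distribʳ-sum)

    module Solver = Algebra.Solver.Ring.NaturalCoefficients.Default commutativeSemiring
    open Solver using (solve; _:=_; _:+_; _:*_; con)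

    +-self : ∀ x → x + x ≡ 0#
    +-self = CommutativeRing.-‿inverseʳ commutativeRing

    +-zero⇒≡ : ∀ {x y} → x + y ≡ 0# → x ≡ y
    +-zero⇒≡ {x} {y} e = begin
      x            ≡⟨ +-identityʳ x ⟨
      x + 0#       ≡⟨ cong (x +_) (+-self y) ⟨
      x + (y + y)  ≡⟨ +-assoc x y y ⟨
      (x + y) + y  ≡⟨ cong (_+ y) e ⟩
      0# + y       ≡⟨ +-identityˡ y ⟩
      y ∎

    ≡⇒+-zero : ∀ {x y} → x ≡ y → x + y ≡ 0#
    ≡⇒+-zero {x} refl = +-self x

    1^ : ∀ n → 1# ^ n ≡ 1#
    1^ zero    = refl
    1^ (suc n) = trans (*-identityˡ _) (1^ n)

    ^-comm : ∀ x a b → (x ^ a) ^ b ≡ (x ^ b) ^ a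
    ^-comm x a b = trans (^-assocʳ x a b) (trans (cong (x ^_) (ℕ.*-comm a b)) (sym (^-assocʳ x b a)))

    square-+ : ∀ x y → (x + y) * (x + y) ≡ x * x + y * y
    square-+ x y = begin
      (x + y) * (x + y)                  ≡⟨ expand x y ⟩
      (x * x + y * y) + (x * y + x * y)  ≡⟨ cong (x * x + y * y +_) (+-self (x * y)) ⟩
      (x * x + y * y) + 0#               ≡⟨ +-identityʳ _ ⟩
      x * x + y * y ∎
      where
      expand : ∀ x y → (x + y) * (x + y) ≡ (x * x + y * y) + (x * y + x * y)
      expand = solve 2 (λ x y → (x :+ y) :* (x :+ y) := (x :* x :+ y :* y) :+ (x :* y :+ x :* y)) refl

    ^-2^suc : ∀ x n → x ^ (2 ℕ.^ suc n) ≡ x ^ (2 ℕ.^ n) * x ^ (2 ℕ.^ n)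
    ^-2^suc x n = trans (cong (λ k → x ^ (2 ℕ.^ n ℕ.+ k)) (ℕ.+-identityʳ (2 ℕ.^ n))) (^-homo-* x (2 ℕ.^ n) (2 ℕ.^ n))

    frobenius : ∀ n x y → (x + y) ^ (2 ℕ.^ n) ≡ x ^ (2 ℕ.^ n) + y ^ (2 ℕ.^ n)
    frobenius zero    x y = trans (*-identityʳ _) (sym (cong₂ _+_ (*-identityʳ x) (*-identityʳ y)))
    frobenius (suc n) x y = begin
      (x + y) ^ (2 ℕ.^ suc n)                           ≡⟨ ^-2^suc (x + y) n ⟩
      (x + y) ^ (2 ℕ.^ n) * (x + y) ^ (2 ℕ.^ n)         ≡⟨ cong (λ z → z * z) (frobenius n x y) ⟩
      (x ^ (2 ℕ.^ n) + y ^ (2 ℕ.^ n)) * (x ^ (2 ℕ.^ n) + y ^ (2 ℕ.^ n)) ≡⟨ square-+ _ _ ⟩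
      x ^ (2 ℕ.^ n) * x ^ (2 ℕ.^ n) + y ^ (2 ℕ.^ n) * y ^ (2 ℕ.^ n) ≡⟨ cong₂ _+_ (^-2^suc x n) (^-2^suc y n) ⟨
      x ^ (2 ℕ.^ suc n) + y ^ (2 ℕ.^ suc n) ∎

    ⌜_⌝ : Bool → K
    ⌜ false ⌝ = 0#
    ⌜ true  ⌝ = 1#

    ⌜⌝-xor : ∀ a b → ⌜ a xor b ⌝ ≡ ⌜ a ⌝ + ⌜ b ⌝
    ⌜⌝-xor false b     = sym (+-identityˡ _)
    ⌜⌝-xor true  false = sym (+-identityʳ _)
    ⌜⌝-xor true  true  = sym (+-self 1#)

    ⌜⌝-^ : ∀ a n → ⌜ a ⌝ ^ (2 ℕ.^ n) ≡ ⌜ a ⌝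
    ⌜⌝-^ true  n = 1^ (2 ℕ.^ n)
    ⌜⌝-^ false zero    = *-identityʳ _
    ⌜⌝-^ false (suc n) = trans (^-2^suc 0# n) (trans (cong₂ _*_ (⌜⌝-^ false n) (⌜⌝-^ false n)) (zeroˡ 0#))

    eval : K → Poly → K
    eval α []      = 0#
    eval α (a ∷ p) = ⌜ a ⌝ + α * eval α p

    module Eval (α : K) where
      ev : Poly → K
      ev = eval α

      ev-0 : ∀ {p} → p ≋ [] → ev p ≡ 0#
      ev-0 {[]}    e = refl
      ev-0 {a ∷ p} e = begin
        ⌜ a ⌝ + α * ev p ≡⟨ cong₂ (λ b x → ⌜ b ⌝ + α * x) (e .at 0) (ev-0 {p} (PolynomialRing.mk λ i → e .at (suc i))) ⟩
        0# + α * 0#      ≡⟨ trans (+-identityˡ _) (zeroʳ α) ⟩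
        0# ∎

      ev-cong : ∀ {p q} → p ≋ q → ev p ≡ ev q
      ev-cong {[]}    {q}     e = sym (ev-0 (≋-sym e))
      ev-cong {a ∷ p} {[]}    e = ev-0 e
      ev-cong {a ∷ p} {b ∷ q} e = cong₂ (λ b x → ⌜ b ⌝ + α * x) (e .at 0) (ev-cong {p} {q} (PolynomialRing.mk λ i → e .at (suc i)))

      ev-+ : ∀ p q → ev (p +P q) ≡ ev p + ev q
      ev-+ []      q       = sym (+-identityˡ _)
      ev-+ (a ∷ p) []      = sym (+-identityʳ _)
      ev-+ (a ∷ p) (b ∷ q) = trans (cong₂ (λ u x → u + α * x) (⌜⌝-xor a b) (ev-+ p q))
        (rearrange ⌜ a ⌝ ⌜ b ⌝ α (ev p) (ev q))
        where
        rearrange : ∀ a b α x y → (a + b) + α * (x + y) ≡ (a + α * x) + (b + α * y)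
        rearrange = solve 5 (λ a b α x y → (a :+ b) :+ α :* (x :+ y) := (a :+ α :* x) :+ (b :+ α :* y)) refl

      ev-scale : ∀ a p → ev (Defs.scaleP a p) ≡ ⌜ a ⌝ * ev p
      ev-scale true  p = trans (ev-cong (PolynomialRing.scale-true p)) (sym (*-identityˡ _))
      ev-scale false p = trans (ev-cong (PolynomialRing.scale-false p)) (sym (zeroˡ _))

      ev-shift : ∀ p → ev (false ∷ p) ≡ α * ev p
      ev-shift p = +-identityˡ _

      ev-* : ∀ p q → ev (p *P q) ≡ ev p * ev q
      ev-* []      q = sym (zeroˡ _)
      ev-* (a ∷ p) q = begin
        ev (Defs.scaleP a q +P (false ∷ (p *P q)))     ≡⟨ ev-+ (Defs.scaleP a q) (false ∷ (p *P q)) ⟩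
        ev (Defs.scaleP a q) + (0# + α * ev (p *P q))  ≡⟨ cong₂ _+_ (ev-scale a q) (trans (+-identityˡ _) (cong (α *_) (ev-* p q))) ⟩
        ⌜ a ⌝ * ev q + α * (ev p * ev q)               ≡⟨ collect ⌜ a ⌝ α (ev p) (ev q) ⟩
        (⌜ a ⌝ + α * ev p) * ev q ∎
        where
        collect : ∀ a α x y → a * y + α * (x * y) ≡ (a + α * x) * y
        collect = solve 4 (λ a α x y → a :* y :+ α :* (x :* y) := (a :+ α :* x) :* y) refl

      ev-const : ∀ a → ev (constP a) ≡ ⌜ a ⌝
      ev-const a = trans (cong (⌜ a ⌝ +_) (zeroʳ α)) (+-identityʳ _)

      ev-X : ev XP ≡ α
      ev-X = trans (ev-shift (true ∷ [])) (trans (cong (α *_) (ev-const true)) (*-identityʳ α))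

      ev-X^ : ∀ k → ev (XP ^P k) ≡ α ^ k
      ev-X^ zero    = ev-const true
      ev-X^ (suc k) = trans (ev-* XP (XP ^P k)) (cong₂ _*_ ev-X (ev-X^ k))

      -- The coefficients lie in F₂ and are fixed by the Frobenius, so p(α)^Q = p(α^Q).
      ev-frobenius : ∀ n → α ^ (2 ℕ.^ n) ≡ α → ∀ p → ev p ^ (2 ℕ.^ n) ≡ ev p
      ev-frobenius n e []      = ⌜⌝-^ false n
      ev-frobenius n e (a ∷ p) = begin
        (⌜ a ⌝ + α * ev p) ^ Q        ≡⟨ frobenius n ⌜ a ⌝ (α * ev p) ⟩
        ⌜ a ⌝ ^ Q + (α * ev p) ^ Q    ≡⟨ cong₂ _+_ (⌜⌝-^ a n) (^-distrib-* α (ev p) Q) ⟩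
        ⌜ a ⌝ + α ^ Q * ev p ^ Q      ≡⟨ cong (⌜ a ⌝ +_) (cong₂ _*_ e (ev-frobenius n e p)) ⟩
        ⌜ a ⌝ + α * ev p ∎
        where Q = 2 ℕ.^ n

    -- The expansion carries no signs, as -1 = 1: in characteristic 2 the determinant is the
    -- permanent.
    det : ∀ {n} → (Fin n → Fin n → K) → K
    det {zero}  M = 1#
    det {suc n} M = sum λ j → M zero j * det λ r c → M (suc r) (punchIn j c)

    sum-0 : ∀ n → sum {n} (λ _ → 0#) ≡ 0#
    sum-0 n = sum-replicate-zero n

    det-cong : ∀ {n} {M M′ : Fin n → Fin n → K} → (∀ r c → M r c ≡ M′ r c) → det M ≡ det M′
    det-cong {zero}  e = refl
    det-cong {suc n} e = sum-cong-≗ λ j → cong₂ _*_ (e zero j) (det-cong λ r c → e (suc r) (punchIn j c))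

    -- The corner term is common to both expansions. In the others, expanding each minor along its
    -- first column and interchanging the two sums exchanges the roles of row and column.
    det-column : ∀ {n} (M : Fin (suc n) → Fin (suc n) → K) →
      det M ≡ sum λ i → M i zero * det λ r c → M (punchIn i r) (suc c)
    det-column {zero}  M = refl
    det-column {suc n} M = cong (M 0F 0F * det (λ r c → M (suc r) (suc c)) +_) (begin
      sum (λ j → M 0F (suc j) * det λ r c → M (suc r) (punchIn (suc j) c))
        ≡⟨ sum-cong-≗ (λ j → trans (cong (M 0F (suc j) *_) (det-column λ r c → M (suc r) (punchIn (suc j) c)))
             (*-distribˡ-sum (M 0F (suc j)) λ i → M (suc i) 0F * D i j)) ⟩
      sum (λ j → sum λ i → M 0F (suc j) * (M (suc i) 0F * D i j))
        ≡⟨ ∑-comm (λ j i → M 0F (suc j) * (M (suc i) 0F * D i j)) ⟩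
      sum (λ i → sum λ j → M 0F (suc j) * (M (suc i) 0F * D i j))
        ≡⟨ sum-cong-≗ (λ i → trans (sum-cong-≗ λ j → swap (M 0F (suc j)) (M (suc i) 0F) (D i j))
             (sym (*-distribˡ-sum (M (suc i) 0F) λ j → M 0F (suc j) * D i j))) ⟩
      sum (λ i → M (suc i) 0F * det λ r c → M (punchIn (suc i) r) (suc c)) ∎)
      where
      D : Fin (suc n) → Fin (suc n) → K
      D i j = det λ r c → M (suc (punchIn i r)) (suc (punchIn j c))
      swap : ∀ x y z → x * (y * z) ≡ y * (x * z)
      swap = solve 3 (λ x y z → x :* (y :* z) := y :* (x :* z)) refl

    -- In the column expansion all rows play the same part: a permutation of the rows permutes the
    -- summands and acts on each minor by `remove i π`.
    det-permute : ∀ {n} (π : Permutation′ n) (M : Fin n → Fin n → K) → det (λ r → M (π ⟨$⟩ʳ r)) ≡ det M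
    det-permute {zero}  π M = refl
    det-permute {suc n} π M = begin
      det (λ r → M (π ⟨$⟩ʳ r))
        ≡⟨ det-column (λ r → M (π ⟨$⟩ʳ r)) ⟩
      sum (λ i → M (π ⟨$⟩ʳ i) 0F * det λ r c → M (π ⟨$⟩ʳ punchIn i r) (suc c))
        ≡⟨ sum-cong-≗ (λ i → cong (M (π ⟨$⟩ʳ i) 0F *_) (trans
             (det-cong λ r c → cong (λ k → M k (suc c)) (punchIn-permute π i r))
             (det-permute (remove i π) λ r c → M (punchIn (π ⟨$⟩ʳ i) r) (suc c)))) ⟩
      sum (λ i → M (π ⟨$⟩ʳ i) 0F * det λ r c → M (punchIn (π ⟨$⟩ʳ i) r) (suc c))
        ≡⟨ sum-permute (λ i → M i 0F * det λ r c → M (punchIn i r) (suc c)) π ⟨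
      sum (λ i → M i 0F * det λ r c → M (punchIn i r) (suc c))
        ≡⟨ det-column M ⟨
      det M ∎

    -- In the column expansion the terms of the two equal rows cancel, and every other minor still
    -- contains both rows.
    det-rows01 : ∀ {n} (M : Fin (suc (suc n)) → Fin (suc (suc n)) → K) → (∀ c → M 0F c ≡ M 1F c) → det M ≡ 0#
    det-rows01 {n} M e = begin
      det M ≡⟨ det-column M ⟩
      t 0F + (t 1F + sum (λ i → t (suc (suc i))))
        ≡⟨ cong₂ (λ x s → x + (t 1F + s)) first (trans (sum-cong-≗ rest) (sum-0 n)) ⟩
      t 1F + (t 1F + 0#) ≡⟨ cong (t 1F +_) (+-identityʳ _) ⟩
      t 1F + t 1F        ≡⟨ +-self _ ⟩
      0# ∎
      where
      t : Fin (suc (suc n)) → K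
      t i = M i 0F * det λ r c → M (punchIn i r) (suc c)
      first : t 0F ≡ t 1F
      first = cong₂ _*_ (e 0F) (det-cong {suc n} {λ r c → M (punchIn 0F r) (suc c)} {λ r c → M (punchIn 1F r) (suc c)} λ { zero c → sym (e (suc c)) ; (suc r) c → refl })
      zero-minor : ∀ {n} (M : Fin (suc (suc n)) → Fin (suc (suc n)) → K) → (∀ c → M 0F c ≡ M 1F c) →
        ∀ i → det (λ r c → M (punchIn (suc (suc i)) r) (suc c)) ≡ 0#
      zero-minor {suc n} M e i = det-rows01 (λ r c → M (punchIn (suc (suc i)) r) (suc c)) λ c → e (suc c)
      rest : ∀ i → t (suc (suc i)) ≡ 0#
      rest i = trans (cong (M (suc (suc i)) 0F *_) (zero-minor M e i)) (zeroʳ _)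

    det-equal-rows : ∀ {n} (M : Fin (suc n) → Fin (suc n) → K) j → (∀ c → M 0F c ≡ M (suc j) c) → det M ≡ 0#
    det-equal-rows {suc n} M j e = trans (sym (det-permute π M)) (det-rows01 (λ r → M (π ⟨$⟩ʳ r)) e)
      where
      π : Permutation′ (suc (suc n))
      π = lift₀ (transpose 0F j)

    -- Row 0 is a combination of the other rows, so linearity in row 0 reduces the determinant to
    -- ones with a repeated row. The normalisation `u 0F ≡ 1#` makes this work without division.
    det-left-kernel : ∀ {n} (M : Fin (suc n) → Fin (suc n) → K) (u : Fin (suc n) → K) → u 0F ≡ 1# →
      (∀ c → sum (λ r → u r * M r c) ≡ 0#) → det M ≡ 0#
    det-left-kernel {n} M u u₀ e = begin
      sum (λ c → M 0F c * D c)
        ≡⟨ sum-cong-≗ (λ c → trans (cong (_* D c) (row c)) (*-distribʳ-sum (D c) λ r → u (suc r) * M (suc r) c)) ⟩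
      sum (λ c → sum λ r → (u (suc r) * M (suc r) c) * D c)
        ≡⟨ ∑-comm (λ c r → (u (suc r) * M (suc r) c) * D c) ⟩
      sum (λ r → sum λ c → (u (suc r) * M (suc r) c) * D c)
        ≡⟨ sum-cong-≗ (λ r → trans (sum-cong-≗ λ c → *-assoc (u (suc r)) (M (suc r) c) (D c))
             (sym (*-distribˡ-sum (u (suc r)) λ c → M (suc r) c * D c))) ⟩
      sum (λ r → u (suc r) * det (replaced r))
        ≡⟨ sum-cong-≗ (λ r → trans (cong (u (suc r) *_) (det-equal-rows (replaced r) r λ _ → refl)) (zeroʳ _)) ⟩
      sum {n} (λ _ → 0#) ≡⟨ sum-0 n ⟩
      0# ∎
      where
      D : Fin (suc n) → K
      D c = det λ r k → M (suc r) (punchIn c k)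
      replaced : Fin n → Fin (suc n) → Fin (suc n) → K
      replaced r zero    c = M (suc r) c
      replaced r (suc i) c = M (suc i) c
      row : ∀ c → M 0F c ≡ sum λ r → u (suc r) * M (suc r) c
      row c = trans (sym (trans (cong (_* M 0F c) u₀) (*-identityˡ _))) (+-zero⇒≡ (e c))

    module _ (α : K) where
      open Eval α

      ev-sumP : ∀ {n} (g : Fin n → Poly) → ev (sumP g) ≡ sum λ i → ev (g i)
      ev-sumP {zero}  g = refl
      ev-sumP {suc n} g = trans (ev-+ (g 0F) _) (cong (ev (g 0F) +_) (ev-sumP (g ∘ suc)))

      ev-det : ∀ {n} (M : Fin n → Fin n → Poly) → ev (detP M) ≡ det λ r c → ev (M r c)
      ev-det {zero}  M = ev-const true
      ev-det {suc n} M = trans (ev-sumP λ j → signP (toℕ' j) (M 0F j *P detP (λ r c → M (suc r) (punchIn j c)))) (sum-cong-≗ λ j → begin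
        ev (signP (toℕ' j) (M 0F j *P detP (λ r c → M (suc r) (punchIn j c)))) ≡⟨ cong ev (signP-id (toℕ' j) _) ⟩
        ev (M 0F j *P detP (λ r c → M (suc r) (punchIn j c)))                  ≡⟨ ev-* (M 0F j) _ ⟩
        ev (M 0F j) * ev (detP (λ r c → M (suc r) (punchIn j c)))              ≡⟨ cong (ev (M 0F j) *_) (ev-det λ r c → M (suc r) (punchIn j c)) ⟩
        ev (M 0F j) * det (λ r c → ev (M (suc r) (punchIn j c))) ∎)

      ev-charPoly : ∀ {n} (T : Fin n → Fin n → Bool) →
        ev (charPoly T) ≡ det λ r c → ⌜ δ r c ⌝ * α + ⌜ T r c ⌝
      ev-charPoly T = trans (ev-det λ r c → (if δ r c then XP else 0P) -P constP (T r c)) (det-cong entry)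
        where
        diagonal : ∀ b → ev (if b then XP else 0P) ≡ ⌜ b ⌝ * α
        diagonal true  = trans ev-X (sym (*-identityˡ α))
        diagonal false = sym (zeroˡ α)
        entry : ∀ r c → ev ((if δ r c then XP else 0P) -P constP (T r c)) ≡ ⌜ δ r c ⌝ * α + ⌜ T r c ⌝
        entry r c = trans (ev-+ (if δ r c then XP else 0P) _) (cong₂ _+_ (diagonal (δ r c)) (ev-const (T r c)))

    sum-split : ∀ m {n} (g : Fin (m ℕ.+ n) → K) → sum g ≡ sum (λ i → g (i ↑ˡ n)) + sum (λ i → g (m ↑ʳ i))
    sum-split zero    g = sym (+-identityˡ _)
    sum-split (suc m) g = trans (cong (g 0F +_) (sum-split m (g ∘ suc))) (sym (+-assoc _ _ _))

    sum-δ : ∀ {n} (g : Fin n → K) c → sum (λ r → g r * ⌜ δ r c ⌝) ≡ g c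
    sum-δ {suc n} g zero = trans (cong₂ _+_ (*-identityʳ _) (trans (sum-cong-≗ λ r → zeroʳ (g (suc r))) (sum-0 n))) (+-identityʳ _)
    sum-δ {suc n} g (suc c) = trans (cong₂ _+_ (zeroʳ _) (trans (sum-cong-≗ λ r → cong (λ b → g (suc r) * ⌜ b ⌝) (δ-suc r)) (sum-δ (g ∘ suc) c))) (+-identityˡ _)
      where
      δ-suc : ∀ r → δ (suc r) (suc c) ≡ δ r c
      δ-suc r with r Fin.≟ c
      ... | yes _ = refl
      ... | no  _ = refl

    -- The companion matrix of X^m + Σ pᵢ Xⁱ: its columns shift, except the last, which is `p`. For
    -- a root y, the row (1, y, ..., y^(m-1)) is a left eigenvector with eigenvalue y.
    companion : ∀ {m} → (Fin m → Bool) → Fin m → Fin m → Bool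
    companion {m} p i j with suc (toℕ j) ℕ.<? m
    ... | yes j<m = δ i (fromℕ< j<m)
    ... | no  _   = p i

    companion-eigen : ∀ {m} (p : Fin m → Bool) y → y ^ m ≡ sum (λ i → y ^ toℕ i * ⌜ p i ⌝) →
      ∀ c → sum (λ i → y ^ toℕ i * ⌜ companion p i c ⌝) ≡ y * y ^ toℕ c
    companion-eigen {m} p y e c with suc (toℕ c) ℕ.<? m
    ... | yes c<m = trans (sum-δ (λ i → y ^ toℕ i) (fromℕ< c<m)) (cong (y ^_) (Fin.toℕ-fromℕ< c<m))
    ... | no  c≮m = trans (sym e) (cong (y ^_) (ℕ.≤-antisym (ℕ.≮⇒≥ c≮m) (Fin.toℕ<n c)))

    -- The row vector (u , α u) with u = (1 , y , … , y^(m-1)) satisfies uA = y u, hence is an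
    -- eigenvector of the TSR matrix with eigenvalue α whenever α² = (1 + α) y.
    tsr-root : ∀ {m} (p : Fin (suc m) → Bool) α y → y ^ suc m ≡ sum (λ i → y ^ toℕ i * ⌜ p i ⌝) →
      α * α ≡ (1# + α) * y → eval α (charPoly (tsr (suc m) true true (companion p))) ≡ 0#
    tsr-root {m} p α y ey eα = trans (ev-charPoly α T) (det-left-kernel M u refl kernel)
      where
      n = suc m
      A = companion p
      T = tsr n true true A
      M : Fin (n ℕ.+ n) → Fin (n ℕ.+ n) → K
      M r c = ⌜ δ r c ⌝ * α + ⌜ T r c ⌝
      w : Fin n → K
      w i = y ^ toℕ i
      u : Fin (n ℕ.+ n) → K
      u r = [ w , (λ i → α * w i) ]′ (splitAt n r)

      uˡ : ∀ i → u (i ↑ˡ n) ≡ w i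
      uˡ i = cong [ w , (λ i → α * w i) ]′ (splitAt-↑ˡ n i n)
      uʳ : ∀ i → u (n ↑ʳ i) ≡ α * w i
      uʳ i = cong [ w , (λ i → α * w i) ]′ (splitAt-↑ʳ n n i)

      uT : Fin (n ℕ.+ n) → K
      uT c = sum λ r → u r * ⌜ T r c ⌝

      Tˡˡ : ∀ i j → T (i ↑ˡ n) (j ↑ˡ n) ≡ false
      Tˡˡ i j rewrite splitAt-↑ˡ n i n | splitAt-↑ˡ n j n = refl
      Tˡʳ : ∀ i j → T (i ↑ˡ n) (n ↑ʳ j) ≡ A i j
      Tˡʳ i j rewrite splitAt-↑ˡ n i n | splitAt-↑ʳ n n j = refl
      Tʳˡ : ∀ i j → T (n ↑ʳ i) (j ↑ˡ n) ≡ δ i j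
      Tʳˡ i j rewrite splitAt-↑ʳ n n i | splitAt-↑ˡ n j n = refl
      Tʳʳ : ∀ i j → T (n ↑ʳ i) (n ↑ʳ j) ≡ A i j
      Tʳʳ i j rewrite splitAt-↑ʳ n n i | splitAt-↑ʳ n n j = refl

      uTˡ : ∀ j → uT (j ↑ˡ n) ≡ α * w j
      uTˡ j = begin
        uT (j ↑ˡ n) ≡⟨ sum-split n (λ r → u r * ⌜ T r (j ↑ˡ n) ⌝) ⟩
        _ + _ ≡⟨ cong₂ _+_
          (trans (sum-cong-≗ λ i → trans (cong (λ b → u (i ↑ˡ n) * ⌜ b ⌝) (Tˡˡ i j)) (zeroʳ _)) (sum-0 n))
          (trans (sum-cong-≗ λ i → cong₂ (λ x b → x * ⌜ b ⌝) (uʳ i) (Tʳˡ i j)) (sum-δ (λ i → α * w i) j)) ⟩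
        0# + α * w j ≡⟨ +-identityˡ _ ⟩
        α * w j ∎

      uTʳ : ∀ j → uT (n ↑ʳ j) ≡ α * (α * w j)
      uTʳ j = begin
        uT (n ↑ʳ j) ≡⟨ sum-split n (λ r → u r * ⌜ T r (n ↑ʳ j) ⌝) ⟩
        _ + _ ≡⟨ cong₂ _+_
          (trans (sum-cong-≗ λ i → cong₂ (λ x b → x * ⌜ b ⌝) (uˡ i) (Tˡʳ i j)) eigen)
          (trans (sum-cong-≗ λ i → trans (cong₂ (λ x b → x * ⌜ b ⌝) (uʳ i) (Tʳʳ i j)) (*-assoc α (w i) _))
            (trans (sym (*-distribˡ-sum α (λ i → w i * ⌜ A i j ⌝))) (cong (α *_) eigen))) ⟩
        y * w j + α * (y * w j)  ≡⟨ factor α y (w j) ⟩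
        ((1# + α) * y) * w j     ≡⟨ cong (_* w j) eα ⟨
        (α * α) * w j            ≡⟨ *-assoc α α (w j) ⟩
        α * (α * w j) ∎
        where
        eigen = companion-eigen p y ey j
        factor : ∀ α y w → y * w + α * (y * w) ≡ ((1# + α) * y) * w
        factor = solve 3 (λ α y w → y :* w :+ α :* (y :* w) := ((con 1 :+ α) :* y) :* w) refl

      uT≡αu : ∀ c → uT c ≡ α * u c
      uT≡αu c = cases (splitAt n c) refl
        where
        cases : ∀ s → splitAt n c ≡ s → uT c ≡ α * u c
        cases (inj₁ j) eq = subst (λ c → uT c ≡ α * u c) {y = c} (Fin.splitAt⁻¹-↑ˡ {m = n} eq)
          (trans (uTˡ j) (cong (α *_) (sym (uˡ j))))
        cases (inj₂ j) eq = subst (λ c → uT c ≡ α * u c) {y = c} (Fin.splitAt⁻¹-↑ʳ {m = n} eq)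
          (trans (uTʳ j) (cong (α *_) (sym (uʳ j))))

      kernel : ∀ c → sum (λ r → u r * M r c) ≡ 0#
      kernel c = begin
        sum (λ r → u r * (⌜ δ r c ⌝ * α + ⌜ T r c ⌝))
          ≡⟨ sum-cong-≗ (λ r → rearrange (u r) ⌜ δ r c ⌝ α ⌜ T r c ⌝) ⟩
        sum (λ r → α * u r * ⌜ δ r c ⌝ + u r * ⌜ T r c ⌝)
          ≡⟨ ∑-distrib-+ (λ r → α * u r * ⌜ δ r c ⌝) (λ r → u r * ⌜ T r c ⌝) ⟩
        sum (λ r → α * u r * ⌜ δ r c ⌝) + uT c
          ≡⟨ cong₂ _+_ (sum-δ (λ r → α * u r) c) (uT≡αu c) ⟩
        α * u c + α * u c ≡⟨ +-self _ ⟩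
        0# ∎
        where
        rearrange : ∀ u d α t → u * (d * α + t) ≡ α * u * d + u * t
        rearrange = solve 4 (λ u d α t → u :* (d :* α :+ t) := α :* u :* d :+ u :* t) refl

-- Degrees of characteristic polynomials, and primitivity from a root of full order.

module PrimitiveRoots where

  open import Defs using (Poly; 0P; 1P; XP; constP; _≈_; normalize; _+P_; _*P_; _^P_; _-P_; sumP; signP; toℕ'; δ; charPoly; _∣P_; IsUnit; Monic; Primitive; lead) renaming (det to detP)
  open PolynomialRing using (_≋_; coeff; ≈⇒≋; ≋⇒≈; ≋-sym; ≋-trans; negP≡id; normalize-∷; cons; module ≋-Reasoning)
  module P = PolynomialRing
  open Divisibility
  open QuotientRings
  open CharacteristicTwo
  open import Data.Bool.Base using (Bool; true; false; if_then_else_)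
  open import Data.Fin.Base as Fin using (Fin; zero; suc; toℕ; punchIn; punchOut; combine; remQuot)
  import Data.Fin.Properties as Fin
  open import Data.List.Base using ([]; _∷_; length)
  open import Data.Nat.Base as ℕ using (ℕ; zero; suc; _<_; z≤n; s≤s)
  import Data.Nat.Divisibility as ℕ
  open import Data.Vec.Base using (Vec; []; _∷_)
  open import Relation.Binary.Definitions using (tri<; tri≈; tri>)

  below-sumP : ∀ {n d} (g : Fin n → Poly) → (∀ i → Below (g i) d) → Below (sumP g) d
  below-sumP {zero}  g b i le = refl
  below-sumP {suc n} g b      = below-+ {g zero} (b zero) (below-sumP (g ∘ suc) (b ∘ suc))

  below-sign : ∀ k {p d} → Below p d → Below (signP k p) d
  below-sign k {p} = subst (λ q → Below q _) (sym (signP-id k p))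

  below-det : ∀ {n} (M : Fin n → Fin n → Poly) → (∀ r c → Below (M r c) 2) → Below (detP M) (suc n)
  below-det {zero}  M b = rest hasDeg-1
  below-det {suc n} M b = below-sumP (λ j → signP (toℕ' j) (M zero j *P detP λ r c → M (suc r) (punchIn j c))) λ j →
    below-sign (toℕ' j) {M zero j *P detP λ r c → M (suc r) (punchIn j c)}
    (below-* {M zero j} (b zero j) (below-det (λ r c → M (suc r) (punchIn j c)) λ r c → b (suc r) (punchIn j c)))

  -- Needed for the minors of off-diagonal entries: deleting column `suc j` takes the X out of row
  -- `suc j`, which costs one degree.
  below-det-constant-row : ∀ {n} (M : Fin (suc n) → Fin (suc n) → Poly) → (∀ r c → Below (M r c) 2) →
    ∀ i → (∀ c → Below (M i c) 1) → Below (detP M) (suc n)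
  below-det-constant-row M b zero k = below-sumP (λ j → signP (toℕ' j) (M zero j *P detP λ r c → M (suc r) (punchIn j c))) λ j →
    below-sign (toℕ' j) {M zero j *P detP λ r c → M (suc r) (punchIn j c)}
    (below-* {M zero j} (k j) (below-det (λ r c → M (suc r) (punchIn j c)) λ r c → b (suc r) (punchIn j c)))
  below-det-constant-row {suc n} M b (suc i) k = below-sumP (λ j → signP (toℕ' j) (M zero j *P detP λ r c → M (suc r) (punchIn j c))) λ j →
    below-sign (toℕ' j) {M zero j *P detP λ r c → M (suc r) (punchIn j c)}
    (below-* {M zero j} (b zero j) (below-det-constant-row (λ r c → M (suc r) (punchIn j c))
      (λ r c → b (suc r) (punchIn j c)) i λ c → k (punchIn j c)))

  hasDeg-det : ∀ {n} (M : Fin n → Fin n → Poly) → (∀ r → HasDeg (M r r) 1) →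
    (∀ r c → r ≢ c → Below (M r c) 1) → HasDeg (detP M) n
  hasDeg-det {zero}  M h b = hasDeg-1
  hasDeg-det {suc n} M h b = hasDeg-+
    (hasDeg-* (h zero) (hasDeg-det (λ r c → M (suc r) (suc c)) (h ∘ suc) λ r c r≢c → b (suc r) (suc c) (r≢c ∘ Fin.suc-injective)))
    (below-sumP (λ j → signP (suc (toℕ' j)) (M zero (suc j) *P detP λ r c → M (suc r) (punchIn (suc j) c)))
      λ j → below-sign (suc (toℕ' j)) {M zero (suc j) *P detP λ r c → M (suc r) (punchIn (suc j) c)} (term j))
    where
    entries : ∀ r c → Below (M r c) 2
    entries r c with r Fin.≟ c
    ... | yes refl = rest (h r)
    ... | no r≢c   = below-mono {M r c} (s≤s z≤n) (b r c r≢c)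
    minor : ∀ {n} (M : Fin (suc n) → Fin (suc n) → Poly) → (∀ r c → Below (M r c) 2) → (∀ r c → r ≢ c → Below (M r c) 1) →
      ∀ j → Below (detP λ r c → M (suc r) (punchIn (suc j) c)) n
    minor {suc n} M e b j = below-det-constant-row (λ r c → M (suc r) (punchIn (suc j) c))
      (λ r c → e (suc r) (punchIn (suc j) c)) j λ c → b (suc j) (punchIn (suc j) c) (Fin.punchInᵢ≢i (suc j) c ∘ sym)
    term : ∀ j → Below (M zero (suc j) *P detP (λ r c → M (suc r) (punchIn (suc j) c))) (suc n)
    term j = below-* {M zero (suc j)} (entries zero (suc j)) (minor M entries b j)

  hasDeg-charPoly : ∀ {n} (T : Fin n → Fin n → Bool) → HasDeg (charPoly T) n
  hasDeg-charPoly T = hasDeg-det (λ r c → (if δ r c then XP else 0P) -P constP (T r c)) diagonal off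
    where
    diagonal : ∀ r → HasDeg ((if δ r r then XP else 0P) -P constP (T r r)) 1
    diagonal r with r Fin.≟ r
    ... | yes _  = refl , λ { (suc (suc i)) _ → refl ; (suc zero) (s≤s ()) }
    ... | no r≢r = contradiction refl r≢r
    off : ∀ r c → r ≢ c → Below ((if δ r c then XP else 0P) -P constP (T r c)) 1
    off r c r≢c with r Fin.≟ c
    ... | yes r≡c = contradiction r≡c r≢c
    ... | no _    = λ { (suc i) _ → refl }

  length-normalize : ∀ {p d} → HasDeg p d → length (normalize p) ≡ suc d
  length-normalize {a ∷ p} {zero} (refl , b) = trans (cong length (normalize-∷ true p))
    (cong (length ∘ cons true) (≋⇒≈ {p} {[]} (below-0 (below-tail {true} b))))
  length-normalize {a ∷ p} {suc d} (t , b) =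
    trans (cong length (normalize-∷ a p)) (length-cons a (length-normalize {p} (t , below-tail {a} b)))
    where
    length-cons : ∀ a {q} → length q ≡ suc d → length (cons a q) ≡ suc (suc d)
    length-cons true  {_ ∷ q} e = cong suc e
    length-cons false {_ ∷ q} e = cong suc e

  hasDeg⇒monic : ∀ {p d} → HasDeg p d → Monic p
  hasDeg⇒monic {p} {d} h = trans (lead≡g (normalize p) refl)
    (ends-true (normalize p) d (length-normalize h) (trans (P.coeff-normalize p d) (top h)))
    where
    -- The local function of lead cannot be named, but unification finds it.
    g : Poly → Bool
    g = _
    lead≡g : ∀ q → normalize p ≡ q → lead p ≡ g q
    lead≡g q e rewrite e = refl
    ends-true : ∀ q d → length q ≡ suc d → coeff q d ≡ true → g q ≡ true
    ends-true (a ∷ [])    zero    e t = t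
    ends-true (a ∷ b ∷ q) (suc d) e t = ends-true (b ∷ q) d (ℕ.suc-injective e) t

  encode : ∀ {n} → Vec Bool n → Fin (2 ℕ.^ n)
  encode []          = zero
  encode {suc n} (false ∷ v) = combine {2} {2 ℕ.^ n} zero (encode v)
  encode {suc n} (true  ∷ v) = combine {2} {2 ℕ.^ n} (suc zero) (encode v)

  decode : ∀ {n} → Fin (2 ℕ.^ n) → Vec Bool n
  decode {zero}  i = []
  decode {suc n} i with remQuot {2} (2 ℕ.^ n) i
  ... | zero     , j = false ∷ decode j
  ... | suc zero , j = true  ∷ decode j

  decode-encode : ∀ {n} (v : Vec Bool n) → decode (encode v) ≡ v
  decode-encode [] = refl
  decode-encode {suc n} (false ∷ v) rewrite Fin.remQuot-combine {2} {2 ℕ.^ n} zero (encode v) = cong (false ∷_) (decode-encode v)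
  decode-encode {suc n} (true  ∷ v) rewrite Fin.remQuot-combine {2} {2 ℕ.^ n} (suc zero) (encode v) = cong (true ∷_) (decode-encode v)

  encode-decode : ∀ {n} (i : Fin (2 ℕ.^ n)) → encode (decode {n} i) ≡ i
  encode-decode {zero} zero = refl
  encode-decode {suc n} i with remQuot {2} (2 ℕ.^ n) i in eq
  ... | zero     , j = trans (cong (combine {2} {2 ℕ.^ n} zero) (encode-decode {n} j))
    (trans (cong (λ x → combine {2} {2 ℕ.^ n} (proj₁ x) (proj₂ x)) (sym eq)) (Fin.combine-remQuot {2} (2 ℕ.^ n) i))
  ... | suc zero , j = trans (cong (combine {2} {2 ℕ.^ n} (suc zero)) (encode-decode {n} j))
    (trans (cong (λ x → combine {2} {2 ℕ.^ n} (proj₁ x) (proj₂ x)) (sym eq)) (Fin.combine-remQuot {2} (2 ℕ.^ n) i))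

  encode-injective : ∀ {n} {u v : Vec Bool n} → encode u ≡ encode v → u ≡ v
  encode-injective {u = u} {v} e = trans (sym (decode-encode u)) (trans (cong decode e) (decode-encode v))

  injective⇒hits : ∀ {m n} → n ≡ m → (g : Fin m → Fin n) → Injective _≡_ _≡_ g → ∀ t → ∃ λ i → g i ≡ t
  injective⇒hits {suc m} refl g inj t with Fin.any? (λ i → g i Fin.≟ t)
  ... | yes hit = hit
  ... | no miss = contradiction
    (Fin.injective⇒≤ {f = λ i → punchOut {i = t} {g i} (λ e → miss (i , sym e))}
      (λ {i} {j} e → inj (Fin.punchOut-injective (λ e → miss (i , sym e)) (λ e → miss (j , sym e)) e)))
    ℕ.1+n≰n

  -- Pigeonhole: `z` and the values `x 0`, ..., `x (N - 1)` are N + 1 distinct elements of a set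
  -- that has no more. It serves for powers of X modulo a polynomial and for discrete logarithms.
  exhaust : ∀ {M N} {S : Set} (enc : S → Fin M) → Injective _≡_ _≡_ enc → M ≡ suc N → (z : S) (x : ℕ → S) →
    (∀ {i} → i < N → x i ≢ z) → (∀ {i j} → i < j → j < N → x i ≢ x j) →
    ∀ s → s ≢ z → ∃ λ i → i < N × s ≡ x i
  exhaust {M} {N} {S} enc enc-injective size z x nonzero distinct s s≢z
    with injective⇒hits size (enc ∘ h) (h-injective _ _ ∘ enc-injective) (enc s)
    where
    h : Fin (suc N) → S
    h zero    = z
    h (suc i) = x (toℕ i)
    h-injective : ∀ i j → h i ≡ h j → i ≡ j
    h-injective zero    zero    e = refl
    h-injective zero    (suc j) e = contradiction (sym e) (nonzero (Fin.toℕ<n j))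
    h-injective (suc i) zero    e = contradiction e (nonzero (Fin.toℕ<n i))
    h-injective (suc i) (suc j) e with ℕ.<-cmp (toℕ i) (toℕ j)
    ... | tri< i<j _ _ = contradiction e (distinct i<j (Fin.toℕ<n j))
    ... | tri≈ _ i≡j _ = cong suc (Fin.toℕ-injective i≡j)
    ... | tri> _ _ j<i = contradiction (sym e) (distinct j<i (Fin.toℕ<n i))
  ... | zero  , e = contradiction (enc-injective (sym e)) s≢z
  ... | suc i , e = toℕ i , Fin.toℕ<n i , enc-injective (sym e)

  module Order (R : Char2Ring) where
    open Char2 R

    -- The half of "α has order N" that keeps the powers below `N` distinct. The inverse is explicit
    -- because the ring is not assumed to be a field.
    record OrderMultiple (N : ℕ) (α : K) : Set where
      field
        inverse   : K
        inverseʳ  : α * inverse ≡ 1#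
        nontrivial : 1# ≢ 0#
        order∣    : ∀ {k} → α ^ k ≡ 1# → N ℕ.∣ k

    module OrderProperties {N α} (ord : OrderMultiple N α) where
      open OrderMultiple ord public

      ^-inverse : ∀ k → α ^ k * inverse ^ k ≡ 1#
      ^-inverse k = trans (sym (^-distrib-* α inverse k)) (trans (cong (_^ k) inverseʳ) (1^ k))

      ^-nonzero : ∀ k → α ^ k ≢ 0#
      ^-nonzero k e = nontrivial (trans (sym (^-inverse k)) (trans (cong (_* inverse ^ k) e) (zeroˡ _)))

      ^-cancel : ∀ i d → α ^ i ≡ α ^ (i ℕ.+ d) → α ^ d ≡ 1#
      ^-cancel i d e = begin
        α ^ d                                    ≡⟨ *-identityˡ _ ⟨
        1# * α ^ d                               ≡⟨ cong (_* α ^ d) (^-inverse i) ⟨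
        α ^ i * inverse ^ i * α ^ d              ≡⟨ shuffle (α ^ i) (inverse ^ i) (α ^ d) ⟩
        α ^ i * α ^ d * inverse ^ i              ≡⟨ cong (_* inverse ^ i) (trans (sym (^-homo-* α i d)) (sym e)) ⟩
        α ^ i * inverse ^ i                      ≡⟨ ^-inverse i ⟩
        1# ∎
        where
        open ≡-Reasoning
        open Solver
        shuffle : ∀ x y z → x * y * z ≡ x * z * y
        shuffle = solve 3 (λ x y z → x :* y :* z := x :* z :* y) refl

      ^-distinct : ∀ {i j} → i < j → j < N → α ^ i ≢ α ^ j
      ^-distinct {i} {j} i<j j<N e = ℕ.<⇒≱ (ℕ.≤-<-trans (ℕ.m∸n≤m j i) j<N)
        (ℕ.∣⇒≤ {{ℕ.>-nonZero (ℕ.m<n⇒0<n∸m i<j)}} (order∣ (^-cancel i (j ℕ.∸ i) (trans e (cong (α ^_) (sym (ℕ.m+[n∸m]≡n (ℕ.<⇒≤ i<j))))))))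

  module _ (R : Char2Ring) where
    open Char2 R
    open Order R

    -- The powers X^i with i < N stay distinct when evaluated at α, so they exhaust the N nonzero
    -- classes modulo `f`. This is generation. It also gives irreducibility: if f = g h and neither
    -- class is zero, then g(α) and h(α) are powers of the unit α, although f(α) = 0.
    root⇒primitive : ∀ {n N α f} → 2 ℕ.^ n ≡ suc N → 0 < n → HasDeg f n → eval α f ≡ 0# → OrderMultiple N α → Primitive f n
    root⇒primitive {n} {N} {α} {f} size 0<n hf root ord =
      hasDeg⇒monic hf , length-normalize hf , (f≉0 , f-nonunit , f-irreducible) , generates
      where
      open OrderProperties ord
      open Eval α
      module Q = Quotient (low n f)

      f≋ : Q.f ≋ f
      f≋ = monic-low hf

      root′ : ∀ {p} → Q.f ∣ p → ev p ≡ 0#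
      root′ {p} (s , e) = trans (ev-cong e) (trans (ev-* s Q.f) (trans (cong (ev s *_) (trans (ev-cong f≋) root)) (zeroʳ _)))

      ev-rem : ∀ {p q} → Q.rem p ≡ Q.rem q → ev p ≡ ev q
      ev-rem {p} {q} e = +-zero⇒≡ (trans (sym (ev-+ p q)) (root′ (Q.divides (Q.rem⇒~ {p} {q} e))))

      X^ : ℕ → Vec Bool n
      X^ i = Q.rem (XP ^P i)

      X^-nonzero : ∀ {i} → i < N → X^ i ≢ Q.0K
      X^-nonzero {i} _ e = ^-nonzero i (trans (sym (ev-X^ i)) (ev-rem {XP ^P i} {[]} e))

      X^-distinct : ∀ {i j} → i < j → j < N → X^ i ≢ X^ j
      X^-distinct {i} {j} i<j j<N e =
        ^-distinct i<j j<N (trans (sym (ev-X^ i)) (trans (ev-rem {XP ^P i} {XP ^P j} e) (ev-X^ j)))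

      -- Abstract, because with-abstraction over power g would normalise the proofs inside.
      abstract
        power : ∀ p → Q.rem p ≢ Q.0K → ∃ λ k → k < N × Q.rem p ≡ X^ k
        power p = exhaust encode encode-injective size Q.0K X^ X^-nonzero X^-distinct (Q.rem p)

      rem-0⇒∣ : ∀ {p} → Q.rem p ≡ Q.0K → f ∣ p
      rem-0⇒∣ {p} e with Q.divides (Q.rem⇒~ {p} {[]} e)
      ... | s , d = s , ≋-trans (≋-sym (P.+-identityʳ p)) (≋-trans d (P.*-congˡ s f≋))

      rem-nonzero⇒ev-unit : ∀ p → Q.rem p ≢ Q.0K → ∃ λ k → ev p ≡ α ^ k
      rem-nonzero⇒ev-unit p nz with power p nz
      ... | k , _ , e = k , trans (ev-rem {p} {XP ^P k} e) (ev-X^ k)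

      f≉0 : ¬ f ≈ 0P
      f≉0 e = hasDeg-≢0 hf (≈⇒≋ {f} {0P} e)

      f-nonunit : ¬ IsUnit f
      f-nonunit (q , e) = ℕ.<⇒≱ 0<n (∣-deg hf hasDeg-1 (q , ≋-trans (≋-sym (≈⇒≋ {f *P q} {1P} e)) (P.*-comm f q)))

      -- With g = s f the factorisation reads f = s f h, and cancelling `f` leaves s h = 1.
      factor⇒unit : ∀ {g h} → f ≋ (g *P h) → f ∣ g → IsUnit h
      factor⇒unit {g} {h} e (s , d) = s , ≋⇒≈ (+-zero⇒≋ (*-zero⇒zeroʳ hf zero-product))
        where
        open ≋-Reasoning
        zero-product : (f *P ((h *P s) +P 1P)) ≋ []
        zero-product = begin
          f *P ((h *P s) +P 1P)          ≈⟨ P.*-distribˡ f (h *P s) 1P ⟩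
          (f *P (h *P s)) +P (f *P 1P)   ≈⟨ P.+-cong (begin
            f *P (h *P s)   ≈⟨ P.*-comm f (h *P s) ⟩
            (h *P s) *P f   ≈⟨ P.*-assoc h s f ⟩
            h *P (s *P f)   ≈⟨ P.*-congˡ h d ⟨
            h *P g          ≈⟨ P.*-comm h g ⟩
            g *P h          ≈⟨ e ⟨
            f ∎) (≋-trans (P.*-comm f 1P) (P.*-identityˡ f)) ⟩
          f +P f                         ≈⟨ P.+-self f ⟩
          [] ∎

      f-irreducible : ∀ g h → f ≈ (g *P h) → IsUnit g ⊎ IsUnit h
      f-irreducible g h e with ≡-dec (Q.rem g) Q.0K | ≡-dec (Q.rem h) Q.0K
        where
        open import Data.Vec.Properties using () renaming (≡-dec to vec-dec)
        open import Data.Bool.Properties using (_≟_)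
        ≡-dec = vec-dec {n = n} _≟_
      ... | yes g≡0 | _ = inj₂ (factor⇒unit {g} {h} (≈⇒≋ {f} {g *P h} e) (rem-0⇒∣ {g} g≡0))
      ... | no _ | yes h≡0 = inj₁ (factor⇒unit {h} {g} (≋-trans (≈⇒≋ {f} {g *P h} e) (P.*-comm g h)) (rem-0⇒∣ {h} h≡0))
      ... | no g≢0 | no h≢0 with rem-nonzero⇒ev-unit g g≢0 | rem-nonzero⇒ev-unit h h≢0
      ... | a , ea | b , eb = contradiction (begin
        α ^ (a ℕ.+ b)  ≡⟨ ^-homo-* α a b ⟩
        α ^ a * α ^ b  ≡⟨ cong₂ _*_ ea eb ⟨
        ev g * ev h    ≡⟨ ev-* g h ⟨
        ev (g *P h)    ≡⟨ ev-cong (≈⇒≋ {f} {g *P h} e) ⟨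
        ev f           ≡⟨ root ⟩
        0# ∎) (^-nonzero (a ℕ.+ b))
        where open ≡-Reasoning

      generates : ∀ g → ¬ Defs._∣P_ f g → ∃ λ k → f ∣P ((XP ^P k) -P g)
      generates g f∤g with power g (λ e → let s , d = rem-0⇒∣ {g} e in f∤g (s , ≋⇒≈ d))
      ... | k , _ , e with Q.divides (Q.rem⇒~ {XP ^P k} {g} (sym e))
      ... | s , d = k , s , ≋⇒≈ (≋-trans (subst (λ q → ((XP ^P k) +P q) ≋ (s *P Q.f)) (sym (negP≡id g)) d) (P.*-congˡ s f≋))

-- From a primitive element with tr(1/α) = 1 to a primitive TSR matrix.

module TSRMatrices where

  open import Defs using (XP; _+P_; _*P_; _^P_; charPoly; tsr; Primitive)
  open PolynomialRing using (_≋_)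
  open Divisibility
  open CharacteristicTwo
  open PrimitiveRoots
  open import Data.Bool.Base using (Bool; true)
  open import Data.Fin.Base as Fin using (Fin; zero; suc; toℕ; fromℕ<)
  import Data.Fin.Properties as Fin
  open import Data.List.Base using ([]; _∷_)
  open import Data.Nat.Base as ℕ using (ℕ; zero; suc; _<_; _≤_; z≤n; s≤s)
  import Data.Nat.Divisibility as ℕ
  open import Data.Nat.Solver using (module +-*-Solver)
  open import Data.Vec.Base using (Vec; []; _∷_; lookup; toList)
  open import Relation.Nullary.Decidable using (map′)

  -- q₁ stands for q - 1 where q = 2 ^ m
  2^2*m : ∀ m {q₁} → 2 ℕ.^ m ≡ suc q₁ → 2 ℕ.^ (2 ℕ.* m) ≡ suc (q₁ ℕ.* (2 ℕ.+ q₁))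
  2^2*m m {q₁} e = begin
    2 ℕ.^ (m ℕ.+ (m ℕ.+ 0))     ≡⟨ cong (λ k → 2 ℕ.^ (m ℕ.+ k)) (ℕ.+-identityʳ m) ⟩
    2 ℕ.^ (m ℕ.+ m)             ≡⟨ ℕ.^-distribˡ-+-* 2 m m ⟩
    2 ℕ.^ m ℕ.* 2 ℕ.^ m         ≡⟨ cong (λ q → q ℕ.* q) e ⟩
    suc q₁ ℕ.* suc q₁           ≡⟨ solve 1 (λ x → (con 1 :+ x) :* (con 1 :+ x) := con 1 :+ x :* (con 2 :+ x)) refl q₁ ⟩
    suc (q₁ ℕ.* (2 ℕ.+ q₁)) ∎
    where
    open ≡-Reasoning
    open +-*-Solver

  module PrimitiveRoot (R : Char2Ring) {M N} (size : M ≡ suc N)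
    (enc : Char2Ring.K R → Fin M) (enc-injective : Injective _≡_ _≡_ enc) where
    open Char2 R
    open Order R

    infix 4 _≟_
    _≟_ : (x y : K) → Dec (x ≡ y)
    x ≟ y = map′ enc-injective (cong enc) (enc x Fin.≟ enc y)

    record PrimitiveElement (γ : K) : Set where
      field
        orderMultiple : OrderMultiple N γ
        γ^N≡1 : γ ^ N ≡ 1#

      open OrderProperties orderMultiple public

      abstract
        log : ∀ x → x ≢ 0# → ∃ λ k → k < N × x ≡ γ ^ k
        log = exhaust enc enc-injective size 0# (γ ^_) (λ {k} _ → ^-nonzero k) ^-distinct

      ^-N* : ∀ k → γ ^ (N ℕ.* k) ≡ 1#
      ^-N* k = trans (sym (^-assocʳ γ N k)) (trans (cong (_^ k) γ^N≡1) (1^ k))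

  module Subfield (R : Char2Ring) {m q₁} (2^m : 2 ℕ.^ m ≡ suc q₁) (0<q₁ : 0 < q₁)
    (enc : Char2Ring.K R → Fin (2 ℕ.^ (2 ℕ.* m))) (enc-injective : Injective _≡_ _≡_ enc) where
    open Char2 R
    open PrimitiveRoot R (2^2*m m 2^m) enc enc-injective public
    q = suc q₁
    N = q₁ ℕ.* suc q

    ^-2^m : ∀ x → x ^ (2 ℕ.^ m) ≡ x ^ q
    ^-2^m x = cong (x ^_) 2^m

    frobenius-q : ∀ x y → (x + y) ^ q ≡ x ^ q + y ^ q
    frobenius-q x y = subst (λ q → (x + y) ^ q ≡ x ^ q + y ^ q) 2^m (frobenius m x y)

    ev-monic : ∀ y {k} (v : Vec Bool k) → eval y (monic v) ≡ sum (λ i → y ^ toℕ i * ⌜ lookup v i ⌝) + y ^ k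
    ev-monic y [] = trans (Eval.ev-const y true) (sym (+-identityˡ 1#))
    ev-monic y {suc k} (a ∷ v) = begin
      ⌜ a ⌝ + y * eval y (monic v)    ≡⟨ cong (λ x → ⌜ a ⌝ + y * x) (ev-monic y v) ⟩
      ⌜ a ⌝ + y * (sum (λ i → y ^ toℕ i * ⌜ lookup v i ⌝) + y ^ k)
        ≡⟨ cong (⌜ a ⌝ +_) (trans (distribˡ y _ _) (cong (_+ y * y ^ k) (trans
             (*-distribˡ-sum y (λ i → y ^ toℕ i * ⌜ lookup v i ⌝)) (sum-cong-≗ λ i → sym (*-assoc y (y ^ toℕ i) ⌜ lookup v i ⌝))))) ⟩
      ⌜ a ⌝ + (sum (λ i → y * y ^ toℕ i * ⌜ lookup v i ⌝) + y * y ^ k)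
        ≡⟨ trans (cong (_+ _) (sym (*-identityˡ ⌜ a ⌝))) (sym (+-assoc _ _ _)) ⟩
      1# * ⌜ a ⌝ + sum (λ i → y * y ^ toℕ i * ⌜ lookup v i ⌝) + y * y ^ k ∎
      where open ≡-Reasoning

    module _ {γ} (prim : PrimitiveElement γ) where
      open PrimitiveElement prim

      ^-q-q : (γ ^ q) ^ q ≡ γ
      ^-q-q = begin
        (γ ^ q) ^ q        ≡⟨ ^-assocʳ γ q q ⟩
        γ ^ (q ℕ.* q)      ≡⟨ cong (γ ^_) (solve 1 (λ x → (con 1 :+ x) :* (con 1 :+ x) := con 1 :+ x :* (con 2 :+ x)) refl q₁) ⟩
        γ * γ ^ N          ≡⟨ cong (γ *_) γ^N≡1 ⟩
        γ * 1#             ≡⟨ *-identityʳ γ ⟩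
        γ ∎
        where
        open ≡-Reasoning
        open +-*-Solver

      -- F_q is {0} together with the powers of γ^(q+1).
      fixed-log : ∀ x → x ≢ 0# → x ^ q ≡ x → ∃ λ s → s < q₁ × x ≡ γ ^ (suc q ℕ.* s)
      fixed-log x x≢0 fixed = go (log x x≢0)
        where
        go : (∃ λ k → k < N × x ≡ γ ^ k) → ∃ λ s → s < q₁ × x ≡ γ ^ (suc q ℕ.* s)
        go (k , k<N , refl) = s ,
          ℕ.*-cancelʳ-< _ s q₁ (subst (_< N) k≡ k<N) ,
          cong (γ ^_) (trans k≡ (ℕ.*-comm s (suc q)))
          where
          instance _ = ℕ.>-nonZero 0<q₁
          k+q₁k : γ ^ k ≡ γ ^ (k ℕ.+ q₁ ℕ.* k)
          k+q₁k = trans (sym fixed) (trans (^-assocʳ γ k q) (cong (γ ^_) (ℕ.*-comm k q)))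
          divides : suc q ℕ.∣ k
          divides = ℕ.*-cancelˡ-∣ q₁ (order∣ (^-cancel k (q₁ ℕ.* k) k+q₁k))
          s = ℕ.quotient divides
          k≡ : k ≡ s ℕ.* suc q
          k≡ = ℕ._∣_.equality divides

      fixed-decode : Fin q → K
      fixed-decode zero    = 0#
      fixed-decode (suc s) = γ ^ (suc q ℕ.* toℕ s)

      -- Elements with equal codes are equal, as both are decoded from the same code; thus F_q has
      -- at most q elements, as the pigeonhole argument requires.
      fixed-encode : ∀ x → x ^ q ≡ x → ∃ λ c → fixed-decode c ≡ x
      fixed-encode x fixed with x ≟ 0#
      ... | yes x≡0 = zero , sym x≡0
      ... | no x≢0  = go (fixed-log x x≢0 fixed)
        where
        go : (∃ λ s → s < q₁ × x ≡ γ ^ (suc q ℕ.* s)) → ∃ λ c → fixed-decode c ≡ x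
        go (s , s<q₁ , e) = suc (fromℕ< s<q₁) ,
          trans (cong (λ t → γ ^ (suc q ℕ.* t)) (Fin.toℕ-fromℕ< s<q₁)) (sym e)

      -- By the pigeonhole principle, two of the 2^(m+1) polynomials of degree ≤ m agree at y ∈ F_q.
      annihilator : ∀ y → y ^ q ≡ y → ∃ λ p → HasDeg p m × eval y p ≡ 0#
      annihilator y fixed = go (Fin.pigeonhole m<m+1 (proj₁ ∘ code))
        where
        open Eval y
        point : Fin (2 ℕ.^ suc m) → K
        point i = ev (toList (decode {suc m} i))
        code : ∀ i → ∃ λ c → fixed-decode c ≡ point i
        code i = fixed-encode (point i)
          (trans (sym (^-2^m _)) (ev-frobenius m (trans (^-2^m y) fixed) (toList (decode {suc m} i))))
        m<m+1 : q < 2 ℕ.^ suc m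
        m<m+1 = subst (_< 2 ℕ.^ suc m) 2^m (ℕ.m<m+n (2 ℕ.^ m) (ℕ.≤-trans (ℕ.m^n>0 2 m) (ℕ.≤-reflexive (sym (ℕ.+-identityʳ _)))))
        go : (∃ λ i → ∃ λ j → i Fin.< j × proj₁ (code i) ≡ proj₁ (code j)) → ∃ λ p → HasDeg p m × eval y p ≡ 0#
        go (i , j , i<j , e) = finish (degree? p)
          where
          u = decode {suc m} i
          w = decode {suc m} j
          p = toList u +P toList w
          root : ev p ≡ 0#
          root = trans (ev-+ (toList u) (toList w)) (≡⇒+-zero
            (trans (sym (proj₂ (code i))) (trans (cong fixed-decode e) (proj₂ (code j)))))
          u≢w : u ≢ w
          u≢w u≡w = Fin.<⇒≢ i<j (trans (sym (encode-decode {suc m} i)) (trans (cong encode u≡w) (encode-decode {suc m} j)))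
          finish : p ≋ [] ⊎ ∃ (HasDeg p) → ∃ λ p → HasDeg p m × eval y p ≡ 0#
          finish (inj₁ p≋0) = contradiction
            (trans (sym (low-toList u)) (trans (low-cong (suc m) (+-zero⇒≋ p≋0)) (low-toList w))) u≢w
          -- The polynomial found may have degree less than m; a power of X raises it to the size of
          -- the companion matrix and keeps the root.
          finish (inj₂ (d , hp)) = (XP ^P (m ℕ.∸ d)) *P p ,
            subst (HasDeg _) (ℕ.m∸n+n≡m d≤m) (hasDeg-* (hasDeg-X^ (m ℕ.∸ d)) hp) ,
            trans (ev-* (XP ^P (m ℕ.∸ d)) p) (trans (cong (ev (XP ^P (m ℕ.∸ d)) *_) root) (zeroʳ _))
            where
            d≤m : d ≤ m
            d≤m = ℕ.s≤s⁻¹ (below⇒< hp (below-+ {toList u} {toList w} (below-toList u) (below-toList w)))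

  -- The hypothesis on `α` is tr(1/α) = 1 with denominators cleared. Multiplied by α it becomes α² =
  -- (1 + α) y for the norm y = α α^q, which the Frobenius fixes.
  primitiveTSR : (R : Char2Ring) → let open Char2 R in ∀ {m q₁} (2^m : 2 ℕ.^ m ≡ suc q₁) (0<q₁ : 0 < q₁)
    (enc : K → Fin (2 ℕ.^ (2 ℕ.* m))) (enc-injective : Injective _≡_ _≡_ enc) →
    let open Subfield R {m} 2^m 0<q₁ enc enc-injective in
    ∀ {α} → PrimitiveElement α → α ^ q * (1# + α) ≡ α →
    ∃ λ c₀ → ∃ λ c₁ → ∃ λ A → Primitive (charPoly (tsr m c₀ c₁ A)) (2 ℕ.* m)
  primitiveTSR R {zero} refl ()
  primitiveTSR R {suc m} {q₁} 2^m 0<q₁ enc enc-injective {α} prim trace =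
    true , true , companion p , root⇒primitive R (2^2*m (suc m) 2^m) (s≤s z≤n)
      (subst (HasDeg (charPoly T)) (cong (suc m ℕ.+_) (sym (ℕ.+-identityʳ (suc m)))) (hasDeg-charPoly T))
      (tsr-root p α y relation norm) orderMultiple
    where
    open ≡-Reasoning
    open Char2 R
    open Subfield R {suc m} 2^m 0<q₁ enc enc-injective
    open PrimitiveElement prim
    y = α * α ^ q
    y-fixed : y ^ q ≡ y
    y-fixed = trans (^-distrib-* α (α ^ q) q) (trans (cong (α ^ q *_) (^-q-q prim)) (*-comm _ α))
    ann = annihilator prim y y-fixed
    v = low (suc m) (proj₁ ann)
    p : Fin (suc m) → Bool
    p = lookup v
    T = tsr (suc m) true true (companion p)
    relation : y ^ suc m ≡ sum (λ i → y ^ toℕ i * ⌜ p i ⌝)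
    relation = sym (+-zero⇒≡ (trans (sym (ev-monic y v))
      (trans (Eval.ev-cong y (monic-low (proj₁ (proj₂ ann)))) (proj₂ (proj₂ ann)))))
    norm : α * α ≡ (1# + α) * y
    norm = sym (begin
      (1# + α) * (α * α ^ q)  ≡⟨ *-comm _ _ ⟩
      α * α ^ q * (1# + α)    ≡⟨ *-assoc _ _ _ ⟩
      α * (α ^ q * (1# + α))  ≡⟨ cong (α *_) trace ⟩
      α * α ∎)

-- Primitive polynomials verified by computation.

module Certificates where

  open import Defs using (charPoly; tsr; Primitive)
  open QuotientRings
  open CharacteristicTwo
  open PrimitiveRoots
  open TSRMatrices
  open import Data.Bool.Base using (Bool; true; false; if_then_else_)
  import Data.Bool.Properties as Bool
  open import Data.Fin.Base using (zero; suc)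
  open import Data.List.Base using (List; []; _∷_)
  open import Data.List.Relation.Unary.All as All using (All; []; _∷_)
  open import Data.Nat.Base as ℕ using (ℕ; zero; suc; _<_; z≤n; s≤s; NonZero)
  open import Data.Nat.DivMod using (_/_; _%_; m*n/n≡m)
  open import Data.Nat.Divisibility as ℕ using (_∣_; divides)
  open import Data.Nat.GCD using (gcd; gcd-GCD; gcd[m,n]∣m; gcd[m,n]∣n; module Bézout)
  open import Data.Nat.ListAction using (product)
  open import Data.Nat.Primality using (Prime; prime?)
  open import Data.Nat.Primality.Factorisation using (factorise; PrimeFactorisation; factorisationHasAllPrimeFactors)
  open import Data.Vec.Base using (Vec; []; _∷_)
  import Data.Vec.Properties as Vec
  open import Relation.Nullary.Decidable using (map′)

  prime-factor : ∀ {n} → .{{NonZero n}} → n ≢ 1 → ∃ λ p → Prime p × p ∣ n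
  prime-factor {n} n≢1 = go (PrimeFactorisation.factors F) (PrimeFactorisation.isFactorisation F) (PrimeFactorisation.factorsPrime F)
    where
    F = factorise n
    go : ∀ ps → n ≡ product ps → All Prime ps → ∃ λ p → Prime p × p ∣ n
    go []       e _        = contradiction e n≢1
    go (p ∷ ps) e (pr ∷ _) = p , pr , divides (product ps) (trans e (ℕ.*-comm p _))

  module OrderCriterion (R : Char2Ring) where
    open Char2 R

    ^-multiple : ∀ {x a} b → x ^ a ≡ 1# → x ^ (a ℕ.* b) ≡ 1#
    ^-multiple {x} {a} b e = trans (sym (^-assocʳ x a b)) (trans (cong (_^ b) e) (1^ b))

    ^-multiple′ : ∀ {x a} b → x ^ a ≡ 1# → x ^ (b ℕ.* a) ≡ 1#
    ^-multiple′ {x} {a} b e = trans (cong (x ^_) (ℕ.*-comm b a)) (^-multiple {x} {a} b e)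

    ^-difference : ∀ {x} a {b c} → a ℕ.+ b ≡ c → x ^ b ≡ 1# → x ^ c ≡ 1# → x ^ a ≡ 1#
    ^-difference {x} a {b} {c} e eb ec = begin
      x ^ a          ≡⟨ *-identityʳ _ ⟨
      x ^ a * 1#     ≡⟨ cong (x ^ a *_) eb ⟨
      x ^ a * x ^ b  ≡⟨ ^-homo-* x a b ⟨
      x ^ (a ℕ.+ b)  ≡⟨ cong (x ^_) e ⟩
      x ^ c          ≡⟨ ec ⟩
      1# ∎
      where open ≡-Reasoning

    ^-gcd : ∀ {x} m n → x ^ m ≡ 1# → x ^ n ≡ 1# → x ^ gcd m n ≡ 1#
    ^-gcd {x} m n em en with Bézout.identity (gcd-GCD m n)
    ... | Bézout.+- a b eq = ^-difference (gcd m n) eq (^-multiple′ {x} {n} b en) (^-multiple′ {x} {m} a em)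
    ... | Bézout.-+ a b eq = ^-difference (gcd m n) eq (^-multiple′ {x} {m} a em) (^-multiple′ {x} {n} b en)

    -- If gcd(k, N) were a proper divisor of N, it would divide N/p for some prime p; but x to the
    -- power gcd(k, N) is 1 by Bézout, hence so would x^(N/p) be.
    order-criterion : ∀ {x N} → .{{NonZero N}} → x ^ N ≡ 1# →
      (∀ p M → Prime p → N ≡ M ℕ.* p → x ^ M ≢ 1#) → ∀ {k} → x ^ k ≡ 1# → N ∣ k
    order-criterion {x} {N} eN proper {k} ek with gcd[m,n]∣n k N
    ... | divides r N≡ with r ℕ.≟ 1
    ... | yes refl = subst (_∣ k) (sym (trans N≡ (ℕ.*-identityˡ _))) (gcd[m,n]∣m k N)
    ... | no r≢1 with prime-factor {r} {{r≢0}} r≢1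
      where
      r≢0 : NonZero r
      r≢0 = ℕ.≢-nonZero λ { refl → ℕ.≢-nonZero⁻¹ N N≡ }
    ... | p , pr , divides s refl = contradiction (^-multiple′ {x} {gcd k N} s (^-gcd k N ek eN))
      (proper p (s ℕ.* gcd k N) pr (trans N≡ (trans (cong (ℕ._* gcd k N) (ℕ.*-comm s p)) (trans (ℕ.*-assoc p s _) (ℕ.*-comm p _)))))

    square : K → K
    square x = x * x

    value : List Bool → ℕ
    value []       = 0
    value (b ∷ bs) = (if b then 1 else 0) ℕ.+ 2 ℕ.* value bs

    -- Repeated squaring, for exponents that come close to 2^40.
    power : K → List Bool → K
    power x []       = 1#
    power x (b ∷ bs) = (if b then x else 1#) * square (power x bs)

    power≡^ : ∀ x bs → power x bs ≡ x ^ value bs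
    power≡^ x []       = refl
    power≡^ x (b ∷ bs) = begin
      (if b then x else 1#) * (power x bs * power x bs)  ≡⟨ cong₂ _*_ (bit b) (cong square (power≡^ x bs)) ⟩
      x ^ (if b then 1 else 0) * (x ^ value bs * x ^ value bs)
        ≡⟨ cong (x ^ (if b then 1 else 0) *_) (trans (sym (^-homo-* x (value bs) (value bs))) (cong (λ k → x ^ (value bs ℕ.+ k)) (sym (ℕ.+-identityʳ _)))) ⟩
      x ^ (if b then 1 else 0) * x ^ (2 ℕ.* value bs)    ≡⟨ ^-homo-* x (if b then 1 else 0) (2 ℕ.* value bs) ⟨
      x ^ value (b ∷ bs) ∎
      where
      open ≡-Reasoning
      bit : ∀ b → (if b then x else 1#) ≡ x ^ (if b then 1 else 0)
      bit true  = sym (*-identityʳ x)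
      bit false = refl

    -- Its correctness is part of each certificate: `bits-N`, `bits-q` and `ProperPower` check the
    -- round trip through `value`.
    toBits : ℕ → ℕ → List Bool
    toBits zero       k = []
    toBits (suc fuel) k = (k % 2 ℕ.≡ᵇ 1) ∷ toBits fuel (k / 2)

  quotientRing : ∀ {n} → Vec Bool n → Char2Ring
  quotientRing {n} v = record { K = Vec Bool n ; isCommutativeRing = Quotient.isCommutativeRing v }

  module Certificate {m : ℕ} (v : Vec Bool (2 ℕ.* m)) (ps : List ℕ) where
    R = quotientRing v
    open Char2 R
    open OrderCriterion R
    open Quotient v using (X)

    _≟K_ : (x y : K) → Dec (x ≡ y)
    _≟K_ = Vec.≡-dec Bool._≟_

    N = product ps
    bits = toBits (2 ℕ.* m)

    ProperPower : ℕ → Set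
    ProperPower p = ∃ λ (nz : NonZero p) → let M = (N / p) {{nz}} in value (bits M) ≡ M × power X (bits M) ≢ 1#

    properPower? : ∀ p → Dec (ProperPower p)
    properPower? zero    = no λ ()
    properPower? (suc p) = map′ (_ ,_) proj₂ (value (bits M) ℕ.≟ M ×-dec ¬? (power X (bits M) ≟K 1#))
      where M = N / suc p

    -- The class of X itself serves as α, so the modulus is chosen to make X primitive and 1/X of
    -- trace 1 at once. The fields on orders are the input of `order-criterion`, the field `trace`
    -- that of `primitiveTSR`.
    record Certified : Set where
      field
        size     : 2 ℕ.^ (2 ℕ.* m) ≡ suc N
        primes   : All Prime ps
        orders   : All ProperPower ps
        bits-N   : value (bits N) ≡ N
        order-N  : power X (bits N) ≡ 1#
        bits-q   : value (bits (2 ℕ.^ m)) ≡ 2 ℕ.^ m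
        nonzero  : 1# ≢ 0#
        trace    : power X (bits (2 ℕ.^ m)) * (1# + X) ≡ X

    certified? : Dec Certified
    certified? = map′
      (λ { (a , b , c , d , e , f , h , g) → record { size = a ; primes = b ; orders = c ; bits-N = d ; order-N = e ; bits-q = f ; nonzero = h ; trace = g } })
      (λ C → let open Certified C in size , primes , orders , bits-N , order-N , bits-q , nonzero , trace)
      (2 ℕ.^ (2 ℕ.* m) ℕ.≟ suc N ×-dec All.all? prime? ps ×-dec All.all? properPower? ps ×-dec value (bits N) ℕ.≟ N
        ×-dec power X (bits N) ≟K 1# ×-dec value (bits (2 ℕ.^ m)) ℕ.≟ 2 ℕ.^ m ×-dec ¬? (1# ≟K 0#) ×-dec (power X (bits (2 ℕ.^ m)) * (1# + X)) ≟K X)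

    certified⇒TSR : Certified → ∀ {q₁} → 2 ℕ.^ m ≡ suc q₁ → 0 < q₁ →
      ∃ λ c₀ → ∃ λ c₁ → ∃ λ A → Primitive (charPoly (tsr m c₀ c₁ A)) (2 ℕ.* m)
    certified⇒TSR C {q₁} 2^m 0<q₁ = primitiveTSR R {m} 2^m 0<q₁ encode encode-injective
      (record { orderMultiple = record
        { inverse = X ^ ℕ.pred N
        ; inverseʳ = trans (cong (X ^_) (ℕ.suc-pred N)) X^N≡1
        ; nontrivial = nonzero
        ; order∣ = λ {k} e → subst (_∣ k) N≡ (order-criterion X^N≡1 proper e) }
      ; γ^N≡1 = trans (cong (X ^_) (sym N≡)) X^N≡1 })
      (trans (cong (_* (1# + X)) (trans (cong (X ^_) (trans (sym 2^m) (sym bits-q))) (sym (power≡^ X (bits (2 ℕ.^ m)))))) trace)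
      where
      open Certified C
      N≡ : N ≡ q₁ ℕ.* (2 ℕ.+ q₁)
      N≡ = ℕ.suc-injective (trans (sym size) (2^2*m m 2^m))
      instance
        N≢0 : NonZero N
        N≢0 = ℕ.>-nonZero (subst (0 <_) (sym N≡) (ℕ.*-mono-≤ 0<q₁ (s≤s z≤n)))
      X^N≡1 : X ^ N ≡ 1#
      X^N≡1 = trans (cong (X ^_) (sym bits-N)) (trans (sym (power≡^ X (bits N))) order-N)
      proper : ∀ p M → Prime p → N ≡ M ℕ.* p → X ^ M ≢ 1#
      proper p M pr N≡Mp e = go (All.lookup orders (factorisationHasAllPrimeFactors pr (divides M N≡Mp) primes))
        where
        go : ¬ ProperPower p
        go (nz , bits-M , ne) = ne (trans (power≡^ X (bits M′)) (trans (cong (X ^_) (trans bits-M M′≡M)) e))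
          where
          M′ = (N / p) {{nz}}
          M′≡M : M′ ≡ M
          M′≡M = trans (cong (λ k → (k / p) {{nz}}) N≡Mp) (m*n/n≡m M p {{nz}})

-- The multiplicative group of a finite field is cyclic.

module FiniteFields where

  open CharacteristicTwo
  open PrimitiveRoots using (module Order)
  open TSRMatrices using (module PrimitiveRoot)
  open Certificates using (prime-factor; module OrderCriterion)
  import Algebra.Properties.CommutativeMonoid.Sum
  open import Data.Fin.Base as Fin using (Fin; zero; suc)
  open import Data.Fin.Permutation using (Permutation′; permutation)
  import Data.Fin.Properties as Fin
  open import Data.Nat.Base as ℕ using (ℕ; zero; suc; _<_; _≤_; z≤n; s≤s; NonZero)
  open import Data.Nat.Divisibility as ℕ using (_∣_; _∤_; _∣?_; divides)
  open import Data.Nat.GCD using (gcd; gcd[m,n]∣m; gcd[m,n]∣n)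
  open import Data.Nat.Induction using (<-rec)
  open import Data.Nat.Primality using (Prime; euclidsLemma; prime⇒irreducible; prime⇒nonZero; prime⇒nonTrivial; ¬prime[1])
  open import Data.Vec.Base using (Vec; []; _∷_; replicate)
  open ≡-Reasoning

  prime∣^⇒≡ : ∀ {r p} → Prime r → Prime p → ∀ k → r ∣ p ℕ.^ k → r ≡ p
  prime∣^⇒≡ pr pp zero    d = contradiction (subst Prime (ℕ.∣1⇒≡1 d) pr) ¬prime[1]
  prime∣^⇒≡ {r} {p} pr pp (suc k) d with euclidsLemma p (p ℕ.^ k) pr d
  ... | inj₂ d′ = prime∣^⇒≡ pr pp k d′
  ... | inj₁ d′ with prime⇒irreducible pp d′
  ... | inj₁ refl = contradiction pr ¬prime[1]
  ... | inj₂ r≡p  = r≡p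

  gcd-prime : ∀ {r n} → Prime r → r ∤ n → gcd n r ≡ 1
  gcd-prime {r} {n} pr r∤n with prime⇒irreducible pr (gcd[m,n]∣n n r)
  ... | inj₁ e = e
  ... | inj₂ e = contradiction (subst (_∣ n) e (gcd[m,n]∣m n r)) r∤n

  split-power : ∀ {p} → Prime p → ∀ b → .{{NonZero b}} → p ∣ b → ∃ λ k → ∃ λ b′ → b ≡ p ℕ.^ suc k ℕ.* b′ × p ∤ b′
  split-power {p} pp = <-rec _ go
    where
    Goal : ℕ → Set
    Goal b = .{{NonZero b}} → p ∣ b → ∃ λ k → ∃ λ b′ → b ≡ p ℕ.^ suc k ℕ.* b′ × p ∤ b′
    go : ∀ b → (∀ {c} → c < b → Goal c) → Goal b
    go b rec p∣b@(divides c refl) with p ∣? c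
    ... | no p∤c  = 0 , c , trans (ℕ.*-comm c p) (cong (ℕ._* c) (sym (ℕ.*-identityʳ p))) , p∤c
    ... | yes p∣c with rec (ℕ.quotient-< p∣b) {{ℕ.quotient≢0 p∣b}} p∣c
      where instance _ = prime⇒nonTrivial pp
    ... | k , b′ , e , p∤b′ = suc k , b′ , trans (cong (ℕ._* p) e) (trans (ℕ.*-comm _ p) (sym (ℕ.*-assoc p (p ℕ.^ suc k) b′))) , p∤b′

  module FiniteField (R : Char2Ring) (nontrivial : Char2Ring.1# R ≢ Char2Ring.0# R)
    (inverse : ∀ x → x ≢ Char2Ring.0# R → ∃ λ y → Char2Ring._*_ R x y ≡ Char2Ring.1# R)
    {N : ℕ} (enc : Char2Ring.K R → Fin (suc N)) (dec : Fin (suc N) → Char2Ring.K R)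
    (dec-enc : ∀ x → dec (enc x) ≡ x) (enc-dec : ∀ i → enc (dec i) ≡ i) where

    open Char2 R
    open Order R
    open OrderCriterion R

    enc-injective : Injective _≡_ _≡_ enc
    enc-injective {x} {y} e = trans (sym (dec-enc x)) (trans (cong dec e) (dec-enc y))

    open PrimitiveRoot R refl enc enc-injective public

    cancel : ∀ {x y z} → x ≢ 0# → x * y ≡ x * z → y ≡ z
    cancel {x} {y} {z} x≢0 e = go (inverse x x≢0)
      where
      go : (∃ λ w → x * w ≡ 1#) → y ≡ z
      go (w , xw) = trans (sym (undo y)) (trans (cong (w *_) e) (undo z))
        where
        undo : ∀ y → w * (x * y) ≡ y
        undo y = trans (sym (*-assoc w x y)) (trans (cong (_* y) (trans (*-comm w x) xw)) (*-identityˡ y))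

    domain : ∀ {x y} → x ≢ 0# → x * y ≡ 0# → y ≡ 0#
    domain {x} x≢0 e = cancel x≢0 (trans e (sym (zeroʳ x)))

    evalMonic : ∀ {k} → Vec K k → K → K
    evalMonic []       x = 1#
    evalMonic (c ∷ cs) x = c + x * evalMonic cs x

    combine : ∀ {k} (cs : Vec K (suc k)) (ds : Vec K k) a →
      ∃ λ (es : Vec K (suc k)) → ∀ x → evalMonic es x ≡ evalMonic cs x + a * evalMonic ds x
    combine (c ∷ []) [] a = (c + a) ∷ [] ,
      Solver.solve 3 (λ c a x → (c :+ a) :+ x :* con 1 := (c :+ x :* con 1) :+ a :* con 1) refl c a
      where open Solver
    combine (c ∷ cs@(_ ∷ _)) (d ∷ ds) a = let es , e = combine cs ds a in
      (c + a * d) ∷ es , λ x → trans (cong (λ y → c + a * d + x * y) (e x))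
        (Solver.solve 6 (λ c a d x y z → c :+ a :* d :+ x :* (y :+ a :* z) := (c :+ x :* y) :+ a :* (d :+ x :* z)) refl
          c a d x (evalMonic cs x) (evalMonic ds x))
      where open Solver

    -- Writing P = c + x Q, the identity x Q(x) + a Q(a) = (x + a) Q(x) + a (Q(x) + Q(a)) reduces to
    -- Q. The quotient is Q plus `a` times a polynomial of lower degree, which `combine` keeps
    -- monic.
    divide-root : ∀ {k} (cs : Vec K (suc k)) a →
      ∃ λ (ds : Vec K k) → ∀ x → evalMonic cs x + evalMonic cs a ≡ (x + a) * evalMonic ds x
    divide-root (c ∷ []) a = [] , λ x → begin
      (c + x * 1#) + (c + a * 1#)   ≡⟨ Solver.solve 3 (λ c x a → (c :+ x :* con 1) :+ (c :+ a :* con 1) := (c :+ c) :+ (x :+ a) :* con 1) refl c x a ⟩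
      (c + c) + (x + a) * 1#        ≡⟨ cong (_+ (x + a) * 1#) (+-self c) ⟩
      0# + (x + a) * 1#             ≡⟨ +-identityˡ _ ⟩
      (x + a) * 1# ∎
      where open Solver
    divide-root (c ∷ cs@(_ ∷ _)) a =
      let ds , e = divide-root cs a ; es , e′ = combine cs ds a in
      es , λ x → let y = evalMonic cs x ; z = evalMonic cs a in begin
        (c + x * y) + (c + a * z)
          ≡⟨ +-identityʳ _ ⟨
        (c + x * y) + (c + a * z) + 0#
          ≡⟨ cong ((c + x * y) + (c + a * z) +_) (+-self (a * y)) ⟨
        (c + x * y) + (c + a * z) + (a * y + a * y)
          ≡⟨ Solver.solve 5 (λ c x a y z → (c :+ x :* y) :+ (c :+ a :* z) :+ (a :* y :+ a :* y) := (c :+ c) :+ ((x :+ a) :* y :+ a :* (y :+ z))) refl c x a y z ⟩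
        (c + c) + ((x + a) * y + a * (y + z))
          ≡⟨ trans (cong (_+ ((x + a) * y + a * (y + z))) (+-self c)) (+-identityˡ _) ⟩
        (x + a) * y + a * (y + z)
          ≡⟨ cong (λ w → (x + a) * y + a * w) (e x) ⟩
        (x + a) * y + a * ((x + a) * evalMonic ds x)
          ≡⟨ Solver.solve 4 (λ s y a w → s :* y :+ a :* (s :* w) := s :* (y :+ a :* w)) refl (x + a) y a (evalMonic ds x) ⟩
        (x + a) * (y + a * evalMonic ds x)
          ≡⟨ cong ((x + a) *_) (e′ x) ⟨
        (x + a) * evalMonic es x ∎
      where open Solver

    root-bound : ∀ {k l} (cs : Vec K k) (xs : Fin l → K) → Injective _≡_ _≡_ xs → (∀ i → evalMonic cs (xs i) ≡ 0#) → l ≤ k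
    root-bound {l = zero}   cs xs inj roots = z≤n
    root-bound {l = suc l} [] xs inj roots = contradiction (roots zero) nontrivial
    root-bound {l = suc l} cs@(_ ∷ _) xs inj roots = go (divide-root cs (xs zero))
      where
      go : (∃ λ ds → ∀ x → evalMonic cs x + evalMonic cs (xs zero) ≡ (x + xs zero) * evalMonic ds x) → _
      go (ds , e) = s≤s (root-bound ds (xs ∘ suc) (Fin.suc-injective ∘ inj) λ i → domain
        (λ z → contradiction (inj (+-zero⇒≡ z)) λ ())
        (trans (sym (e (xs (suc i)))) (trans (cong₂ _+_ (roots (suc i)) (roots zero)) (+-identityʳ 0#))))

    evalMonic-0 : ∀ k x → evalMonic (replicate k 0#) x ≡ x ^ k
    evalMonic-0 zero    x = refl
    evalMonic-0 (suc k) x = trans (+-identityˡ _) (cong (x *_) (evalMonic-0 k x))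

    unit-root-bound : ∀ {k l} → 0 < k → (xs : Fin l → K) → Injective _≡_ _≡_ xs → (∀ i → xs i ^ k ≡ 1#) → l ≤ k
    unit-root-bound {suc k} _ xs inj roots = root-bound (1# ∷ replicate k 0#) xs inj
      λ i → trans (cong (λ y → 1# + xs i * y) (evalMonic-0 k (xs i))) (trans (cong (1# +_) (roots i)) (+-self 1#))

    -- Sums taken in the multiplicative monoid: `Π.sum` is a product, and `∑-distrib-+` and
    -- `sum-permute` are statements about products.
    private module Π = Algebra.Properties.CommutativeMonoid.Sum *-commutativeMonoid

    Π-nonzero : ∀ {n} (g : Fin n → K) → (∀ i → g i ≢ 0#) → Π.sum g ≢ 0#
    Π-nonzero {zero}  g nz e = nontrivial e
    Π-nonzero {suc n} g nz e = Π-nonzero (g ∘ suc) (nz ∘ suc) (domain (nz zero) e)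

    -- Replaces the factor belonging to the zero element by 1, so that a product over all indices
    -- runs over the nonzero elements.
    zero-else : K → K → K
    zero-else x y with x ≟ 0#
    ... | yes _ = 1#
    ... | no  _ = y

    zero-else-0 : ∀ {x} y → x ≡ 0# → zero-else x y ≡ 1#
    zero-else-0 {x} y e with x ≟ 0#
    ... | yes _ = refl
    ... | no ne = contradiction e ne

    zero-else-≢0 : ∀ {x} y → x ≢ 0# → zero-else x y ≡ y
    zero-else-≢0 {x} y ne with x ≟ 0#
    ... | yes e = contradiction e ne
    ... | no  _ = refl

    -- Multiplication by a permutes the nonzero elements, so their product P satisfies P = a^N P.
    fermat : ∀ a → a ≢ 0# → a ^ N ≡ 1#
    fermat a a≢0 = go (inverse a a≢0)
      where
      go : (∃ λ b → a * b ≡ 1#) → a ^ N ≡ 1#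
      go (b , ab) = sym (cancel (Π-nonzero g g≢0) (begin
        Π.sum g * 1#                                ≡⟨ *-identityʳ _ ⟩
        Π.sum g                                     ≡⟨ Π.sum-permute g π ⟩
        Π.sum (λ i → g (enc (a * dec i)))           ≡⟨ Π.sum-cong-≗ step ⟩
        Π.sum (λ i → g i * zero-else (dec i) a)     ≡⟨ Π.∑-distrib-+ g (λ i → zero-else (dec i) a) ⟩
        Π.sum g * Π.sum (λ i → zero-else (dec i) a) ≡⟨ cong (Π.sum g *_) count ⟩
        Π.sum g * a ^ N ∎))
        where
        undo : ∀ {a b} → a * b ≡ 1# → ∀ i → enc (a * dec (enc (b * dec i))) ≡ i
        undo {a} {b} ab i = trans (cong (λ x → enc (a * x)) (dec-enc _)) (trans (cong enc
          (trans (sym (*-assoc a b (dec i))) (trans (cong (_* dec i) ab) (*-identityˡ _)))) (enc-dec i))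
        π : Permutation′ (suc N)
        π = permutation (λ i → enc (a * dec i)) (λ i → enc (b * dec i)) (undo ab) (undo (trans (*-comm b a) ab))
        g : Fin (suc N) → K
        g i = zero-else (dec i) (dec i)
        g≢0 : ∀ i → g i ≢ 0#
        g≢0 i e with dec i ≟ 0#
        ... | yes _ = nontrivial e
        ... | no ne = ne e
        step : ∀ i → g (enc (a * dec i)) ≡ g i * zero-else (dec i) a
        step i = trans (cong (λ x → zero-else x x) (dec-enc (a * dec i))) (by-cases (dec i ≟ 0#))
          where
          by-cases : Dec (dec i ≡ 0#) → zero-else (a * dec i) (a * dec i) ≡ g i * zero-else (dec i) a
          by-cases (yes e) = trans (zero-else-0 _ (trans (cong (a *_) e) (zeroʳ a)))
            (sym (trans (cong₂ _*_ (zero-else-0 _ e) (zero-else-0 a e)) (*-identityʳ 1#)))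
          by-cases (no ne) = trans (zero-else-≢0 _ (λ e → ne (domain a≢0 e)))
            (trans (*-comm a (dec i)) (sym (cong₂ _*_ (zero-else-≢0 _ ne) (zero-else-≢0 a ne))))
        count : Π.sum (λ i → zero-else (dec i) a) ≡ a ^ N
        count = begin
          Π.sum (λ i → zero-else (dec i) a)
            ≡⟨ Π.sum-remove {i = enc 0#} (λ i → zero-else (dec i) a) ⟩
          zero-else (dec (enc 0#)) a * Π.sum (λ j → zero-else (dec (Fin.punchIn (enc 0#) j)) a)
            ≡⟨ cong₂ _*_ (zero-else-0 a (dec-enc 0#)) (Π.sum-cong-≗ {N} {_} {λ _ → a} λ j →
                 zero-else-≢0 a λ e → Fin.punchInᵢ≢i (enc 0#) j (trans (sym (enc-dec _)) (cong enc e))) ⟩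
          1# * Π.sum {N} (λ _ → a)
            ≡⟨ trans (*-identityˡ _) (Π.sum-replicate N) ⟩
          a ^ N ∎

    -- Otherwise X^k - 1 would have N > k roots.
    nonroot : ∀ {k} → 0 < k → k < N → ∃ λ x → x ≢ 0# × x ^ k ≢ 1#
    nonroot {k} 0<k k<N with Fin.any? (λ i → ¬? (dec i ≟ 0#) ×-dec ¬? (dec i ^ k ≟ 1#))
    ... | yes (i , h) = dec i , h
    ... | no none = contradiction (unit-root-bound 0<k xs xs-injective roots) (ℕ.<⇒≱ k<N)
      where
      index : Fin N → Fin (suc N)
      index = Fin.punchIn (enc 0#)
      xs : Fin N → K
      xs = dec ∘ index
      xs-injective : Injective _≡_ _≡_ xs
      xs-injective {i} {j} e = Fin.punchIn-injective (enc 0#) i j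
        (trans (sym (enc-dec (index i))) (trans (cong enc e) (enc-dec (index j))))
      xs≢0 : ∀ i → xs i ≢ 0#
      xs≢0 i e = Fin.punchInᵢ≢i (enc 0#) i (trans (sym (enc-dec _)) (cong enc e))
      roots : ∀ i → xs i ^ k ≡ 1#
      roots i with xs i ^ k ≟ 1#
      ... | yes e = e
      ... | no ne = contradiction (index i , xs≢0 i , ne) none

    HasOrder : ℕ → K → Set
    HasOrder a x = x ^ a ≡ 1# × (∀ r M → Prime r → a ≡ M ℕ.* r → x ^ M ≢ 1#)

    -- Let (x y)^M = 1 with M r = a P. If r divides a, then y^M = 1, hence x^M = 1, and x^(a/r) is
    -- killed by the coprime exponents P and r. If r = p, the same argument applies to y^(P/p) and
    -- the exponents a and p.
    extend : ∀ {a p x y} k → .{{NonZero a}} → Prime p → p ∤ a → HasOrder a x → y ^ (p ℕ.^ suc k) ≡ 1# → y ^ (p ℕ.^ k) ≢ 1# →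
      HasOrder (a ℕ.* p ℕ.^ suc k) (x * y)
    extend {a} {p} {x} {y} k pp p∤a (xa , x-proper) yp y-proper =
      trans (^-distrib-* x y (a ℕ.* p ℕ.^ suc k)) (trans (cong₂ _*_ (^-multiple {x} {a} (p ℕ.^ suc k) xa) (^-multiple′ {y} {p ℕ.^ suc k} a yp)) (*-identityʳ 1#)) ,
      proper
      where
      P = p ℕ.^ suc k
      other : ∀ {x y M} → (x * y) ^ M ≡ 1# → x ^ M ≡ 1# → y ^ M ≡ 1#
      other {x} {y} {M} e ex = trans (sym (*-identityˡ _)) (trans (cong (_* y ^ M) (sym ex)) (trans (sym (^-distrib-* x y M)) e))
      proper : ∀ r M → Prime r → a ℕ.* P ≡ M ℕ.* r → (x * y) ^ M ≢ 1#
      proper r M pr eq e with euclidsLemma a P pr (divides M eq)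
      ... | inj₁ (divides s refl) = x-proper r s pr refl (subst (λ k → x ^ k ≡ 1#) (ℕ.*-identityʳ s)
        (trans (sym (^-assocʳ x s 1)) (subst (λ k → (x ^ s) ^ k ≡ 1#) (gcd-prime pr r∤P)
          (^-gcd P r xsP (trans (^-assocʳ x s r) xa)))))
        where
        r∤P : r ∤ P
        r∤P d = p∤a (divides s (cong (s ℕ.*_) (prime∣^⇒≡ pr pp (suc k) d)))
        M≡ : M ≡ s ℕ.* P
        M≡ = ℕ.*-cancelʳ-≡ M (s ℕ.* P) r {{prime⇒nonZero pr}} (trans (sym eq)
          (trans (ℕ.*-assoc s r P) (trans (cong (s ℕ.*_) (ℕ.*-comm r P)) (sym (ℕ.*-assoc s P r)))))
        xsP : (x ^ s) ^ P ≡ 1#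
        xsP = trans (^-assocʳ x s P) (trans (cong (x ^_) (sym M≡)) (other {y} {x} {M} (trans (cong (_^ M) (*-comm y x)) e)
          (trans (cong (y ^_) M≡) (^-multiple′ {y} {P} s yp))))
      ... | inj₂ r∣P = y-proper (trans (sym (*-identityʳ z)) (subst (λ k → z ^ k ≡ 1#) (gcd-prime pp p∤a) (^-gcd a p za zp)))
        where
        z = y ^ (p ℕ.^ k)
        M≡ : M ≡ p ℕ.^ k ℕ.* a
        M≡ = ℕ.*-cancelʳ-≡ M _ p {{prime⇒nonZero pp}} (trans (cong (M ℕ.*_) (sym (prime∣^⇒≡ pr pp (suc k) r∣P)))
          (trans (sym eq) (trans (ℕ.*-comm a P) (trans (ℕ.*-assoc p (p ℕ.^ k) a) (ℕ.*-comm p _)))))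
        za : z ^ a ≡ 1#
        za = trans (^-assocʳ y (p ℕ.^ k) a) (trans (cong (y ^_) (sym M≡))
          (other {x} {y} {M} e (trans (cong (x ^_) M≡) (^-multiple′ {x} {a} (p ℕ.^ k) xa))))
        zp : z ^ p ≡ 1#
        zp = trans (^-assocʳ y (p ℕ.^ k) p) (trans (cong (y ^_) (ℕ.*-comm (p ℕ.^ k) p)) yp)

    module _ (0<N : 0 < N) where

      private instance
        N≢0 : NonZero N
        N≢0 = ℕ.>-nonZero 0<N

      -- Induction on the part `b` of N not yet treated. For a prime p dividing `b`, with full power
      -- P, some y has y^(N/p) ≠ 1; then y^(N/P) has order exactly P and multiplies the order `a` by
      -- P.
      build : ∀ b a x → N ≡ a ℕ.* b → (∀ p → Prime p → p ∣ a → p ∤ b) → HasOrder a x → ∃ λ γ → HasOrder N γ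
      build = <-rec _ step
        where
        Goal : ℕ → Set
        Goal b = ∀ a x → N ≡ a ℕ.* b → (∀ p → Prime p → p ∣ a → p ∤ b) → HasOrder a x → ∃ λ γ → HasOrder N γ
        step : ∀ b → (∀ {c} → c < b → Goal c) → Goal b
        step b rec a x N≡ coprime ord with b ℕ.≟ 1
        ... | yes refl = x , subst (λ k → HasOrder k x) (sym (trans N≡ (ℕ.*-identityʳ a))) ord
        ... | no b≢1 = by-prime (prime-factor b≢1)
          where
          instance
            b≢0 : NonZero b
            b≢0 = ℕ.≢-nonZero λ { refl → ℕ.≢-nonZero⁻¹ N (trans N≡ (ℕ.*-zeroʳ a)) }
            a≢0 : NonZero a
            a≢0 = ℕ.≢-nonZero λ { refl → ℕ.≢-nonZero⁻¹ N N≡ }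
          by-prime : (∃ λ p → Prime p × p ∣ b) → ∃ λ γ → HasOrder N γ
          by-prime (p , pp , p∣b) = by-power (split-power pp b p∣b)
            where
            by-power : (∃ λ k → ∃ λ b′ → b ≡ p ℕ.^ suc k ℕ.* b′ × p ∤ b′) → ∃ λ γ → HasOrder N γ
            by-power (k , b′ , b≡ , p∤b′) = by-nonroot (nonroot 0<D D<N)
              where
              P = p ℕ.^ suc k
              D = p ℕ.^ k ℕ.* (a ℕ.* b′)
              instance
                P≢0 : NonZero P
                P≢0 = ℕ.m^n≢0 p (suc k) {{prime⇒nonZero pp}}
                p≢0 : NonZero p
                p≢0 = prime⇒nonZero pp
                b′≢0 : NonZero b′
                b′≢0 = ℕ.≢-nonZero λ { refl → ℕ.≢-nonZero⁻¹ b (trans b≡ (ℕ.*-zeroʳ P)) }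
              N≡PD : N ≡ P ℕ.* (a ℕ.* b′)
              N≡PD = trans N≡ (trans (cong (a ℕ.*_) b≡) (trans (sym (ℕ.*-assoc a P b′))
                (trans (cong (ℕ._* b′) (ℕ.*-comm a P)) (ℕ.*-assoc P a b′))))
              N≡pD : N ≡ p ℕ.* D
              N≡pD = trans N≡PD (ℕ.*-assoc p (p ℕ.^ k) (a ℕ.* b′))
              0<D : 0 < D
              0<D = ℕ.n≢0⇒n>0 λ D≡0 → ℕ.≢-nonZero⁻¹ N (trans N≡pD (trans (cong (p ℕ.*_) D≡0) (ℕ.*-zeroʳ p)))
              D<N : D < N
              D<N = subst (D <_) (trans (ℕ.*-comm D p) (sym N≡pD)) (ℕ.m<m*n D p {{ℕ.>-nonZero 0<D}} (ℕ.nonTrivial⇒n>1 p {{prime⇒nonTrivial pp}}))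
              1<P : 1 < P
              1<P = ℕ.<-≤-trans (ℕ.nonTrivial⇒n>1 p {{prime⇒nonTrivial pp}}) (ℕ.m≤m*n p (p ℕ.^ k) {{ℕ.m^n≢0 p k}})
              coprime′ : ∀ r → Prime r → r ∣ a ℕ.* P → r ∤ b′
              coprime′ r pr r∣aP r∣b′ with euclidsLemma a P pr r∣aP
              ... | inj₁ r∣a = coprime r pr r∣a (subst (r ∣_) (sym b≡) (ℕ.∣n⇒∣m*n P r∣b′))
              ... | inj₂ r∣P = p∤b′ (subst (_∣ b′) (prime∣^⇒≡ pr pp (suc k) r∣P) r∣b′)
              by-nonroot : (∃ λ y → y ≢ 0# × y ^ D ≢ 1#) → ∃ λ γ → HasOrder N γ
              by-nonroot (y , y≢0 , yD) = rec
                (subst (b′ <_) (sym (trans b≡ (ℕ.*-comm P b′))) (ℕ.m<m*n b′ P 1<P))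
                (a ℕ.* P) (x * y ^ (a ℕ.* b′))
                (trans N≡ (trans (cong (a ℕ.*_) b≡) (sym (ℕ.*-assoc a P b′))))
                coprime′
                (extend k pp (λ p∣a → coprime p pp p∣a p∣b) ord
                  (trans (^-assocʳ y (a ℕ.* b′) P) (trans (cong (y ^_) (trans (ℕ.*-comm _ P) (sym N≡PD))) (fermat y y≢0)))
                  λ e → yD (trans (cong (y ^_) (ℕ.*-comm (p ℕ.^ k) _)) (trans (sym (^-assocʳ y (a ℕ.* b′) (p ℕ.^ k))) e)))

      generator : ∃ PrimitiveElement
      generator = go (build N 1 1# (sym (ℕ.*-identityˡ N)) (λ p pp p∣1 → contradiction (subst Prime (ℕ.∣1⇒≡1 p∣1) pp) ¬prime[1])
          (1^ 1 , λ r M pr 1≡Mr → contradiction (subst Prime (ℕ.∣1⇒≡1 (divides M 1≡Mr)) pr) ¬prime[1]))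
        where
        go : (∃ λ γ → HasOrder N γ) → ∃ PrimitiveElement
        go (γ , γ^N , proper) = γ , record
          { orderMultiple = record
            { inverse = γ ^ ℕ.pred N
            ; inverseʳ = trans (cong (γ ^_) (ℕ.suc-pred N)) γ^N
            ; nontrivial = nontrivial
            ; order∣ = order-criterion γ^N proper }
          ; γ^N≡1 = γ^N }

-- The field with 2^n elements and a generator, for every n ≥ 1.

module PrimitiveExtensions where

  open import Defs using (1P; XP; constP; _+P_; _*P_; _^P_)
  open PolynomialRing using (_≋_; ≋-refl; ≋-sym; ≋-trans; ∷-cong; shift-[])
  module P = PolynomialRing
  open Divisibility
  open QuotientRings
  open CharacteristicTwo
  open PrimitiveRoots using (encode; decode; encode-decode; decode-encode; module Order)
  open Certificates using (quotientRing)
  open import Data.Bool.Base using (Bool; true; false)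
  open import Data.Bool.Properties using (xor-identityʳ)
  open import Data.Fin.Base as Fin using (Fin; suc)
  import Data.Fin.Properties as Fin
  open import Data.List.Base using ([]; _∷_)
  open import Data.Nat.Base as ℕ using (ℕ; suc; _<_; _≤_; z≤n; s≤s)
  open import Data.Vec.Base using (Vec; []; _∷_; toList)

  module QuotientRing {n} (v : Vec Bool n) where
    R = quotientRing v
    open Quotient v public using (f; rem; X; rem⇒~; ~⇒rem; rem-toList; divides; ⟨_⟩; rem-cong; +-hom; *-hom; rep; is-rem)
    open Char2 R
    open Eval X

    eval-X : ∀ p → ev p ≡ rem p
    eval-X []      = refl
    eval-X (a ∷ p) = trans
      (is-rem (+-hom (rep {p = constP a} (constant a)) (*-hom (rep {p = XP} refl) (rep {p = p} (eval-X p)))))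
      (rem-cong (∷-split a p))
      where
      constant : ∀ a → ⌜ a ⌝ ≡ rem (constP a)
      constant true  = refl
      constant false = sym (rem-cong shift-[])
      ∷-split : ∀ a p → (constP a +P (XP *P p)) ≋ (a ∷ p)
      ∷-split a p = ≋-trans (P.+-cong (≋-refl {constP a}) (≋-trans (P.shift-* 1P p) (∷-cong refl (P.*-identityˡ p))))
        (∷-cong (xor-identityʳ a) ≋-refl)

    X^-rem : ∀ k → X ^ k ≡ rem (XP ^P k)
    X^-rem k = trans (sym (ev-X^ k)) (eval-X (XP ^P k))

    frob-rem : ∀ n → X ^ (2 ℕ.^ n) + X ≡ rem (frob n)
    frob-rem n = is-rem (+-hom (rep {p = XP ^P (2 ℕ.^ n)} (X^-rem (2 ℕ.^ n))) (rep {p = XP} refl))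

    ∣⇒rem-0 : ∀ p → f ∣ p → rem p ≡ 0#
    ∣⇒rem-0 p d = ~⇒rem {p} {[]} ⟨ ∣-resp (≋-sym (P.+-identityʳ p)) d ⟩

    rem-0⇒∣ : ∀ p → rem p ≡ 0# → f ∣ p
    rem-0⇒∣ p e = ∣-resp (P.+-identityʳ p) (divides (rem⇒~ {p} {[]} e))

    -- If X^(2^k) = X then x^(2^k) = x for all x, all of them being polynomials in X.
    frob∣⇒fixed : ∀ k → f ∣ frob k → ∀ x → x ^ (2 ℕ.^ k) ≡ x
    frob∣⇒fixed k d x = subst (λ y → y ^ (2 ℕ.^ k) ≡ y) (trans (eval-X (toList x)) (rem-toList x))
      (ev-frobenius k (+-zero⇒≡ (trans (frob-rem k) (∣⇒rem-0 (frob k) d))) (toList x))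

    fixed⇒frob∣ : ∀ k → X ^ (2 ℕ.^ k) ≡ X → f ∣ frob k
    fixed⇒frob∣ k e = rem-0⇒∣ (frob k) (trans (sym (frob-rem k)) (≡⇒+-zero e))

  module IrreducibleQuotient {d} (v : Vec Bool (suc d))
    (minimal : ∀ {h e} → HasDeg h e → h ∣ monic v → e ≤ d → e ≡ 0) where
    open QuotientRing v public
    open Char2 R

    nontrivial : 1# ≢ 0#
    nontrivial e = contradiction (∣-deg (hasDeg-monic v) hasDeg-1 (rem-0⇒∣ 1P e)) λ ()

    -- The gcd of x and the modulus has degree at most that of x, so `minimal` makes it 1, and the
    -- Bézout coefficient of x is the inverse.
    inverse : ∀ x → x ≢ 0# → ∃ λ y → x * y ≡ 1#
    inverse x x≢0 = go (degree? B.gcd)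
      where
      module B = Bezout (bezout (toList x) f)
      go : B.gcd ≋ [] ⊎ ∃ (HasDeg B.gcd) → ∃ λ y → x * y ≡ 1#
      go (inj₁ z) = contradiction (trans (sym (rem-toList x)) (rem-cong {toList x} {[]} x≋0)) x≢0
        where
        x≋0 : toList x ≋ []
        x≋0 = let s , e = B.gcd∣p in ≋-trans e (≋-trans (P.*-congˡ s z) (P.*-zeroʳ s))
      go (inj₂ (e , h)) = rem B.u , trans
        (trans (is-rem (*-hom (rep {p = toList x} (sym (rem-toList x))) (rep {p = B.u} refl))) (rem-cong (P.*-comm (toList x) B.u)))
        (~⇒rem {xu} {1P} ⟨ B.v , one ⟩)
        where
        xu = B.u *P toList x
        e≤d : e ≤ d
        e≤d = bound (degree? (toList x))
          where
          bound : toList x ≋ [] ⊎ ∃ (HasDeg (toList x)) → e ≤ d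
          bound (inj₁ x≋0)     = contradiction (trans (sym (rem-toList x)) (rem-cong {toList x} {[]} x≋0)) x≢0
          bound (inj₂ (c , hx)) = ℕ.≤-trans (∣-deg h hx B.gcd∣p) (ℕ.s≤s⁻¹ (below⇒< hx (below-toList x)))
        gcd≋1 : B.gcd ≋ 1P
        gcd≋1 = hasDeg0⇒1 (subst (HasDeg B.gcd) (minimal h B.gcd∣q e≤d) h)
        one : (xu +P 1P) ≋ (B.v *P f)
        one = ≋-trans (P.+-cong (≋-refl {xu}) (≋-trans (≋-sym gcd≋1) B.identity))
          (≋-trans (≋-sym (P.+-assoc xu xu (B.v *P f))) (P.+-cong (P.+-self xu) ≋-refl))

    N = ℕ.pred (2 ℕ.^ suc d)

    size : 2 ℕ.^ suc d ≡ suc N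
    size = sym (ℕ.suc-pred (2 ℕ.^ suc d) {{ℕ.m^n≢0 2 (suc d)}})

    enc : K → Fin (suc N)
    enc x = Fin.cast size (encode x)

    dec : Fin (suc N) → K
    dec i = decode (Fin.cast (sym size) i)

    dec-enc : ∀ x → dec (enc x) ≡ x
    dec-enc x = trans (cong decode (trans (Fin.cast-trans size (sym size) (encode x)) (Fin.cast-is-id refl (encode x)))) (decode-encode x)

    enc-dec : ∀ i → enc (dec i) ≡ i
    enc-dec i = trans (cong (Fin.cast size) (encode-decode {suc d} (Fin.cast (sym size) i)))
      (trans (Fin.cast-trans (sym size) size i) (Fin.cast-is-id refl i))

    module F = FiniteFields.FiniteField R nontrivial inverse enc dec dec-enc enc-dec

    X-fixed : X ^ (2 ℕ.^ suc d) ≡ X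
    X-fixed = trans (cong (X ^_) size) (go (X F.≟ 0#))
      where
      go : Dec (X ≡ 0#) → X * X ^ N ≡ X
      go (yes e) = trans (cong (_* X ^ N) e) (trans (zeroˡ _) (sym e))
      go (no ne) = trans (cong (X *_) (F.fermat X ne)) (*-identityʳ X)

    -- All nonzero elements would be roots of unity of exponent 2^(k+1) - 1, which bounds their
    -- number.
    fixed-bound : ∀ k → (∀ x → x ^ (2 ℕ.^ suc k) ≡ x) → suc N ≤ 2 ℕ.^ suc k
    fixed-bound k fixed = subst (suc N ≤_) size-k (s≤s (F.unit-root-bound 0<N′ xs xs-injective roots))
      where
      N′ = ℕ.pred (2 ℕ.^ suc k)
      size-k : suc N′ ≡ 2 ℕ.^ suc k
      size-k = ℕ.suc-pred (2 ℕ.^ suc k) {{ℕ.m^n≢0 2 (suc k)}}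
      0<N′ : 0 < N′
      0<N′ = ℕ.pred-mono-≤ (1<2^ k)
      index : Fin N → Fin (suc N)
      index = Fin.punchIn (enc 0#)
      xs : Fin N → K
      xs = dec ∘ index
      xs≢0 : ∀ i → xs i ≢ 0#
      xs≢0 i e = Fin.punchInᵢ≢i (enc 0#) i (trans (sym (enc-dec _)) (cong enc e))
      xs-injective : Injective _≡_ _≡_ xs
      xs-injective {i} {j} e = Fin.punchIn-injective (enc 0#) i j (trans (sym (enc-dec (index i))) (trans (cong enc e) (enc-dec (index j))))
      roots : ∀ i → xs i ^ N′ ≡ 1#
      roots i = F.cancel (xs≢0 i) (trans (trans (cong (xs i ^_) size-k) (fixed (xs i))) (sym (*-identityʳ (xs i))))

    module _ {n} (f∣ : monic v ∣ frob (suc n)) (new : ∀ {e} → e < n → ¬ monic v ∣ frob (suc e)) where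

      -- If n < d, the 2^(d+1) elements of the quotient would all satisfy x^(2^(n+1)) = x, too many
      -- for that equation. If d < n, Fermat's theorem makes the factor divide `frob (suc d)`, so it
      -- would not be new.
      degree : d ≡ n
      degree = ℕ.≤-antisym
        (ℕ.≮⇒≥ λ n<d → ℕ.<⇒≱ (ℕ.^-monoʳ-< 2 (s≤s (s≤s z≤n)) (s≤s n<d))
          (subst (_≤ 2 ℕ.^ suc n) (sym size) (fixed-bound n (frob∣⇒fixed (suc n) f∣))))
        (ℕ.≮⇒≥ λ d<n → new d<n (fixed⇒frob∣ (suc d) X-fixed))

  -- Indexed by degree and group order alone, so that the equality of degrees moves the whole
  -- package in one `subst₂`.
  record PrimitiveExtension (n N : ℕ) : Set where
    field
      modulus : Vec Bool n
    open Char2 (quotientRing modulus)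
    open Order (quotientRing modulus)
    field
      γ : K
      orderMultiple : OrderMultiple N γ
      γ^N≡1 : γ ^ N ≡ 1#

  primitiveExtension : ∀ n {N} → 2 ℕ.^ suc n ≡ suc N → PrimitiveExtension (suc n) N
  primitiveExtension n {N} size = go (newFactor n)
    where
    go : (∃ λ d → ∃ λ (v : Vec Bool (suc d)) → monic v ∣ frob (suc n)
      × (∀ {h e} → HasDeg h e → h ∣ monic v → e ≤ d → e ≡ 0)
      × (∀ {e} → e < n → ¬ monic v ∣ frob (suc e))) → PrimitiveExtension (suc n) N
    go (d , v , v∣ , minimal , new) = subst₂ PrimitiveExtension (cong suc I.degree′) N≡ ext
      where
      module I where
        open IrreducibleQuotient v minimal public
        degree′ : d ≡ n
        degree′ = degree v∣ new
      N≡ : I.N ≡ N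
      N≡ = trans (cong (λ k → ℕ.pred (2 ℕ.^ suc k)) I.degree′) (cong ℕ.pred size)
      ext : PrimitiveExtension (suc d) I.N
      ext = from-generator (I.F.generator (ℕ.pred-mono-≤ (1<2^ d)))
        where
        from-generator : ∃ I.F.PrimitiveElement → PrimitiveExtension (suc d) I.N
        from-generator (γ , prim) = record
          { modulus = v ; γ = γ
          ; orderMultiple = I.F.PrimitiveElement.orderMultiple prim
          ; γ^N≡1 = I.F.PrimitiveElement.γ^N≡1 prim }

-- Relative difference sets: second moments and the sieve.

module DifferenceSets where

  open import Data.List.Base using (List; []; _∷_; length)
  open import Data.List.Relation.Unary.All as All using (All; []; _∷_)
  open import Data.List.Relation.Unary.AllPairs using (AllPairs; []; _∷_)
  open import Data.Nat.Base using (ℕ; zero; suc; _+_; _*_; _∸_; _^_; _<_; _≤_; z≤n; s≤s; NonZero; pred; >-nonZero; ≢-nonZero⁻¹)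
  open import Data.Nat.Divisibility
  open import Data.Nat.ListAction using (product)
  open import Data.Nat.Primality using (Prime; euclidsLemma; prime⇒irreducible; prime⇒nonZero; ¬prime[1])
  open import Data.Nat.Properties
  open import Data.Nat.Solver using (module +-*-Solver)

  ∑ : ℕ → (ℕ → ℕ) → ℕ
  ∑ zero    f = 0
  ∑ (suc n) f = f 0 + ∑ n (f ∘ suc)

  ∑-cong : ∀ n {f g} → (∀ i → f i ≡ g i) → ∑ n f ≡ ∑ n g
  ∑-cong zero    e = refl
  ∑-cong (suc n) e = cong₂ _+_ (e 0) (∑-cong n (e ∘ suc))

  ∑-mono : ∀ n {f g} → (∀ {i} → i < n → f i ≤ g i) → ∑ n f ≤ ∑ n g
  ∑-mono zero    e = z≤n
  ∑-mono (suc n) e = +-mono-≤ (e (s≤s z≤n)) (∑-mono n (e ∘ s≤s))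

  ∑-0 : ∀ n → ∑ n (λ _ → 0) ≡ 0
  ∑-0 zero    = refl
  ∑-0 (suc n) = ∑-0 n

  ∑-const : ∀ n c → ∑ n (λ _ → c) ≡ n * c
  ∑-const zero    c = refl
  ∑-const (suc n) c = cong (c +_) (∑-const n c)

  ∑-distrib-+ : ∀ n f g → ∑ n (λ i → f i + g i) ≡ ∑ n f + ∑ n g
  ∑-distrib-+ zero    f g = refl
  ∑-distrib-+ (suc n) f g = trans (cong (f 0 + g 0 +_) (∑-distrib-+ n (f ∘ suc) (g ∘ suc)))
    (solve 4 (λ a b c d → (a :+ b) :+ (c :+ d) := (a :+ c) :+ (b :+ d)) refl (f 0) (g 0) (∑ n (f ∘ suc)) (∑ n (g ∘ suc)))
    where open +-*-Solver

  ∑-distribˡ-* : ∀ n c f → ∑ n (λ i → c * f i) ≡ c * ∑ n f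
  ∑-distribˡ-* zero    c f = sym (*-zeroʳ c)
  ∑-distribˡ-* (suc n) c f = trans (cong (c * f 0 +_) (∑-distribˡ-* n c (f ∘ suc))) (sym (*-distribˡ-+ c (f 0) _))

  ∑-swap : ∀ m n (f : ℕ → ℕ → ℕ) → ∑ m (λ i → ∑ n (f i)) ≡ ∑ n (λ j → ∑ m (λ i → f i j))
  ∑-swap zero    n f = sym (∑-0 n)
  ∑-swap (suc m) n f = trans (cong (∑ n (f 0) +_) (∑-swap m n (f ∘ suc))) (sym (∑-distrib-+ n (f 0) _))

  ∑-split : ∀ m n f → ∑ (m + n) f ≡ ∑ m f + ∑ n (λ i → f (m + i))
  ∑-split zero    n f = refl
  ∑-split (suc m) n f = trans (cong (f 0 +_) (∑-split m n (f ∘ suc))) (sym (+-assoc (f 0) _ _))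

  ∑-blocks : ∀ m e f → ∑ (m * e) f ≡ ∑ m (λ j → ∑ e (λ c → f (j * e + c)))
  ∑-blocks zero    e f = refl
  ∑-blocks (suc m) e f = trans (∑-split e (m * e) f) (cong (∑ e f +_) (trans (∑-blocks m e (λ i → f (e + i)))
    (∑-cong m λ j → ∑-cong e λ c → cong f (sym (+-assoc e (j * e) c)))))

  ∑-last : ∀ n f → ∑ (suc n) f ≡ ∑ n f + f n
  ∑-last n f = trans (cong (λ k → ∑ k f) (+-comm 1 n)) (trans (∑-split n 1 f)
    (cong (∑ n f +_) (trans (+-identityʳ _) (cong f (+-identityʳ n)))))

  ∑-shift : ∀ n f → (∀ i → f (n + i) ≡ f i) → ∀ s → ∑ n (λ i → f (s + i)) ≡ ∑ n f
  ∑-shift n f periodic zero    = refl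
  ∑-shift n f periodic (suc s) = trans
    (+-cancelˡ-≡ (f s) (∑ n (λ i → f (suc s + i))) (∑ n (λ i → f (s + i)))
      (trans (cong₂ _+_ (cong f (sym (+-identityʳ s))) (∑-cong n λ i → cong f (sym (+-suc s i))))
      (trans (∑-last n (λ i → f (s + i)))
      (trans (+-comm _ (f (s + n))) (cong (_+ ∑ n (λ i → f (s + i))) (trans (cong f (+-comm s n)) (periodic s)))))))
    (∑-shift n f periodic s)

  ∑-member : ∀ {n} f {i} → i < n → f i ≤ ∑ n f
  ∑-member {suc n} f {zero}  _         = m≤m+n (f 0) _
  ∑-member {suc n} f {suc i} (s≤s i<n) = ≤-trans (∑-member (f ∘ suc) i<n) (m≤n+m _ (f 0))

  ∑-positive : ∀ n f → 0 < ∑ n f → ∃ λ i → i < n × 0 < f i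
  ∑-positive (suc n) f pos with f 0 in eq
  ... | suc _ = 0 , s≤s z≤n , subst (0 <_) (sym eq) (s≤s z≤n)
  ... | zero with ∑-positive n (f ∘ suc) pos
  ... | i , i<n , h = suc i , s≤s i<n , h

  ∑-atMostOne : ∀ n f → (∀ i → f i ≤ 1) → (∀ {i j} → i < n → j < n → 0 < f i → 0 < f j → i ≡ j) → ∑ n f ≤ 1
  ∑-atMostOne zero    f le uniq = z≤n
  ∑-atMostOne (suc n) f le uniq with f 0 in eq
  ... | zero  = ∑-atMostOne n (f ∘ suc) (le ∘ suc) λ i<n j<n hi hj → suc-injective (uniq (s≤s i<n) (s≤s j<n) hi hj)
  ... | suc k = subst (_≤ 1) (sym (trans (cong (suc k +_) rest) (+-identityʳ (suc k)))) (subst (_≤ 1) eq (le 0))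
    where
    rest : ∑ n (f ∘ suc) ≡ 0
    rest = n≤0⇒n≡0 (≮⇒≥ λ pos → let i , i<n , h = ∑-positive n (f ∘ suc) pos in
      contradiction (uniq (s≤s z≤n) (s≤s i<n) (subst (0 <_) (sym eq) (s≤s z≤n)) h) λ ())

  -- Where `f` dominates `g` termwise, the total excess bounds each single one. It extracts the
  -- class of 0 from the variance without subtraction.
  ∑-excess : ∀ n f g K → (∀ i → g i ≤ f i) → ∑ (suc n) f ≤ ∑ (suc n) g + K → f 0 ≤ g 0 + K
  ∑-excess n f g K g≤f le = +-cancelʳ-≤ (∑ n (g ∘ suc)) (f 0) (g 0 + K) (begin
    f 0 + ∑ n (g ∘ suc)       ≤⟨ +-monoʳ-≤ (f 0) (∑-mono n λ {i} _ → g≤f (suc i)) ⟩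
    f 0 + ∑ n (f ∘ suc)       ≤⟨ le ⟩
    g 0 + ∑ n (g ∘ suc) + K   ≡⟨ solve 3 (λ a b c → a :+ b :+ c := a :+ c :+ b) refl (g 0) (∑ n (g ∘ suc)) K ⟩
    g 0 + K + ∑ n (g ∘ suc) ∎)
    where
    open ≤-Reasoning
    open +-*-Solver

  2*ab≤a²+b² : ∀ a b → 2 * (a * b) ≤ a * a + b * b
  2*ab≤a²+b² a b with ≤-total a b
  ... | inj₁ a≤b = subst (λ b → 2 * (a * b) ≤ a * a + b * b) (m+[n∸m]≡n a≤b) (≤-trans (m≤m+n _ (d * d))
    (≤-reflexive (solve 2 (λ a d → con 2 :* (a :* (a :+ d)) :+ d :* d := a :* a :+ (a :+ d) :* (a :+ d)) refl a d)))
    where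
    d = b ∸ a
    open +-*-Solver
  ... | inj₂ b≤a = subst (λ a → 2 * (a * b) ≤ a * a + b * b) (m+[n∸m]≡n b≤a) (≤-trans (m≤m+n _ (d * d))
    (≤-reflexive (solve 2 (λ b d → con 2 :* ((b :+ d) :* b) :+ d :* d := (b :+ d) :* (b :+ d) :+ b :* b) refl b d)))
    where
    d = a ∸ b
    open +-*-Solver

  square-cancel-≤ : ∀ {a b} → a * a ≤ b * b → a ≤ b
  square-cancel-≤ {a} {b} le = ≮⇒≥ λ b<a → <⇒≱ (*-mono-< b<a b<a) le

  -- The hypothesis is (a - b)² ≤ D², written without subtraction.
  close : ∀ a b D → a * a + b * b ≤ 2 * (a * b) + D * D → a ≤ b + D
  close a b D le with ≤-total a b
  ... | inj₁ a≤b = ≤-trans a≤b (m≤m+n b D)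
  ... | inj₂ b≤a = subst (_≤ b + D) (m+[n∸m]≡n b≤a) (+-monoʳ-≤ b (square-cancel-≤ (+-cancelˡ-≤ (2 * (a * b)) (d * d) (D * D)
    (subst (λ a → 2 * (a * b) + d * d ≤ 2 * (a * b) + D * D) (m+[n∸m]≡n b≤a) (begin
      2 * ((b + d) * b) + d * d         ≡⟨ solve 2 (λ b d → con 2 :* ((b :+ d) :* b) :+ d :* d := (b :+ d) :* (b :+ d) :+ b :* b) refl b d ⟩
      (b + d) * (b + d) + b * b         ≡⟨ cong (λ a → a * a + b * b) (m+[n∸m]≡n b≤a) ⟩
      a * a + b * b                     ≤⟨ le ⟩
      2 * (a * b) + D * D               ≡⟨ cong (λ a → 2 * (a * b) + D * D) (m+[n∸m]≡n b≤a) ⟨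
      2 * ((b + d) * b) + D * D ∎)))))
    where
    d = a ∸ b
    open ≤-Reasoning
    open +-*-Solver

  indicator : ∀ {P : Set} → Dec P → ℕ
  indicator (yes _) = 1
  indicator (no  _) = 0

  indicator≤1 : ∀ {P : Set} (d : Dec P) → indicator d ≤ 1
  indicator≤1 (yes _) = s≤s z≤n
  indicator≤1 (no  _) = z≤n

  indicator-true : ∀ {P : Set} (d : Dec P) → P → indicator d ≡ 1
  indicator-true (yes _) p = refl
  indicator-true (no ¬p) p = contradiction p ¬p

  indicator-positive : ∀ {P : Set} (d : Dec P) → 0 < indicator d → P
  indicator-positive (yes p) _ = p

  positive-* : ∀ a b → 0 < a * b → 0 < a × 0 < b
  positive-* (suc a) (suc b) _ = s≤s z≤n , s≤s z≤n
  positive-* (suc a) zero    h = contradiction (subst (0 <_) (*-zeroʳ a) h) λ ()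

  -- Euler's function of `product ps` when `ps` consists of distinct primes.
  totient : List ℕ → ℕ
  totient []       = 1
  totient (p ∷ ps) = pred p * totient ps

  -- ℓ is the indicator function of a relative difference set modulo N = q² - 1.
  module DifferenceSet (q₁ : ℕ) (ℓ : ℕ → ℕ)
    (periodic : ∀ i → ℓ (q₁ * suc (suc q₁) + i) ≡ ℓ i) (idempotent : ∀ i → ℓ i * ℓ i ≡ ℓ i)
    (large : suc q₁ ≤ ∑ (q₁ * suc (suc q₁)) ℓ)
    (differences : ∀ {h} → 0 < h → h < q₁ * suc (suc q₁) → ∑ (q₁ * suc (suc q₁)) (λ i → ℓ i * ℓ (i + h)) ≤ 1)
    where

    q N : ℕ
    q = suc q₁
    N = q₁ * suc q

    periodic* : ∀ k i → ℓ (k * N + i) ≡ ℓ i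
    periodic* zero    i = refl
    periodic* (suc k) i = trans (cong ℓ (+-assoc N (k * N) i)) (trans (periodic (k * N + i)) (periodic* k i))

    module Class (M₁ e₁ : ℕ) (N≡ : N ≡ suc M₁ * suc e₁) where

      M e : ℕ
      M = suc M₁
      e = suc e₁

      count : ℕ → ℕ
      count c = ∑ M (λ j → ℓ (j * e + c))

      ∑-count : ∑ e count ≡ ∑ N ℓ
      ∑-count = trans (sym (∑-swap M e (λ j c → ℓ (j * e + c)))) (trans (sym (∑-blocks M e ℓ)) (cong (λ n → ∑ n ℓ) (sym N≡)))

      -- A squared count is a number of pairs within one class. Such pairs differ by a multiple
      -- `k * e`, and over all classes the first member runs through a full period.
      ∑-count² : ∑ e (λ c → count c * count c) ≡ ∑ M (λ k → ∑ N (λ i → ℓ i * ℓ (i + k * e)))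
      ∑-count² = begin
        ∑ e (λ c → count c * count c)
          ≡⟨ ∑-cong e (λ c → trans (sym (∑-distribˡ-* M (count c) (λ j → ℓ (j * e + c)))) (∑-cong M λ j →
               trans (*-comm (count c) (ℓ (j * e + c))) (trans (cong (ℓ (j * e + c) *_) (sym (shifted c j)))
                 (sym (∑-distribˡ-* M (ℓ (j * e + c)) (λ k → ℓ (j * e + c + k * e))))))) ⟩
        ∑ e (λ c → ∑ M λ j → ∑ M λ k → ℓ (j * e + c) * ℓ (j * e + c + k * e))
          ≡⟨ ∑-swap M e (λ j c → ∑ M λ k → ℓ (j * e + c) * ℓ (j * e + c + k * e)) ⟨
        ∑ M (λ j → ∑ e λ c → ∑ M λ k → ℓ (j * e + c) * ℓ (j * e + c + k * e))
          ≡⟨ ∑-blocks M e (λ i → ∑ M λ k → ℓ i * ℓ (i + k * e)) ⟨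
        ∑ (M * e) (λ i → ∑ M λ k → ℓ i * ℓ (i + k * e))
          ≡⟨ ∑-swap (M * e) M (λ i k → ℓ i * ℓ (i + k * e)) ⟩
        ∑ M (λ k → ∑ (M * e) λ i → ℓ i * ℓ (i + k * e))
          ≡⟨ cong (λ n → ∑ M (λ k → ∑ n λ i → ℓ i * ℓ (i + k * e))) N≡ ⟨
        ∑ M (λ k → ∑ N (λ i → ℓ i * ℓ (i + k * e))) ∎
        where
        open ≡-Reasoning
        open +-*-Solver
        shifted : ∀ c j → ∑ M (λ k → ℓ (j * e + c + k * e)) ≡ count c
        shifted c j = trans
          (∑-cong M λ k → cong ℓ (solve 4 (λ j k e c → j :* e :+ c :+ k :* e := (j :+ k) :* e :+ c) refl j k e c))
          (∑-shift M (λ k → ℓ (k * e + c)) (λ k → trans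
            (cong ℓ (trans (solve 4 (λ M k e c → (M :+ k) :* e :+ c := M :* e :+ (k :* e :+ c)) refl M k e c)
              (cong (_+ (k * e + c)) (sym N≡)))) (periodic (k * e + c))) j)

      -- The difference 0 contributes the size of the set, and each of the M₁ nonzero multiples of
      -- `e` at most 1.
      ∑-count²≤ : ∑ e (λ c → count c * count c) ≤ ∑ N ℓ + M₁
      ∑-count²≤ = begin
        ∑ e (λ c → count c * count c)              ≡⟨ ∑-count² ⟩
        ∑ N (λ i → ℓ i * ℓ (i + 0)) + ∑ M₁ (λ k → ∑ N (λ i → ℓ i * ℓ (i + suc k * e)))
          ≤⟨ +-mono-≤ (≤-reflexive (∑-cong N λ i → trans (cong (λ j → ℓ i * ℓ j) (+-identityʳ i)) (idempotent i)))
               (∑-mono M₁ λ {k} k<M₁ → differences {suc k * e} (s≤s z≤n)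
                 (subst (suc k * e <_) (sym N≡) (*-monoˡ-< e (s≤s k<M₁)))) ⟩
        ∑ N ℓ + ∑ M₁ (λ _ → 1)                      ≡⟨ cong (∑ N ℓ +_) (trans (∑-const M₁ 1) (*-identityʳ M₁)) ⟩
        ∑ N ℓ + M₁ ∎
        where open ≤-Reasoning

    module _ (0<q₁ : 0 < q₁) where

      N-suc : N ≡ suc (pred N) * 1
      N-suc = trans (sym (suc-pred N {{>-nonZero (*-mono-≤ 0<q₁ (s≤s z≤n))}})) (sym (*-identityʳ _))

      -- For e = 1 all of the set lies in one class, whence Λ(Λ - 1) < N = q² - 1, which excludes Λ
      -- > q.
      size : ∑ N ℓ ≡ q
      size = ≤-antisym (≮⇒≥ too-large) large
        where
        Λ = ∑ N ℓ
        module C = Class (pred N) 0 N-suc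
        count-0 : C.count 0 ≡ Λ
        count-0 = trans (sym (+-identityʳ (C.count 0))) C.∑-count
        square : Λ * Λ ≤ Λ + pred N
        square = subst (λ x → x * x ≤ Λ + pred N) count-0 (≤-trans (≤-reflexive (sym (+-identityʳ _))) C.∑-count²≤)
        too-large : ¬ q < Λ
        too-large q<Λ = <⇒≱ (begin-strict
          Λ + pred N     ≤⟨ +-monoʳ-≤ Λ (pred[n]≤n {N}) ⟩
          Λ + q₁ * suc q <⟨ +-monoʳ-< Λ (*-monoˡ-< (suc q) (n<1+n q₁)) ⟩
          Λ + q * suc q  ≤⟨ +-monoʳ-≤ Λ (*-monoʳ-≤ q q<Λ) ⟩
          Λ + q * Λ      ≤⟨ *-monoˡ-≤ Λ q<Λ ⟩
          Λ * Λ ∎) square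
          where open ≤-Reasoning

      module _ (B : ℕ) (q≤B² : q ≤ B * B) where

        -- The variance of the class counts is at most q.
        class-bound : ∀ M₁ e₁ (N≡ : N ≡ suc M₁ * suc e₁) → let e = suc e₁ ; n = Class.count M₁ e₁ N≡ 0 in
          e * n ≤ q + e * B × q ≤ e * n + e * B
        class-bound M₁ e₁ N≡ = close (e * n) q (e * B) variance ,
          close q (e * n) (e * B) (subst₂ (λ s t → s ≤ 2 * t + (e * B) * (e * B)) (+-comm ((e * n) * (e * n)) (q * q)) (*-comm (e * n) q) variance)
          where
          open ≤-Reasoning
          open +-*-Solver
          open Class M₁ e₁ N≡
          n = count 0
          -- `f c` exceeds `g c` by (e n_c - q)². Over all c the excess sums to at most e² q,
          -- because the part e² M₁ due to the nonzero differences is at most e q².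
          f g : ℕ → ℕ
          f c = (e * count c) * (e * count c) + q * q
          g c = 2 * ((e * count c) * q)
          e²M₁≤eq² : e * e * M₁ ≤ e * (q * q)
          e²M₁≤eq² = begin
            e * e * M₁           ≤⟨ *-monoʳ-≤ (e * e) (n≤1+n M₁) ⟩
            e * e * suc M₁       ≡⟨ solve 2 (λ e M → e :* e :* M := e :* (M :* e)) refl e (suc M₁) ⟩
            e * (suc M₁ * e)     ≡⟨ cong (e *_) N≡ ⟨
            e * (q₁ * suc q)     ≤⟨ *-monoʳ-≤ e (≤-trans (n≤1+n _) (≤-reflexive (solve 1 (λ x → con 1 :+ x :* (con 2 :+ x) := (con 1 :+ x) :* (con 1 :+ x)) refl q₁))) ⟩
            e * (q * q) ∎
          total : ∑ e f ≤ ∑ e g + (e * B) * (e * B)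
          total = begin
            ∑ e f
              ≡⟨ ∑-distrib-+ e (λ c → (e * count c) * (e * count c)) (λ _ → q * q) ⟩
            ∑ e (λ c → (e * count c) * (e * count c)) + ∑ e (λ _ → q * q)
              ≡⟨ cong₂ _+_ (trans (∑-cong e λ c → solve 2 (λ e n → (e :* n) :* (e :* n) := e :* e :* (n :* n)) refl e (count c))
                   (∑-distribˡ-* e (e * e) (λ c → count c * count c))) (∑-const e (q * q)) ⟩
            e * e * ∑ e (λ c → count c * count c) + e * (q * q)
              ≤⟨ +-monoˡ-≤ (e * (q * q)) (*-monoʳ-≤ (e * e) (subst (λ Λ → ∑ e (λ c → count c * count c) ≤ Λ + M₁) size ∑-count²≤)) ⟩
            e * e * (q + M₁) + e * (q * q)
              ≡⟨ cong (_+ e * (q * q)) (*-distribˡ-+ (e * e) q M₁) ⟩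
            e * e * q + e * e * M₁ + e * (q * q)
              ≤⟨ +-monoˡ-≤ (e * (q * q)) (+-mono-≤ (*-monoʳ-≤ (e * e) q≤B²) e²M₁≤eq²) ⟩
            e * e * (B * B) + e * (q * q) + e * (q * q)
              ≡⟨ solve 3 (λ e b q → e :* e :* (b :* b) :+ e :* (q :* q) :+ e :* (q :* q) := (con 2 :* e :* q) :* q :+ (e :* b) :* (e :* b)) refl e B q ⟩
            2 * e * q * q + (e * B) * (e * B)
              ≡⟨ cong (λ Λ → 2 * e * q * Λ + (e * B) * (e * B)) (trans ∑-count size) ⟨
            2 * e * q * ∑ e count + (e * B) * (e * B)
              ≡⟨ cong (_+ (e * B) * (e * B)) (trans (sym (∑-distribˡ-* e (2 * e * q) count))
                   (∑-cong e λ c → solve 3 (λ e q n → con 2 :* e :* q :* n := con 2 :* (e :* n :* q)) refl e q (count c))) ⟩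
            ∑ e g + (e * B) * (e * B) ∎
          variance : f 0 ≤ g 0 + (e * B) * (e * B)
          variance = ∑-excess e₁ f g ((e * B) * (e * B)) (λ c → 2*ab≤a²+b² (e * count c) q) total

        -- The sieve over the prime divisors of the modulus.

        dvd : ℕ → ℕ → ℕ
        dvd e i = indicator (e ∣? i)

        avoids : List ℕ → ℕ → ℕ
        avoids []       i = 1
        avoids (p ∷ ps) i = (1 ∸ dvd p i) * avoids ps i

        sifted : List ℕ → ℕ → ℕ
        sifted ps e = ∑ N (λ i → ℓ i * (dvd e i * avoids ps i))

        dvd-* : ∀ {e p} → Prime p → p ∤ e → ∀ i → dvd (e * p) i ≡ dvd e i * dvd p i
        dvd-* {e} {p} pp p∤e i with e ∣? i | p ∣? i | (e * p) ∣? i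
        ... | yes _ | yes _ | yes _ = refl
        ... | no _  | _     | no _  = refl
        ... | yes _ | no _  | no _  = refl
        ... | no e∤i | _ | yes h = contradiction (∣-trans (m∣m*n p) h) e∤i
        ... | yes _ | no p∤i | yes h = contradiction (∣-trans (n∣m*n e) h) p∤i
        ... | yes (divides s refl) | yes p∣se | no ∤ with euclidsLemma s e pp p∣se
        ... | inj₂ p∣e = contradiction p∣e p∤e
        ... | inj₁ (divides t refl) = contradiction (divides t (solve 3 (λ t p e → t :* p :* e := t :* (e :* p)) refl t p e)) ∤
          where open +-*-Solver

        -- Legendre's recursion: a multiple of `e` either avoids `p` or is a multiple of `e * p`.
        sifted-∷ : ∀ {e p} ps → Prime p → p ∤ e → sifted ps e ≡ sifted (p ∷ ps) e + sifted ps (e * p)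
        sifted-∷ {e} {p} ps pp p∤e = trans (∑-cong N λ i → trans
          (split (ℓ i) (dvd e i) (avoids ps i) (indicator≤1 (p ∣? i)))
          (cong (λ d → ℓ i * (dvd e i * avoids (p ∷ ps) i) + ℓ i * (d * avoids ps i)) (sym (dvd-* pp p∤e i))))
          (∑-distrib-+ N (λ i → ℓ i * (dvd e i * avoids (p ∷ ps) i)) (λ i → ℓ i * (dvd (e * p) i * avoids ps i)))
          where
          open +-*-Solver
          split : ∀ l d a {t} → t ≤ 1 → l * (d * a) ≡ l * (d * ((1 ∸ t) * a)) + l * (d * t * a)
          split l d a z≤n       = solve 3 (λ l d a → l :* (d :* a) := l :* (d :* (con 1 :* a)) :+ l :* (d :* con 0 :* a)) refl l d a
          split l d a (s≤s z≤n) = solve 3 (λ l d a → l :* (d :* a) := l :* (d :* (con 0 :* a)) :+ l :* (d :* con 1 :* a)) refl l d a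

        sifted-[] : ∀ M₁ e₁ (N≡ : N ≡ suc M₁ * suc e₁) → sifted [] (suc e₁) ≡ Class.count M₁ e₁ N≡ 0
        sifted-[] M₁ e₁ N≡ = begin
          ∑ N (λ i → ℓ i * (dvd e i * 1))                             ≡⟨ cong (λ n → ∑ n (λ i → ℓ i * (dvd e i * 1))) N≡ ⟩
          ∑ (M * e) (λ i → ℓ i * (dvd e i * 1))                       ≡⟨ ∑-blocks M e (λ i → ℓ i * (dvd e i * 1)) ⟩
          ∑ M (λ j → ∑ e (λ c → ℓ (j * e + c) * (dvd e (j * e + c) * 1)))
            ≡⟨ ∑-cong M (λ j → trans (cong₂ _+_ (first j) (rest j)) (+-identityʳ _)) ⟩
          ∑ M (λ j → ℓ (j * e + 0)) ∎
          where
          open ≡-Reasoning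
          M = suc M₁
          e = suc e₁
          first : ∀ j → ℓ (j * e + 0) * (dvd e (j * e + 0) * 1) ≡ ℓ (j * e + 0)
          first j = trans (cong (λ d → ℓ (j * e + 0) * (d * 1)) (indicator-true (e ∣? (j * e + 0))
            (∣m∣n⇒∣m+n (n∣m*n j) (e ∣0)))) (*-identityʳ _)
          vanish : ∀ j c → c < e₁ → dvd e (j * e + suc c) ≡ 0
          vanish j c c<e₁ with e ∣? (j * e + suc c)
          ... | no _  = refl
          ... | yes d = contradiction (∣⇒≤ (∣m+n∣m⇒∣n d (n∣m*n j))) (<⇒≱ (s≤s c<e₁))
          rest : ∀ j → ∑ e₁ (λ c → ℓ (j * e + suc c) * (dvd e (j * e + suc c) * 1)) ≡ 0
          rest j = n≤0⇒n≡0 (≤-trans (∑-mono e₁ {g = λ _ → 0} λ {c} c<e₁ → ≤-reflexive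
            (trans (cong (λ d → ℓ (j * e + suc c) * (d * 1)) (vanish j c c<e₁)) (*-zeroʳ (ℓ (j * e + suc c))))) (≤-reflexive (∑-0 e₁)))

        Distinct : List ℕ → Set
        Distinct = AllPairs _≢_

        -- That is, |P e F - q φ(P)| ≤ 2^k e P B with k primes: the expected count is q φ(P) / (e
        -- P), and every prime doubles the number of classes that contribute an error B. As the
        -- recursion subtracts one count from another, each bound needs the opposite one for the
        -- subtracted count, and the two are proved together.
        sieve-bound : ∀ ps e → .{{NonZero e}} → All Prime ps → Distinct ps → All (_∤ e) ps → e * product ps ∣ N →
          let P = product ps ; F = sifted ps e ; E = 2 ^ length ps * (e * P * B) in
          P * e * F ≤ q * totient ps + E × q * totient ps ≤ P * e * F + E
        sieve-bound [] (suc e₁) [] [] [] (divides zero N≡0) = contradiction N≡0 (≢-nonZero⁻¹ N {{>-nonZero (*-mono-≤ 0<q₁ (s≤s z≤n))}})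
        sieve-bound [] (suc e₁) [] [] [] (divides (suc M₁) N≡) =
          let upper , lower = class-bound M₁ e₁ N≡′ in
          subst₂ _≤_ (cong₂ _*_ (sym (*-identityˡ e)) (sym F≡)) (cong₂ _+_ (sym (*-identityʳ q)) E≡) upper ,
          subst₂ _≤_ (sym (*-identityʳ q)) (cong₂ _+_ (cong₂ _*_ (sym (*-identityˡ e)) (sym F≡)) E≡) lower
          where
          e = suc e₁
          N≡′ : N ≡ suc M₁ * e
          N≡′ = trans N≡ (cong (suc M₁ *_) (*-identityʳ e))
          F≡ = sifted-[] M₁ e₁ N≡′
          E≡ : e * B ≡ 1 * (e * 1 * B)
          E≡ = sym (trans (*-identityˡ _) (cong (_* B) (*-identityʳ e)))
        sieve-bound (p ∷ ps) e (pp ∷ primes) (p≢ ∷ distinct) (p∤e ∷ ∤e) dv =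
          upper , lower
          where
          open ≤-Reasoning
          open +-*-Solver
          instance
            p≢0 : NonZero p
            p≢0 = prime⇒nonZero pp
          p₁ = pred p
          P = product ps
          φ = totient ps
          t = 2 ^ length ps * (e * P * B)
          F′ = sifted (p ∷ ps) e
          F₁ = sifted ps (e * p)
          F≡ : sifted ps e ≡ F′ + F₁
          F≡ = sifted-∷ ps pp p∤e
          sub-dv : e * P ∣ N
          sub-dv = ∣-trans (divides p (solve 3 (λ e p P → e :* (p :* P) := p :* (e :* P)) refl e p P)) dv
          ∤ep : ∀ {qs} → All Prime qs → All (_∤ e) qs → All (p ≢_) qs → All (_∤ e * p) qs
          ∤ep [] [] [] = []
          ∤ep (pr ∷ prs) (r∤e ∷ ∤es) (p≢r ∷ p≢s) = r∤ep ∷ ∤ep prs ∤es p≢s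
            where
            r∤ep : _ ∤ e * p
            r∤ep d with euclidsLemma e p pr d
            ... | inj₁ r∣e = r∤e r∣e
            ... | inj₂ r∣p with prime⇒irreducible pp r∣p
            ... | inj₁ refl = ¬prime[1] pr
            ... | inj₂ refl = p≢r refl
          IH₀ = sieve-bound ps e primes distinct ∤e sub-dv
          IH₁ = sieve-bound ps (e * p) {{m*n≢0 e p}} primes distinct (∤ep primes ∤e p≢) (subst (_∣ N) (sym (*-assoc e p P)) dv)
          E≡ : 2 ^ length (p ∷ ps) * (e * (p * P) * B) ≡ p * t + p * t
          E≡ = solve 5 (λ k e p P B → (con 2 :* k) :* (e :* (p :* P) :* B) := p :* (k :* (e :* P :* B)) :+ p :* (k :* (e :* P :* B))) refl (2 ^ length ps) e p P B
          t₁≡ : 2 ^ length ps * (e * p * P * B) ≡ p * t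
          t₁≡ = solve 5 (λ k e p P B → k :* (e :* p :* P :* B) := p :* (k :* (e :* P :* B))) refl (2 ^ length ps) e p P B
          S₁ = P * (e * p) * F₁
          split : p * (P * e * sifted ps e) ≡ p * P * e * F′ + S₁
          split = trans (cong (λ F → p * (P * e * F)) F≡)
            (solve 5 (λ p P e a b → p :* (P :* e :* (a :+ b)) := p :* P :* e :* a :+ P :* (e :* p) :* b) refl p P e F′ F₁)
          qφ : p * (q * φ) ≡ q * φ + q * (p₁ * φ)
          qφ = trans (cong (_* (q * φ)) (sym (suc-pred p)))
            (solve 3 (λ p q f → (con 1 :+ p) :* (q :* f) := q :* f :+ q :* (p :* f)) refl p₁ q φ)
          lower : q * (p₁ * φ) ≤ p * P * e * F′ + 2 ^ length (p ∷ ps) * (e * (p * P) * B)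
          lower = +-cancelˡ-≤ (q * φ) _ _ (begin
            q * φ + q * (p₁ * φ)                             ≡⟨ qφ ⟨
            p * (q * φ)                                      ≤⟨ *-monoʳ-≤ p (proj₂ IH₀) ⟩
            p * (P * e * sifted ps e + t)                    ≡⟨ trans (*-distribˡ-+ p _ t) (cong (_+ p * t) split) ⟩
            p * P * e * F′ + S₁ + p * t                      ≤⟨ +-monoˡ-≤ (p * t) (+-monoʳ-≤ (p * P * e * F′) (proj₁ IH₁)) ⟩
            p * P * e * F′ + (q * φ + 2 ^ length ps * (e * p * P * B)) + p * t
              ≡⟨ cong (λ z → p * P * e * F′ + (q * φ + z) + p * t) t₁≡ ⟩
            p * P * e * F′ + (q * φ + p * t) + p * t
              ≡⟨ solve 3 (λ a b c → a :+ (b :+ c) :+ c := b :+ (a :+ (c :+ c))) refl (p * P * e * F′) (q * φ) (p * t) ⟩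
            q * φ + (p * P * e * F′ + (p * t + p * t))       ≡⟨ cong (λ z → q * φ + (p * P * e * F′ + z)) E≡ ⟨
            q * φ + (p * P * e * F′ + 2 ^ length (p ∷ ps) * (e * (p * P) * B)) ∎)
          upper : p * P * e * F′ ≤ q * (p₁ * φ) + 2 ^ length (p ∷ ps) * (e * (p * P) * B)
          upper = +-cancelˡ-≤ (q * φ) _ _ (begin
            q * φ + p * P * e * F′                           ≤⟨ +-monoˡ-≤ (p * P * e * F′) (proj₂ IH₁) ⟩
            S₁ + 2 ^ length ps * (e * p * P * B) + p * P * e * F′
              ≡⟨ cong (λ z → S₁ + z + p * P * e * F′) t₁≡ ⟩
            S₁ + p * t + p * P * e * F′
              ≡⟨ solve 3 (λ a b c → a :+ b :+ c := c :+ a :+ b) refl S₁ (p * t) (p * P * e * F′) ⟩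
            p * P * e * F′ + S₁ + p * t                      ≡⟨ cong (_+ p * t) split ⟨
            p * (P * e * sifted ps e) + p * t                ≤⟨ +-monoˡ-≤ (p * t) (*-monoʳ-≤ p (proj₁ IH₀)) ⟩
            p * (q * φ + t) + p * t                          ≡⟨ cong (_+ p * t) (trans (*-distribˡ-+ p (q * φ) t) (cong (_+ p * t) qφ)) ⟩
            q * φ + q * (p₁ * φ) + p * t + p * t
              ≡⟨ solve 3 (λ a b c → a :+ b :+ c :+ c := a :+ (b :+ (c :+ c))) refl (q * φ) (q * (p₁ * φ)) (p * t) ⟩
            q * φ + (q * (p₁ * φ) + (p * t + p * t))         ≡⟨ cong (λ z → q * φ + (q * (p₁ * φ) + z)) E≡ ⟨
            q * φ + (q * (p₁ * φ) + 2 ^ length (p ∷ ps) * (e * (p * P) * B)) ∎)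

        avoids-positive : ∀ ps i → 0 < avoids ps i → All (_∤ i) ps
        avoids-positive []       i h = []
        avoids-positive (p ∷ ps) i h with p ∣? i
        ... | no p∤i = p∤i ∷ avoids-positive ps i (subst (0 <_) (+-identityʳ _) h)

        -- For e = 1 the hypothesis says that the main term exceeds the error, so the sifted count
        -- cannot vanish.
        sieve : ∀ ps → All Prime ps → Distinct ps → product ps ∣ N →
          2 ^ length ps * (product ps * B) < q * totient ps → ∃ λ i → 0 < ℓ i × All (_∤ i) ps
        sieve ps primes distinct dv main = go (∑-positive N _ (n≢0⇒n>0 sifted≢0))
          where
          P = product ps
          bound = proj₂ (sieve-bound ps 1 primes distinct (All.map (λ pr d → ¬prime[1] (subst Prime (∣1⇒≡1 d) pr)) primes)
            (subst (_∣ N) (sym (*-identityˡ P)) dv))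
          sifted≢0 : sifted ps 1 ≢ 0
          sifted≢0 e = <⇒≱ main (subst (q * totient ps ≤_) (trans
            (cong₂ _+_ (trans (cong (P * 1 *_) e) (*-zeroʳ (P * 1))) (cong (λ x → 2 ^ length ps * (x * B)) (*-identityˡ P))) refl) bound)
          go : (∃ λ i → i < N × 0 < ℓ i * (dvd 1 i * avoids ps i)) → ∃ λ i → 0 < ℓ i × All (_∤ i) ps
          go (i , _ , h) = let hℓ , h′ = positive-* (ℓ i) _ h in
            i , hℓ , avoids-positive ps i (proj₂ (positive-* (dvd 1 i) _ h′))

-- The exponents of trace one, and a primitive element among them.

module TraceOneElements where

  open CharacteristicTwo
  open PrimitiveRoots using (module Order)
  open TSRMatrices
  open Certificates using (prime-factor; module OrderCriterion)
  open DifferenceSets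
  open import Data.Fin.Base using (Fin)
  open import Data.List.Base using ([]; _∷_; length)
  open import Data.List.Membership.Propositional using (_∈_)
  open import Data.List.Relation.Unary.All as All using (All; []; _∷_)
  open import Data.List.Relation.Unary.AllPairs using (AllPairs; []; _∷_)
  open import Data.Nat.Base as ℕ using (ℕ; zero; suc; _<_; _≤_; z≤n; s≤s; NonZero)
  open import Data.Nat.Coprimality using (coprime-divisor; gcd≡1⇒coprime)
  open import Data.Nat.Divisibility as ℕ using (_∣_; _∤_)
  open import Data.Nat.GCD using (gcd; gcd[m,n]∣m; gcd[m,n]∣n)
  open import Data.Nat.ListAction using (product)
  open import Data.Nat.Primality using (Prime)
  open import Data.Nat.Solver using (module +-*-Solver)
  open import Relation.Binary.Definitions using (tri<; tri≈; tri>)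

  module TraceOne (R : Char2Ring) {m q₁} (2^m : 2 ℕ.^ m ≡ suc q₁) (0<q₁ : 0 < q₁)
    (enc : Char2Ring.K R → Fin (2 ℕ.^ (2 ℕ.* m))) (enc-injective : Injective _≡_ _≡_ enc) where
    open Char2 R
    open Order R
    open OrderCriterion R
    open Subfield R {m} 2^m 0<q₁ enc enc-injective

    tr : K → K
    tr x = x ^ q + x

    tr-+ : ∀ x y → tr (x + y) ≡ tr x + tr y
    tr-+ x y = trans (cong (_+ (x + y)) (frobenius-q x y))
      (solve 4 (λ a b x y → (a :+ b) :+ (x :+ y) := (a :+ x) :+ (b :+ y)) refl (x ^ q) (y ^ q) x y)
      where open Solver

    tr-*ˡ : ∀ {g} x → g ^ q ≡ g → tr (g * x) ≡ g * tr x
    tr-*ˡ {g} x fixed = trans (cong (_+ g * x) (trans (^-distrib-* g x q) (cong (_* x ^ q) fixed))) (sym (distribˡ g (x ^ q) x))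

    module _ {γ} (prim : PrimitiveElement γ) where
      open PrimitiveElement prim
      open ≡-Reasoning

      instance
        N≢0 : NonZero N
        N≢0 = ℕ.>-nonZero (ℕ.*-mono-≤ 0<q₁ (s≤s z≤n))

      cancel : ∀ {x y z} → x ≢ 0# → y * x ≡ z * x → y ≡ z
      cancel {x} {y} {z} x≢0 e = go (log x x≢0)
        where
        go : (∃ λ k → k < N × x ≡ γ ^ k) → y ≡ z
        go (k , _ , refl) = trans (sym (undo y)) (trans (cong (_* inverse ^ k) e) (undo z))
          where
          undo : ∀ y → y * γ ^ k * inverse ^ k ≡ y
          undo y = trans (*-assoc y _ _) (trans (cong (y *_) (^-inverse k)) (*-identityʳ y))

      ℓ : ℕ → ℕ
      ℓ i = indicator (tr (γ ^ i) ≟ 1#)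

      periodic : ∀ i → ℓ (N ℕ.+ i) ≡ ℓ i
      periodic i = cong (λ x → indicator (tr x ≟ 1#)) (trans (^-homo-* γ N i) (trans (cong (_* γ ^ i) γ^N≡1) (*-identityˡ _)))

      idempotent : ∀ i → ℓ i ℕ.* ℓ i ≡ ℓ i
      idempotent i with tr (γ ^ i) ≟ 1#
      ... | yes _ = refl
      ... | no  _ = refl

      -- Two solutions x ≠ y of tr x = tr (g x) = 1 make g a fixed point of the Frobenius, whence tr (g x) = g and g = 1.
      unique-solution : ∀ {g x y} → tr x ≡ 1# → tr (g * x) ≡ 1# → tr y ≡ 1# → tr (g * y) ≡ 1# → g ≢ 1# → x ≡ y
      unique-solution {g} {x} {y} tx tgx ty tgy g≢1 = go (x + y ≟ 0#)
        where
        z = x + y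
        tz : tr z ≡ 0#
        tz = trans (tr-+ x y) (≡⇒+-zero (trans tx (sym ty)))
        tgz : tr (g * z) ≡ 0#
        tgz = trans (cong tr (distribˡ g x y)) (trans (tr-+ (g * x) (g * y)) (≡⇒+-zero (trans tgx (sym tgy))))
        go : Dec (z ≡ 0#) → x ≡ y
        go (yes z≡0) = +-zero⇒≡ z≡0
        go (no z≢0)  = contradiction (trans (sym (*-identityʳ g)) (trans (cong (g *_) (sym tx)) (trans (sym (tr-*ˡ x fixed)) tgx))) g≢1
          where
          fixed : g ^ q ≡ g
          fixed = cancel z≢0 (begin
            g ^ q * z      ≡⟨ cong (g ^ q *_) (+-zero⇒≡ tz) ⟨
            g ^ q * z ^ q  ≡⟨ ^-distrib-* g z q ⟨
            (g * z) ^ q    ≡⟨ +-zero⇒≡ tgz ⟩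
            g * z ∎)

      differences : ∀ {h} → 0 < h → h < N → ∑ N (λ i → ℓ i ℕ.* ℓ (i ℕ.+ h)) ≤ 1
      differences {h} 0<h h<N = ∑-atMostOne N _
        (λ i → ℕ.*-mono-≤ (indicator≤1 (tr (γ ^ i) ≟ 1#)) (indicator≤1 (tr (γ ^ (i ℕ.+ h)) ≟ 1#)))
        unique
        where
        γ^h≢1 : γ ^ h ≢ 1#
        γ^h≢1 e = ℕ.<⇒≱ h<N (ℕ.∣⇒≤ {{ℕ.>-nonZero 0<h}} (order∣ e))
        hits : ∀ i → 0 < ℓ i ℕ.* ℓ (i ℕ.+ h) → tr (γ ^ i) ≡ 1# × tr (γ ^ h * γ ^ i) ≡ 1#
        hits i pos = let a , b = positive-* (ℓ i) _ pos in
          indicator-positive _ a ,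
          trans (cong tr (trans (*-comm (γ ^ h) (γ ^ i)) (sym (^-homo-* γ i h)))) (indicator-positive _ b)
        unique : ∀ {i j} → i < N → j < N → 0 < ℓ i ℕ.* ℓ (i ℕ.+ h) → 0 < ℓ j ℕ.* ℓ (j ℕ.+ h) → i ≡ j
        unique {i} {j} i<N j<N hi hj with ℕ.<-cmp i j | unique-solution (proj₁ (hits i hi)) (proj₂ (hits i hi)) (proj₁ (hits j hj)) (proj₂ (hits j hj)) γ^h≢1
        ... | tri< i<j _ _ | e = contradiction e (^-distinct i<j j<N)
        ... | tri≈ _ i≡j _ | e = i≡j
        ... | tri> _ _ j<i | e = contradiction (sym e) (^-distinct j<i i<N)

      -- For 0 < c ≤ q the trace t of γ^c is a nonzero element γ^((q+1)s) of F_q, so some γ^((q+1)j+c) has trace 1.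
      hit : ∀ {c} → c < q → ∃ λ j → j < q₁ × 0 < ℓ (j ℕ.* suc q ℕ.+ suc c)
      hit {c} c<q = go (fixed-log prim t t≢0 t-fixed)
        where
        t = tr (γ ^ suc c)
        -- Trace 0 would put γ^(c+1) into F_q, so that q + 1 would divide c + 1 ≤ q.
        t≢0 : t ≢ 0#
        t≢0 e = ℕ.<⇒≱ (s≤s c<q) (ℕ.∣⇒≤ (ℕ.*-cancelˡ-∣ q₁ {{ℕ.>-nonZero 0<q₁}} (order∣ (^-cancel (suc c) (q₁ ℕ.* suc c)
          (trans (sym (+-zero⇒≡ e)) (trans (^-assocʳ γ (suc c) q) (cong (γ ^_) (ℕ.*-comm (suc c) q))))))))
        t-fixed : t ^ q ≡ t
        t-fixed = trans (frobenius-q (x ^ q) x) (trans (cong (_+ x ^ q) xqq) (+-comm x (x ^ q)))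
          where
          x = γ ^ suc c
          xqq : (x ^ q) ^ q ≡ x
          xqq = trans (cong (_^ q) (^-comm γ (suc c) q)) (trans (^-comm (γ ^ q) (suc c) q) (cong (_^ suc c) (^-q-q prim)))
        go : (∃ λ s → s < q₁ × t ≡ γ ^ (suc q ℕ.* s)) → ∃ λ j → j < q₁ × 0 < ℓ (j ℕ.* suc q ℕ.+ suc c)
        -- Here t = 1 already; the general choice j = q₁ - s would fall outside the range j < q₁.
        go (zero , _ , e) = 0 , 0<q₁ , ℕ.≤-reflexive (sym (indicator-true (t ≟ 1#) (trans e (cong (γ ^_) (ℕ.*-zeroʳ (suc q))))))
        go (suc s , s<q₁ , e) = j , ℕ.∸-monoʳ-< (s≤s z≤n) (ℕ.<⇒≤ s<q₁) , ℕ.≤-reflexive (sym (indicator-true (tr _ ≟ 1#) (begin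
          tr (γ ^ (j ℕ.* suc q ℕ.+ suc c))       ≡⟨ cong tr (^-homo-* γ (j ℕ.* suc q) (suc c)) ⟩
          tr (u * γ ^ suc c)                     ≡⟨ tr-*ˡ (γ ^ suc c) u-fixed ⟩
          u * t                                  ≡⟨ cong (u *_) e ⟩
          u * γ ^ (suc q ℕ.* suc s)              ≡⟨ ^-homo-* γ (j ℕ.* suc q) (suc q ℕ.* suc s) ⟨
          γ ^ (j ℕ.* suc q ℕ.+ suc q ℕ.* suc s)  ≡⟨ cong (γ ^_) total ⟩
          γ ^ N                                  ≡⟨ γ^N≡1 ⟩
          1# ∎)))
          where
          -- Chosen so that the exponents of `u` and `t` add up to N, which makes `u` the inverse of
          -- `t`.
          j = q₁ ℕ.∸ suc s
          u = γ ^ (j ℕ.* suc q)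
          total : j ℕ.* suc q ℕ.+ suc q ℕ.* suc s ≡ N
          total = trans (cong (j ℕ.* suc q ℕ.+_) (ℕ.*-comm (suc q) (suc s))) (trans (sym (ℕ.*-distribʳ-+ (suc q) j (suc s)))
            (cong (ℕ._* suc q) (ℕ.m∸n+n≡m (ℕ.<⇒≤ s<q₁))))
          u-fixed : u ^ q ≡ u
          u-fixed = trans (^-assocʳ γ (j ℕ.* suc q) q) (trans (cong (γ ^_)
            (solve 2 (λ j x → j :* (con 2 :+ x) :* (con 1 :+ x) := j :* (con 2 :+ x) :+ x :* (con 2 :+ x) :* j) refl j q₁))
            (trans (^-homo-* γ (j ℕ.* suc q) (N ℕ.* j)) (trans (cong (u *_) (^-N* j)) (*-identityʳ u))))
            where open +-*-Solver

      -- One exponent of trace 1 in each of the q nonzero classes modulo q + 1, by `hit`.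
      large : q ≤ ∑ N ℓ
      large = ℕ.≤-trans (ℕ.≤-reflexive (sym (trans (∑-const q 1) (ℕ.*-identityʳ q))))
        (ℕ.≤-trans (∑-mono q {g = classes ∘ suc} λ {c} c<q → let j , j<q₁ , h = hit c<q in
          ℕ.≤-trans h (∑-member (λ j → ℓ (j ℕ.* suc q ℕ.+ suc c)) j<q₁))
        (ℕ.≤-trans (ℕ.m≤n+m (∑ q (classes ∘ suc)) (classes 0)) (ℕ.≤-reflexive
          (trans (sym (∑-swap q₁ (suc q) (λ j c → ℓ (j ℕ.* suc q ℕ.+ c)))) (sym (∑-blocks q₁ (suc q) ℓ))))))
        where
        classes : ℕ → ℕ
        classes c = ∑ q₁ (λ j → ℓ (j ℕ.* suc q ℕ.+ c))

      -- The sieve yields γ^i of trace 1, but the matrix needs its inverse as eigenvalue. An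
      -- exponent i that shares no prime with N is coprime to N, so the full order is preserved.
      inverse-primitive : ∀ {i} → (∀ p → Prime p → p ∣ N → p ∤ i) → PrimitiveElement (inverse ^ i)
      inverse-primitive {i} coprime = record
        { orderMultiple = record
          { inverse = γ ^ i
          ; inverseʳ = trans (*-comm _ _) (^-inverse i)
          ; nontrivial = nontrivial
          ; order∣ = λ {k} e → coprime-divisor (gcd≡1⇒coprime gcd≡1)
              (order∣ (trans (sym (*-identityʳ _)) (trans (cong (γ ^ (i ℕ.* k) *_) (trans (sym e) (^-assocʳ inverse i k))) (^-inverse (i ℕ.* k))))) }
        ; γ^N≡1 = trans (^-assocʳ inverse i N) (trans (cong (inverse ^_) (ℕ.*-comm i N))
            (trans (sym (trans (cong (_* inverse ^ (N ℕ.* i)) (^-N* i)) (*-identityˡ _))) (^-inverse (N ℕ.* i)))) }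
        where
        gcd≡1 : gcd N i ≡ 1
        gcd≡1 with gcd N i ℕ.≟ 1
        ... | yes e = e
        ... | no ne = let p , pp , p∣g = prime-factor {{g≢0}} ne in
          contradiction (ℕ.∣-trans p∣g (gcd[m,n]∣n N i)) (coprime p pp (ℕ.∣-trans p∣g (gcd[m,n]∣m N i)))
          where
          g≢0 : NonZero (gcd N i)
          g≢0 = ℕ.≢-nonZero λ e → ℕ.≢-nonZero⁻¹ N (ℕ.0∣⇒≡0 (subst (_∣ N) e (gcd[m,n]∣m N i)))

      inverse-trace : ∀ {i} → tr (γ ^ i) ≡ 1# → (inverse ^ i) ^ q * (1# + inverse ^ i) ≡ inverse ^ i
      inverse-trace {i} tβ = begin
        α ^ q * (1# + α)                     ≡⟨ solve 2 (λ a b → a :* (con 1 :+ b) := a :+ a :* b) refl (α ^ q) α ⟩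
        α ^ q + α ^ q * α                    ≡⟨ cong (α ^ q +_) (trans (sym (*-identityʳ _)) (cong (α ^ q * α *_) (sym tβ))) ⟩
        α ^ q + α ^ q * α * (β ^ q + β)      ≡⟨ solve 4 (λ A a B b → A :+ A :* a :* (B :+ b) := A :* (con 1 :+ b :* a) :+ (B :* A) :* a) refl (α ^ q) α (β ^ q) β ⟩
        α ^ q * (1# + β * α) + (β ^ q * α ^ q) * α
          ≡⟨ cong₂ (λ s t → α ^ q * (1# + s) + t * α) βα (trans (sym (^-distrib-* β α q)) (trans (cong (_^ q) βα) (1^ q))) ⟩
        α ^ q * (1# + 1#) + 1# * α           ≡⟨ cong₂ _+_ (trans (cong (α ^ q *_) (+-self 1#)) (zeroʳ _)) (*-identityˡ α) ⟩
        0# + α                               ≡⟨ +-identityˡ α ⟩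
        α ∎
        where
        open Solver
        α = inverse ^ i
        β = γ ^ i
        βα : β * α ≡ 1#
        βα = ^-inverse i

      primitive-trace-one : ∀ B → q ≤ B ℕ.* B → ∀ ps → All Prime ps → AllPairs _≢_ ps → product ps ∣ N →
        (∀ p → Prime p → p ∣ N → p ∈ ps) → 2 ℕ.^ length ps ℕ.* (product ps ℕ.* B) < q ℕ.* totient ps →
        ∃ λ α → PrimitiveElement α × α ^ q * (1# + α) ≡ α
      primitive-trace-one B q≤B² ps primes distinct dv complete main = go (D.sieve 0<q₁ B q≤B² ps primes distinct dv main)
        where
        module D = DifferenceSet q₁ ℓ periodic idempotent large differences
        go : (∃ λ i → 0 < ℓ i × All (_∤ i) ps) → ∃ λ α → PrimitiveElement α × α ^ q * (1# + α) ≡ α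
        go (i , h , avoid) = inverse ^ i ,
          inverse-primitive (λ p pp p∣N → All.lookup avoid (complete p pp p∣N)) ,
          inverse-trace {i} (indicator-positive _ h)

  -- The sieve takes each prime once, so repetitions in the factorisation are dropped; what remains
  -- multiplies to a divisor of `N`.
  distinct-primes : ∀ N → .{{NonZero N}} → ∃ λ ps → All Prime ps × AllPairs _≢_ ps × product ps ∣ N × (∀ p → Prime p → p ∣ N → p ∈ ps)
  distinct-primes N = go (factors F) (PrimeFactorisation.factorsPrime F) N∣ complete-all
    where
    open import Data.Nat.Primality.Factorisation
    open import Data.List.Membership.DecPropositional ℕ._≟_ using (_∈?_)
    open import Data.List.Relation.Unary.Any using (here; there)
    F = factorise N
    N∣ : product (factors F) ∣ N
    N∣ = ℕ.∣-reflexive (sym (PrimeFactorisation.isFactorisation F))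
    complete-all : ∀ p → Prime p → p ∣ N → p ∈ factors F
    complete-all p pp p∣N = factorisationHasAllPrimeFactors pp (subst (p ∣_) (PrimeFactorisation.isFactorisation F) p∣N) (PrimeFactorisation.factorsPrime F)
    dedupe : ∀ ps → All Prime ps → ∃ λ qs → All Prime qs × AllPairs _≢_ qs × product qs ∣ product ps × (∀ p → p ∈ ps → p ∈ qs)
    dedupe [] [] = [] , [] , [] , ℕ.∣-refl , λ _ ()
    dedupe (p ∷ ps) (pp ∷ primes) with dedupe ps primes
    ... | qs , qp , qd , dv , sub with p ∈? qs
    ... | yes p∈ = qs , qp , qd , ℕ.∣n⇒∣m*n p dv , λ { r (here refl) → p∈ ; r (there h) → sub r h }
    ... | no p∉  = p ∷ qs , pp ∷ qp , All.tabulate (λ { r∈ refl → p∉ r∈ }) ∷ qd , ℕ.*-monoʳ-∣ p dv ,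
      λ { r (here refl) → here refl ; r (there h) → there (sub r h) }
    go : ∀ ps → All Prime ps → product ps ∣ N → (∀ p → Prime p → p ∣ N → p ∈ ps) → _
    go ps primes dv complete with dedupe ps primes
    ... | qs , qp , qd , dv′ , sub = qs , qp , qd , ℕ.∣-trans dv′ dv , λ p pp d → sub p (complete p pp d)

-- The numerical condition of the sieve.

module SieveInequality where

  open DifferenceSets using (totient)
  open import Data.List.Base using (List; []; _∷_; _++_; length; map; filter)
  open import Data.List.Membership.Propositional using (_∈_)
  open import Data.List.Membership.Propositional.Properties using (∈-∃++; ∈-filter⁺)
  import Data.List.Membership.DecPropositional
  open import Data.List.Relation.Binary.Permutation.Propositional using (_↭_)
  open import Data.List.Relation.Binary.Permutation.Propositional.Properties using (map⁺; shift; ∈-resp-↭)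
  open import Data.List.Relation.Unary.All as All using (All; []; _∷_)
  open import Data.List.Relation.Unary.AllPairs as AllPairs using (AllPairs; []; _∷_)
  open import Data.List.Relation.Unary.Any using (here; there)
  open import Data.Nat.Base
  open import Data.Nat.Divisibility using (_∣_; _∣?_; ∣⇒≤; ∣1⇒≡1; ∣m+n∣m⇒∣n; m∣m*n)
  open import Data.Nat.DivMod using (_/_; _%_)
  open import Data.Nat.ListAction using (product)
  open import Data.Nat.ListAction.Properties using (product-↭)
  open import Data.Nat.Primality using (Prime; prime?)
  open import Data.Nat.Properties
  open import Data.Nat.Solver using (module +-*-Solver)
  open import Relation.Nullary.Decidable using (from-yes)
  open import Data.List.Relation.Binary.Permutation.Propositional using (↭⇒↭ₛ; ↭-sym)
  open import Data.List.Relation.Binary.Permutation.Setoid.Properties (setoid ℕ) using (Unique-resp-↭)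
  open Data.List.Membership.DecPropositional _≟_ using (_∈?_)

  ^-distribʳ-* : ∀ k m n → (m * n) ^ k ≡ m ^ k * n ^ k
  ^-distribʳ-* zero    m n = refl
  ^-distribʳ-* (suc k) m n = trans (cong (m * n *_) (^-distribʳ-* k m n))
    (solve 4 (λ m n a b → m :* n :* (a :* b) := m :* a :* (n :* b)) refl m n (m ^ k) (n ^ k))
    where open +-*-Solver

  -- A sieving prime p costs a factor 2p/(p-1); its sixth power is num p / (den p / p), and it is at most p once p ≥ 71.
  num den : ℕ → ℕ
  num p = (2 * p) ^ 6
  den p = p * pred p ^ 6

  Num Den : List ℕ → ℕ
  Num ps = product (map num ps)
  Den ps = product (map den ps)

  Num≡ : ∀ ps → Num ps ≡ (2 ^ length ps * product ps) ^ 6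
  Num≡ []       = refl
  Num≡ (p ∷ ps) = begin
    (2 * p) ^ 6 * Num ps                                       ≡⟨ cong ((2 * p) ^ 6 *_) (Num≡ ps) ⟩
    (2 * p) ^ 6 * (2 ^ length ps * product ps) ^ 6             ≡⟨ ^-distribʳ-* 6 (2 * p) (2 ^ length ps * product ps) ⟨
    (2 * p * (2 ^ length ps * product ps)) ^ 6                 ≡⟨ cong (_^ 6) (solve 3 (λ p k P → con 2 :* p :* (k :* P) := con 2 :* k :* (p :* P)) refl p (2 ^ length ps) (product ps)) ⟩
    (2 ^ length (p ∷ ps) * product (p ∷ ps)) ^ 6 ∎
    where
    open ≡-Reasoning
    open +-*-Solver

  Den≡ : ∀ ps → Den ps ≡ product ps * totient ps ^ 6
  Den≡ []       = refl
  Den≡ (p ∷ ps) = begin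
    p * pred p ^ 6 * Den ps                                    ≡⟨ cong (p * pred p ^ 6 *_) (Den≡ ps) ⟩
    p * pred p ^ 6 * (product ps * totient ps ^ 6)             ≡⟨ solve 4 (λ a b c d → a :* b :* (c :* d) := a :* c :* (b :* d)) refl p (pred p ^ 6) (product ps) (totient ps ^ 6) ⟩
    p * product ps * (pred p ^ 6 * totient ps ^ 6)             ≡⟨ cong (p * product ps *_) (^-distribʳ-* 6 (pred p) (totient ps)) ⟨
    p * product ps * (pred p * totient ps) ^ 6 ∎
    where
    open ≡-Reasoning
    open +-*-Solver

  -- By the ratio hypothesis p ≤ (b/a) p₁, so 64 p^5 ≤ 64 (b/a)^5 p₁^5 ≤ a p₁^5 ≤ p₁^6. The values a
  -- = 70 and b = 71 are those at the threshold p = 71.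
  num≤den-criterion : ∀ a b p₁ → .{{NonZero b}} → 64 * b ^ 5 ≤ a ^ 6 → a ≤ p₁ → a * suc p₁ ≤ b * p₁ → num (suc p₁) ≤ den (suc p₁)
  num≤den-criterion a b p₁ const a≤p₁ ratio = begin
    (2 * p) ^ 6               ≡⟨ ^-distribʳ-* 6 2 p ⟩
    2 ^ 6 * (p * p ^ 5)       ≡⟨ solve 2 (λ p x → con 64 :* (p :* x) := p :* (con 64 :* x)) refl p (p ^ 5) ⟩
    p * (64 * p ^ 5)          ≤⟨ *-monoʳ-≤ p (*-cancelˡ-≤ (b ^ 5) {{m^n≢0 b 5}} scaled) ⟩
    p * p₁ ^ 6 ∎
    where
    open ≤-Reasoning
    open +-*-Solver
    p = suc p₁
    scaled : b ^ 5 * (64 * p ^ 5) ≤ b ^ 5 * p₁ ^ 6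
    scaled = begin
      b ^ 5 * (64 * p ^ 5)    ≡⟨ solve 2 (λ x y → x :* (con 64 :* y) := con 64 :* x :* y) refl (b ^ 5) (p ^ 5) ⟩
      64 * b ^ 5 * p ^ 5      ≤⟨ *-monoˡ-≤ (p ^ 5) const ⟩
      a * a ^ 5 * p ^ 5       ≡⟨ trans (*-assoc a (a ^ 5) (p ^ 5)) (cong (a *_) (sym (^-distribʳ-* 5 a p))) ⟩
      a * (a * p) ^ 5         ≤⟨ *-mono-≤ a≤p₁ (^-monoˡ-≤ 5 ratio) ⟩
      p₁ * (b * p₁) ^ 5       ≡⟨ cong (p₁ *_) (^-distribʳ-* 5 b p₁) ⟩
      p₁ * (b ^ 5 * p₁ ^ 5)   ≡⟨ solve 3 (λ p x y → p :* (x :* y) := x :* (p :* y)) refl p₁ (b ^ 5) (p₁ ^ 5) ⟩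
      b ^ 5 * (p₁ * p₁ ^ 5) ∎

  num≤den : ∀ {p} → 71 ≤ p → num p ≤ den p
  num≤den {suc p₁} (s≤s 70≤p₁) = num≤den-criterion 70 71 p₁ (from-yes (64 * 71 ^ 5 ≤? 70 ^ 6)) 70≤p₁
    (subst (_≤ 71 * p₁) (sym (*-suc 70 p₁)) (+-monoˡ-≤ (70 * p₁) 70≤p₁))

  -- The quotient Num/Den is multiplicative. A prime of `S` absent from `ps` has a factor of at
  -- least 1, and a prime of `ps` outside `S` is at least 71 and has a factor of at most 1.
  weight-bound : ∀ S ps → All (λ s → den s ≤ num s) S → AllPairs _≢_ ps → (∀ {p} → p ∈ ps → p ∈ S ⊎ 71 ≤ p) →
    Num ps * Den S ≤ Num S * Den ps
  weight-bound [] ps _ _ cover = ≤-trans (≤-reflexive (*-identityʳ (Num ps)))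
    (≤-trans (go ps λ h → case (cover h)) (≤-reflexive (sym (+-identityʳ (Den ps)))))
    where
    case : ∀ {p} → p ∈ [] ⊎ 71 ≤ p → 71 ≤ p
    case (inj₂ h) = h
    go : ∀ ps → (∀ {p} → p ∈ ps → 71 ≤ p) → Num ps ≤ Den ps
    go []       h = ≤-refl
    go (p ∷ ps) h = *-mono-≤ (num≤den (h (here refl))) (go ps (h ∘ there))
  weight-bound (s ∷ S) ps (s≤ ∷ S≤) distinct cover with s ∈? ps
  ... | no s∉ps = begin
    Num ps * (den s * Den S)    ≡⟨ solve 3 (λ a b c → a :* (b :* c) := b :* (a :* c)) refl (Num ps) (den s) (Den S) ⟩
    den s * (Num ps * Den S)    ≤⟨ *-mono-≤ s≤ (weight-bound S ps S≤ distinct cover′) ⟩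
    num s * (Num S * Den ps)    ≡⟨ *-assoc (num s) (Num S) (Den ps) ⟨
    num s * Num S * Den ps ∎
    where
    open ≤-Reasoning
    open +-*-Solver
    cover′ : ∀ {p} → p ∈ ps → p ∈ S ⊎ 71 ≤ p
    cover′ p∈ with cover p∈
    ... | inj₁ (here refl) = contradiction p∈ s∉ps
    ... | inj₁ (there h)   = inj₁ h
    ... | inj₂ h           = inj₂ h
  ... | yes s∈ps with ∈-∃++ s∈ps
  ... | ys , zs , refl = begin
    Num ps * (den s * Den S)           ≡⟨ cong (_* (den s * Den S)) (product-↭ (map⁺ num perm)) ⟩
    num s * Num qs * (den s * Den S)   ≡⟨ solve 4 (λ a b c d → a :* b :* (c :* d) := a :* c :* (b :* d)) refl (num s) (Num qs) (den s) (Den S) ⟩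
    num s * den s * (Num qs * Den S)   ≤⟨ *-monoʳ-≤ (num s * den s) (weight-bound S qs S≤ (AllPairs.tail distinct′) cover′) ⟩
    num s * den s * (Num S * Den qs)   ≡⟨ solve 4 (λ a b c d → a :* b :* (c :* d) := a :* c :* (b :* d)) refl (num s) (den s) (Num S) (Den qs) ⟩
    num s * Num S * (den s * Den qs)   ≡⟨ cong (num s * Num S *_) (product-↭ (map⁺ den perm)) ⟨
    num s * Num S * Den ps ∎
    where
    open ≤-Reasoning
    open +-*-Solver
    qs = ys ++ zs
    perm : ys ++ s ∷ zs ↭ s ∷ qs
    perm = shift s ys zs
    distinct′ : AllPairs _≢_ (s ∷ qs)
    distinct′ = Unique-resp-↭ (↭⇒↭ₛ perm) distinct
    cover′ : ∀ {p} → p ∈ qs → p ∈ S ⊎ 71 ≤ p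
    cover′ p∈ with cover (∈-resp-↭ (↭-sym perm) (there p∈))
    ... | inj₁ (here refl) = contradiction refl (All.lookup (AllPairs.head distinct′) p∈)
    ... | inj₁ (there h)   = inj₁ h
    ... | inj₂ h           = inj₂ h

  -- `main` is the sixth power of the sieve inequality, after each prime outside `S` is charged
  -- p^(1/6) and the product of the sieving primes is bounded by `N`. It mentions only `q`, `N`, `B`
  -- and `S`, so it can be checked without factoring `N`.
  record Sufficient (q N : ℕ) (S : List ℕ) : Set where
    field
      B       : ℕ
      q≤B²    : q ≤ B * B
      den≤num : All (λ s → den s ≤ num s) S
      main    : B ^ 6 * (Num S * N) < q ^ 6 * Den S

  sieve-condition : ∀ {q N S} → .{{NonZero N}} → (suff : Sufficient q N S) → let open Sufficient suff in
    ∀ ps → AllPairs _≢_ ps → product ps ∣ N → 0 < totient ps → (∀ {p} → p ∈ ps → p ∈ S ⊎ 71 ≤ p) →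
    2 ^ length ps * (product ps * B) < q * totient ps
  sieve-condition {q} {N} {S} suff ps distinct dv 0<φ cover = ≰⇒> λ le → <⇒≱ sixth (^-monoˡ-≤ 6 le)
    where
    open ≤-Reasoning
    open +-*-Solver
    open Sufficient suff
    P = product ps
    φ = totient ps
    k = 2 ^ length ps
    instance _ = >-nonZero 0<φ
    lhs : (k * (P * B)) ^ 6 ≡ B ^ 6 * Num ps
    lhs = trans (cong (_^ 6) (solve 3 (λ k P B → k :* (P :* B) := B :* (k :* P)) refl k P B))
      (trans (^-distribʳ-* 6 B (k * P)) (cong (B ^ 6 *_) (sym (Num≡ ps))))
    sixth : (k * (P * B)) ^ 6 < (q * φ) ^ 6
    sixth = *-cancelʳ-< (Den S) _ _ (begin-strict
      (k * (P * B)) ^ 6 * Den S              ≡⟨ trans (cong (_* Den S) lhs) (*-assoc (B ^ 6) (Num ps) (Den S)) ⟩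
      B ^ 6 * (Num ps * Den S)               ≤⟨ *-monoʳ-≤ (B ^ 6) (weight-bound S ps den≤num distinct cover) ⟩
      B ^ 6 * (Num S * Den ps)               ≡⟨ cong (λ x → B ^ 6 * (Num S * x)) (Den≡ ps) ⟩
      B ^ 6 * (Num S * (P * φ ^ 6))          ≤⟨ *-monoʳ-≤ (B ^ 6) (*-monoʳ-≤ (Num S) (*-monoˡ-≤ (φ ^ 6) (∣⇒≤ dv))) ⟩
      B ^ 6 * (Num S * (N * φ ^ 6))          ≡⟨ solve 4 (λ b s n f → b :* (s :* (n :* f)) := b :* (s :* n) :* f) refl (B ^ 6) (Num S) N (φ ^ 6) ⟩
      B ^ 6 * (Num S * N) * φ ^ 6            <⟨ *-monoˡ-< (φ ^ 6) {{m^n≢0 φ 6}} main ⟩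
      q ^ 6 * Den S * φ ^ 6                  ≡⟨ trans (solve 3 (λ a b c → a :* b :* c := a :* c :* b) refl (q ^ 6) (Den S) (φ ^ 6))
                                                  (cong (_* Den S) (sym (^-distribʳ-* 6 q φ))) ⟩
      (q * φ) ^ 6 * Den S ∎)

  -- The odd primes below the threshold 71 of `num≤den`; the prime 2 never divides 4^m - 1.
  oddPrimes : List ℕ
  oddPrimes = 3 ∷ 5 ∷ 7 ∷ 11 ∷ 13 ∷ 17 ∷ 19 ∷ 23 ∷ 29 ∷ 31 ∷ 37 ∷ 41 ∷ 43 ∷ 47 ∷ 53 ∷ 59 ∷ 61 ∷ 67 ∷ []

  abstract
    small-primes : ∀ {p} → p < 71 → Prime p → p ≡ 2 ⊎ p ∈ oddPrimes
    small-primes = from-yes (allUpTo? (λ p → prime? p →-dec (p ≟ 2 ⊎-dec p ∈? oddPrimes)) 71)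

    oddPrimes-den≤num : All (λ s → den s ≤ num s) oddPrimes
    oddPrimes-den≤num = from-yes (All.all? (λ s → den s ≤? num s) oddPrimes)

  2∤4^m-1 : ∀ m {N} → 2 ^ (2 * suc m) ≡ suc N → ¬ 2 ∣ N
  2∤4^m-1 m {N} e 2∣N = contradiction (∣1⇒≡1 (∣m+n∣m⇒∣n (subst (2 ∣_) (trans e (+-comm 1 N)) (m∣m*n {2} (2 ^ (m + suc (m + 0))))) 2∣N)) λ ()

  cover-divisors : ∀ m {N} → 2 ^ (2 * suc m) ≡ suc N → ∀ {p} → Prime p → p ∣ N → p ∈ filter (_∣? N) oddPrimes ⊎ 71 ≤ p
  cover-divisors m {N} e {p} pp p∣N with <-≤-connex p 71
  ... | inj₂ le = inj₂ le
  ... | inj₁ lt with small-primes lt pp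
  ... | inj₁ refl = contradiction p∣N (2∤4^m-1 m e)
  ... | inj₂ p∈   = inj₁ (∈-filter⁺ (_∣? N) p∈ p∣N)

  cover-all : ∀ m {N} → 2 ^ (2 * suc m) ≡ suc N → ∀ {p} → Prime p → p ∣ N → p ∈ oddPrimes ⊎ 71 ≤ p
  cover-all m {N} e {p} pp p∣N with <-≤-connex p 71
  ... | inj₂ le = inj₂ le
  ... | inj₁ lt with small-primes lt pp
  ... | inj₁ refl = contradiction p∣N (2∤4^m-1 m e)
  ... | inj₂ p∈   = inj₁ p∈

  -- An upper bound for the square root of 2^m, as √2 < 1415/1000.
  √2^ : ℕ → ℕ
  √2^ m = if-even (m % 2)
    where
    if-even : ℕ → ℕ
    if-even zero    = 2 ^ (m / 2)
    if-even (suc _) = suc (2 ^ (m / 2) * 1415 / 1000)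

  groupOrder : ℕ → ℕ
  groupOrder m = pred (2 ^ (2 * m))

  smallDivisors : ℕ → List ℕ
  smallDivisors m = filter (_∣? groupOrder m) oddPrimes

  -- Sharper than the uniform estimate in two ways: only those primes below 71 that divide 4^m - 1
  -- are charged, and `√2^ m` is close to √q for odd m as well.
  Tabulated : ℕ → Set
  Tabulated m = 2 ^ m ≤ √2^ m * √2^ m × All (λ s → den s ≤ num s) (smallDivisors m) ×
    √2^ m ^ 6 * (Num (smallDivisors m) * groupOrder m) < (2 ^ m) ^ 6 * Den (smallDivisors m)

  tabulated? : ∀ m → Dec (Tabulated m)
  tabulated? m = (2 ^ m ≤? √2^ m * √2^ m) ×-dec All.all? (λ s → den s ≤? num s) (smallDivisors m) ×-dec
    (√2^ m ^ 6 * (Num (smallDivisors m) * groupOrder m) <? (2 ^ m) ^ 6 * Den (smallDivisors m))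

  tabulated⇒sufficient : ∀ m → Tabulated m → Sufficient (2 ^ m) (groupOrder m) (smallDivisors m)
  tabulated⇒sufficient m (a , b , c) = record { B = √2^ m ; q≤B² = a ; den≤num = b ; main = c }

  -- With B = 2^⌈m/2⌉ one has B² ≤ 2q, hence B⁶ ≤ 8q³, which is the source of the 8. Together with N
  -- < q² this uses up q⁵, and the sixth factor q ≥ 2^t has to outweigh 8 Num/Den.
  asymptotic : ∀ S t k {N} → All (λ s → den s ≤ num s) S → 0 < Num S → 8 * Num S ≤ 2 ^ t * Den S →
    2 ^ (2 * (t + k)) ≡ suc N → Sufficient (2 ^ (t + k)) N S
  asymptotic S t k {N} den≤num 0<Num check size = record { B = B ; q≤B² = q≤B² ; den≤num = den≤num ; main = main }
    where
    open ≤-Reasoning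
    open +-*-Solver
    m = t + k
    q = 2 ^ m
    h = ⌈ m /2⌉
    B = 2 ^ h
    BB : B * B ≡ 2 ^ (h + h)
    BB = sym (^-distribˡ-+-* 2 h h)
    q≤B² : q ≤ B * B
    q≤B² = subst (q ≤_) (sym BB) (^-monoʳ-≤ 2 (≤-trans (≤-reflexive (sym (⌊n/2⌋+⌈n/2⌉≡n m))) (+-monoˡ-≤ h (⌊n/2⌋≤⌈n/2⌉ m))))
    h+h≤ : h + h ≤ suc m
    h+h≤ = ≤-trans (+-monoˡ-≤ h (⌈n/2⌉≤1+⌊n/2⌋ m)) (s≤s (≤-reflexive (⌊n/2⌋+⌈n/2⌉≡n m)))
      where
      ⌈n/2⌉≤1+⌊n/2⌋ : ∀ n → ⌈ n /2⌉ ≤ suc ⌊ n /2⌋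
      ⌈n/2⌉≤1+⌊n/2⌋ n = ⌊n/2⌋-mono {suc n} {suc (suc n)} (n≤1+n (suc n))
    BB≤2q : B * B ≤ 2 * q
    BB≤2q = ≤-trans (≤-reflexive BB) (^-monoʳ-≤ 2 h+h≤)
    B⁶≤ : B ^ 6 ≤ 8 * q ^ 3
    B⁶≤ = begin
      B ^ 6          ≡⟨ solve 1 (λ b → b :* (b :* (b :* (b :* (b :* (b :* con 1))))) := (b :* b) :* ((b :* b) :* ((b :* b) :* con 1))) refl B ⟩
      (B * B) ^ 3    ≤⟨ ^-monoˡ-≤ 3 BB≤2q ⟩
      (2 * q) ^ 3    ≡⟨ ^-distribʳ-* 3 2 q ⟩
      8 * q ^ 3 ∎
    N<q² : N < q * q
    N<q² = ≤-reflexive (trans (sym size) (trans (cong (λ x → 2 ^ (m + x)) (+-identityʳ m)) (^-distribˡ-+-* 2 m m)))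
    8Num≤qDen : 8 * Num S ≤ q * Den S
    8Num≤qDen = ≤-trans check (*-monoˡ-≤ (Den S) (^-monoʳ-≤ 2 (m≤m+n t k)))
    instance
      B⁶≢0 : NonZero (B ^ 6)
      B⁶≢0 = m^n≢0 B 6 {{m^n≢0 2 h}}
    main : B ^ 6 * (Num S * N) < q ^ 6 * Den S
    main = begin-strict
      B ^ 6 * (Num S * N)                 <⟨ *-monoʳ-< (B ^ 6) (*-monoʳ-< (Num S) {{>-nonZero 0<Num}} N<q²) ⟩
      B ^ 6 * (Num S * (q * q))           ≤⟨ *-monoˡ-≤ (Num S * (q * q)) B⁶≤ ⟩
      8 * q ^ 3 * (Num S * (q * q))       ≡⟨ solve 2 (λ q s → con 8 :* (q :* (q :* (q :* con 1))) :* (s :* (q :* q)) := con 8 :* s :* (q :* (q :* (q :* (q :* (q :* con 1)))))) refl q (Num S) ⟩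
      8 * Num S * q ^ 5                   ≤⟨ *-monoˡ-≤ (q ^ 5) 8Num≤qDen ⟩
      q * Den S * q ^ 5                   ≡⟨ solve 3 (λ q d x → q :* d :* x := q :* x :* d) refl q (Den S) (q ^ 5) ⟩
      q ^ 6 * Den S ∎

  abstract
    -- The quotient 8 Num/Den is only slightly below 2^41; this decides where the table may end.
    asymptotic-constant : 0 < Num oddPrimes × 8 * Num oddPrimes ≤ 2 ^ 41 * Den oddPrimes
    asymptotic-constant = from-yes ((0 <? Num oddPrimes) ×-dec (8 * Num oddPrimes ≤? 2 ^ 41 * Den oddPrimes))

-- Assembly: a table for m ≤ 40 and the uniform estimate beyond.

open import Defs
open import Data.Nat using (ℕ; _≤_; _+_; _*_)
open import Data.Product using (∃; ∃-syntax)
open Divisibility using (1<2^)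
open CharacteristicTwo
open PrimitiveRoots using (encode; encode-injective)
open TSRMatrices
open Certificates
open PrimitiveExtensions
open DifferenceSets using (totient)
open TraceOneElements
open SieveInequality
open import Data.List.Base using ([]; _∷_; applyUpTo; length)
open import Data.Nat.ListAction using (product)
open import Data.Nat.ListAction.Properties using (∈⇒∣product)
open import Data.List.Membership.Propositional using (_∈_)
open import Data.List.Membership.Propositional.Properties using (∈-applyUpTo⁺)
open import Data.List.Relation.Unary.All as All using (All; []; _∷_)
open import Data.Nat.Base
open import Data.Nat.Divisibility using (_∣_; ∣-trans)
open import Data.Nat.Primality using (Prime; prime⇒nonTrivial)
open import Data.Nat.Properties
open import Data.Nat.DivMod using (_/_; _%_)
open import Data.Bool.Base using (Bool)
open import Data.Vec.Base using (Vec; []; _∷_)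
open import Relation.Nullary.Decidable using (True; toWitness)

coefficients : ∀ n → ℕ → Vec Bool n
coefficients zero    k = []
coefficients (suc n) k = (k % 2 ≡ᵇ 1) ∷ coefficients n (k / 2)

certified? : ∀ m k ps → Dec (Certificate.Certified {m} (coefficients (2 * m) k) ps)
certified? m k ps = Certificate.certified? {m} (coefficients (2 * m) k) ps

HasPrimitiveTSR : ℕ → Set
HasPrimitiveTSR m = ∃ λ c₀ → ∃ λ c₁ → ∃ λ A → Primitive (charPoly (tsr m c₀ c₁ A)) (2 * m)

totient-positive : ∀ {ps} → All Prime ps → 0 < totient ps
totient-positive []            = s≤s z≤n
totient-positive (pp ∷ primes) = *-mono-≤ (pred-mono-≤ (nonTrivial⇒n>1 _ {{prime⇒nonTrivial pp}})) (totient-positive primes)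

sufficient⇒TSR : ∀ m {q₁ N S} → 2 ^ suc m ≡ suc q₁ → 2 ^ (2 * suc m) ≡ suc N → Sufficient (2 ^ suc m) N S →
  (∀ {p} → Prime p → p ∣ N → p ∈ S ⊎ 71 ≤ p) → HasPrimitiveTSR (suc m)
sufficient⇒TSR m {q₁} {N} {S} 2^m size suff cover = go (distinct-primes N)
  where
  0<q₁ : 0 < q₁
  0<q₁ = s≤s⁻¹ (subst (1 <_) 2^m (1<2^ m))
  N≡ : N ≡ q₁ * suc (suc q₁)
  N≡ = suc-injective (trans (sym size) (2^2*m (suc m) 2^m))
  instance
    N≢0 : NonZero N
    N≢0 = >-nonZero (subst (0 <_) (sym N≡) (*-mono-≤ 0<q₁ (s≤s z≤n)))
  -- `2 * suc m` computes to the successor of this argument, so the extension has degree 2(m + 1).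
  open PrimitiveExtension (primitiveExtension (m + suc (m + 0)) (2^2*m (suc m) 2^m))
  open TraceOne (quotientRing modulus) {suc m} 2^m 0<q₁ encode encode-injective
  open Sufficient suff
  go : (∃ λ ps → _) → HasPrimitiveTSR (suc m)
  go (ps , primes , distinct , dv , complete) = finish (primitive-trace-one
    (record { orderMultiple = orderMultiple ; γ^N≡1 = γ^N≡1 })
    B (subst (_≤ B * B) 2^m q≤B²) ps primes distinct (subst (_ ∣_) N≡ dv)
    (λ p pp p∣N → complete p pp (subst (p ∣_) (sym N≡) p∣N))
    (subst (λ q → 2 ^ length ps * (product ps * B) < q * totient ps) 2^m
      (sieve-condition suff ps distinct dv (totient-positive primes) λ p∈ → cover (All.lookup primes p∈) (∣-trans (∈⇒∣product p∈) dv))))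
    where
    finish : (∃ λ α → _) → HasPrimitiveTSR (suc m)
    finish (α , prim , trace) = primitiveTSR (quotientRing modulus) {suc m} 2^m 0<q₁ encode encode-injective prim trace

2^≡suc : ∀ k → 2 ^ k ≡ suc (pred (2 ^ k))
2^≡suc k = sym (suc-pred (2 ^ k) {{m^n≢0 2 k}})

-- The binary digits of k list the lower coefficients of a primitive polynomial, ps the prime factors of 4^m - 1.
data Covered (m : ℕ) : Set where
  certificate : ∀ k ps {_ : True (certified? m k ps)} → Covered m
  tabulated   : {_ : True (tabulated? m)} → Covered m

covered⇒TSR : ∀ m → Covered (suc m) → HasPrimitiveTSR (suc m)
covered⇒TSR m (certificate k ps {C}) = Certificate.certified⇒TSR {suc m} (coefficients (2 * suc m) k) ps (toWitness {a? = certified? (suc m) k ps} C)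
  (2^≡suc (suc m)) (pred-mono-≤ (1<2^ m))
covered⇒TSR m (tabulated {T}) =
  sufficient⇒TSR m (2^≡suc (suc m)) size (tabulated⇒sufficient (suc m) (toWitness {a? = tabulated? (suc m)} T)) (cover-divisors m size)
  where size = 2^≡suc (2 * suc m)

-- Beyond m = 10 certificates appear at 12, 14, 15, 18 and 20, where 4^m - 1 has several small prime
-- divisors.
table : All Covered (1 ∷ 2 ∷ 3 ∷ 4 ∷ 5 ∷ 6 ∷ 7 ∷ 8 ∷ 9 ∷ 10 ∷ 11 ∷ 12 ∷ 13 ∷ 14 ∷ 15 ∷ 16 ∷ 17 ∷ 18 ∷ 19 ∷ 20 ∷ 21 ∷ 22 ∷ 23 ∷ 24 ∷ 25 ∷ 26 ∷ 27 ∷ 28 ∷ 29 ∷ 30 ∷ 31 ∷ 32 ∷ 33 ∷ 34 ∷ 35 ∷ 36 ∷ 37 ∷ 38 ∷ 39 ∷ 40 ∷ [])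
table =
    -- The number 3 encodes X² + X + 1: bit i is the coefficient of Xⁱ and the leading term is
    -- implicit. In the later rows primes are repeated with their multiplicity, as the product has
    -- to be 4^m - 1.
    certificate 3 (3 ∷ [])
  ∷ certificate 9 (3 ∷ 5 ∷ [])
  ∷ certificate 27 (3 ∷ 3 ∷ 7 ∷ [])
  ∷ certificate 45 (3 ∷ 5 ∷ 17 ∷ [])
  ∷ certificate 455 (3 ∷ 11 ∷ 31 ∷ [])
  ∷ certificate 153 (3 ∷ 3 ∷ 5 ∷ 7 ∷ 13 ∷ [])
  ∷ certificate 1755 (3 ∷ 43 ∷ 127 ∷ [])
  ∷ certificate 12861 (3 ∷ 5 ∷ 17 ∷ 257 ∷ [])
  ∷ certificate 8519 (3 ∷ 3 ∷ 3 ∷ 7 ∷ 19 ∷ 73 ∷ [])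
  ∷ certificate 25545 (3 ∷ 5 ∷ 5 ∷ 11 ∷ 31 ∷ 41 ∷ [])
  ∷ tabulated
  ∷ certificate 293933 (3 ∷ 3 ∷ 5 ∷ 7 ∷ 13 ∷ 17 ∷ 241 ∷ [])
  ∷ tabulated
  ∷ certificate 1412249 (3 ∷ 5 ∷ 29 ∷ 43 ∷ 113 ∷ 127 ∷ [])
  ∷ certificate 109227 (3 ∷ 3 ∷ 7 ∷ 11 ∷ 31 ∷ 151 ∷ 331 ∷ [])
  ∷ tabulated
  ∷ tabulated
  ∷ certificate 14011417 (3 ∷ 3 ∷ 3 ∷ 5 ∷ 7 ∷ 13 ∷ 19 ∷ 37 ∷ 73 ∷ 109 ∷ [])
  ∷ tabulated
  ∷ certificate 74993965 (3 ∷ 5 ∷ 5 ∷ 11 ∷ 17 ∷ 31 ∷ 41 ∷ 61681 ∷ [])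
  ∷ tabulated
  ∷ tabulated
  ∷ tabulated
  ∷ tabulated
  ∷ tabulated
  ∷ tabulated
  ∷ tabulated
  ∷ tabulated
  ∷ tabulated
  ∷ tabulated
  ∷ tabulated
  ∷ tabulated
  ∷ tabulated
  ∷ tabulated
  ∷ tabulated
  ∷ tabulated
  ∷ tabulated
  ∷ tabulated
  ∷ tabulated
  ∷ tabulated
  ∷ []

eventually : ∀ t {m} → t ≤ m → 0 < Num oddPrimes × 8 * Num oddPrimes ≤ 2 ^ suc t * Den oddPrimes → HasPrimitiveTSR (suc m)
eventually t {m} t≤m (positive , check) = subst (λ m → HasPrimitiveTSR (suc m)) (m+[n∸m]≡n t≤m)
  (sufficient⇒TSR (t + k) (2^≡suc (suc t + k)) size
    (asymptotic oddPrimes (suc t) k oddPrimes-den≤num positive check size) (cover-all (t + k) size))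
  where
  k = m ∸ t
  size = 2^≡suc (2 * (suc t + k))

theorem6p3 : ∀ (m : ℕ) → 1 ≤ m →
    ∃[ c₀ ] ∃[ c₁ ] ∃[ A ] Primitive (charPoly (tsr m c₀ c₁ A)) (2 * m)
theorem6p3 (suc m) _ with <-≤-connex m 40
-- The matrix block has size `suc m`: `m < 40` is the tabulated range 1 to 40, and `40 ≤ m` provides
-- the exponent 41 of `asymptotic-constant`.
... | inj₁ m<40 = covered⇒TSR m (All.lookup {xs = applyUpTo suc 40} table (∈-applyUpTo⁺ suc m<40))
... | inj₂ 40≤m = eventually 40 40≤m asymptotic-constant
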